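{- Let $n\ge1$. As $\Sigma_n$-modules, the sign isotypic subspace $(\mathbb{C}\mathcal{F}_n)^{1^n}$ of the face algebra is isomorphic to $M_\lambda$, where $\lambda=(2^{n/2})$ if $n$ is even and $\lambda=(2^{(n-1)/2},1)$ if $n$ is odd.
   Context: **Face algebra.** $\mathcal{F}_n$ is the monoid of ordered set partitions of $[n]=\{1,\dots,n\}$ (faces of the braid arrangement) with product $(P_1,\dots,P_k)\cdot(Q_1,\dots,Q_\ell)=(P_1\cap Q_1,P_1\cap Q_2,\dots,P_1\cap Q_\ell,P_2\cap Q_1,\dots,P_k\cap Q_\ell)$ with empty sets removed; $\mathbb{C}\mathcal{F}_n$ is its monoid algebra. $S_n$ acts by $\pi(P_1,\dots,P_k)=(\pi(P_1),\dots,\pi(P_k))$, extended linearly; $(\mathbb{C}\mathcal{F}_n)^{S_n}$ is the invariant subalgebra, and $(\mathbb{C}\mathcal{F}_n)^{1^n}$ is the isotypic subspace for the sign character. $\Pi_n$ is the lattice of set partitions of $[n]$ ordered by refinement ($X\le Y$ iff $X$ refines $Y$), with its natural $S_n$-action; $\sigma:\mathcal{F}_n\to\Pi_n$ forgets the order of the blocks. For $\lambda\vdash n$, $X\in\lambda$ means that the block sizes of $X$ are the parts of $\lambda$. **Idempotents.** A cfpoi of an algebra is a complete family of primitive orthogonal idempotents (nonzero idempotents summing to $1$, with pairwise products $0$, none a sum of two nonzero orthogonal idempotents). Fix (following Saliola) a cfpoi $\{\widehat E_X:X\in\Pi_n\}$ of $\mathbb{C}\mathcal{F}_n$ with $\pi(\widehat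 E_X)=\widehat E_{\pi(X)}$ for $\pi\in S_n$ such that: $f\widehat E_X=0$ for $f\in\mathcal{F}_n$ with $\sigma(f)\not\ge X$; $\widehat E_X\in\mathrm{span}_{\mathbb{C}}\{f:\sigma(f)\le X\}$; and the coefficients in $\widehat E_X$ of the faces $f$ with $\sigma(f)=X$ sum to $1$ (such families exist). $\{E_\lambda:\lambda\vdash n\}$ is an arbitrary fixed cfpoi of $(\mathbb{C}\mathcal{F}_n)^{S_n}$, indexed so that for some invertible $u\in(\mathbb{C}\mathcal{F}_n)^{S_n}$ one has $E_\lambda=u\big(\sum_{X\in\lambda}\widehat E_X\big)u^{ -1}$ for all $\lambda$ (every cfpoi of $(\mathbb{C}\mathcal{F}_n)^{S_n}$ has this form). **Descent algebra.** $\Sigma_n\subseteq\mathbb{C}S_n$ is the subalgebra spanned by $x_J=\sum_{\pi:\mathrm{Des}(\pi)\subseteq J}\pi$, $J\subseteq[n-1]$, where $\mathrm{Des}(\pi)=\{i:\pi(i)>\pi(i+1)\}$. Bidigare's algebra antiisomorphism $\Phi:\Sigma_n\to(\mathbb{C}\mathcal{F}_n)^{S_n}$ sends $x_J$, $J=\{a_1<\dots<a_k\}$, to the sum of all faces whose successive block sizes are $(a_1,a_2-a_1,\dots,a_k-a_{k-1},n-a_k)$. $\mathbb{C}\mathcal{F}_n$ and its $S_n$-isotypic subspaces are right $\Sigma_n$-modules via $f\cdot x=\Phi(x)f$. $M_\lambda$ is the simple right $\Sigma_n$-module $P_\lambda/\mathrm{rad}(P_\lambda)$, where $P_\lambda=\Phi^{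 -1}(E_\lambda)\Sigma_n$; the $M_\lambda$ ($\lambda\vdash n$) are the simple $\Sigma_n$-modules up to isomorphism. -}

module Defs where

open import Level using (Level; _⊔_; 0ℓ) renaming (suc to lsuc)
open import Algebra.Apartness.Bundles using (HeytingField; HeytingCommutativeRing)
open import Algebra.Bundles using (CommutativeRing)
open import Algebra.Bundles.Raw using (RawMonoid; RawRing)
open import Algebra.Module.Bundles.Raw using (RawRightModule)
import Algebra.Definitions.RawSemiring as RawSemiringOps
open import Data.Bool.Properties using () renaming (_≟_ to _≟ᵇ_)
open import Data.Fin using (Fin; zero; suc; toℕ; inject₁; _<?_)
open import Data.Fin.Permutation as Perm using (Permutation′; _⟨$⟩ʳ_; _⟨$⟩ˡ_; _∘ₚ_)
open import Data.Fin.Properties using (all?) renaming (_≟_ to _≟ᶠ_)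
open import Data.Fin.Subset using (Subset; inside; outside; _∈_; _∩_; ⊤; ∣_∣; Nonempty; Empty)
  renaming (_⊆_ to _⊆ˢ_)
open import Data.Fin.Subset.Properties
  using (_∈?_; nonempty?; x∈p∩q⁺; x∈p∩q⁻; ∈⊤) renaming (_⊆?_ to _⊆ˢ?_)
open import Data.List as List
  using (List; []; _∷_; [_]; _++_; map; filter; mapMaybe; concatMap; foldr; length;
         replicate; upTo; allFin; cartesianProduct; cartesianProductWith; deduplicate)
open import Data.List.Properties using () renaming (≡-dec to List-≡-dec)
open import Data.List.Relation.Unary.All as All using (All; []; _∷_)
import Data.List.Relation.Unary.All.Properties as All
open import Data.List.Relation.Unary.AllPairs as AllPairs using (AllPairs; []; _∷_)
import Data.List.Relation.Unary.AllPairs.Properties as AllPairs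
open import Data.List.Relation.Unary.Any as Any using (Any; here)
import Data.List.Relation.Unary.Any.Properties as Any
open import Data.List.Relation.Unary.Linked as Linked using (Linked; []; [-]; _∷_)
import Data.List.Relation.Binary.Subset.DecPropositional as DecSubset
import Data.List.Sort as Sort
import Data.Maybe as Maybe
open import Data.Nat as ℕ using (ℕ; zero; suc; _∸_; _≥_; _/_; _%_; s≤s; z≤n)
open import Data.Nat.DivMod using (m≡m%n+[m/n]*n; m%n<n)
open import Data.Nat.ListAction using (sum)
open import Data.Nat.ListAction.Properties using (sum-++)
open import Data.Nat.Properties using (≤-decTotalOrder; ≤-refl; *-identityʳ; +-comm)
open import Data.Product using (_×_; _,_; ∃; ∃₂; proj₁; proj₂; map₁; map₂)
open import Data.Unit using () renaming (⊤ to Unit)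
open import Data.Sum using (inj₁; inj₂)
open import Data.Vec as Vec using (lookup; tabulate)
open import Data.Vec.Functional using (Vector)
open import Data.Vec.Properties using (lookup⇒[]=; []=⇒lookup; lookup∘tabulate)
  renaming (≡-dec to Vec-≡-dec)
open import Function using (_∘_)
open import Relation.Binary using (Rel; Decidable; DecidableEquality)
import Relation.Binary.Construct.Flip.EqAndOrd as Flip
open import Relation.Binary.PropositionalEquality as ≡ using (_≡_; refl; cong)
open import Relation.Nullary using (¬_; Dec; does; contradiction)
open import Relation.Nullary.Decidable using (dec⇒maybe; map′; _×-dec_; ¬?)
open import Relation.Unary using (Pred)
open import Data.Bool using (if_then_else_)

private variable
  a b c p q ℓ ℓ₁ ℓ₂ : Level
  n : ℕ

-- The complex numbers enter only through the properties of being an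
-- algebraically closed field of characteristic zero (a Heyting field is a field
-- with a tight apartness; classically every field is one).
CharacteristicZero : HeytingField c ℓ₁ ℓ₂ → Set ℓ₂
CharacteristicZero K = ∀ k → suc k ×ᴷ 1# # 0#
  where
  open HeytingField K using (_#_; 0#; 1#; heytingCommutativeRing)
  open CommutativeRing (HeytingCommutativeRing.commutativeRing heytingCommutativeRing)
    using (rawRing)
  open RawSemiringOps (RawRing.rawSemiring rawRing) using () renaming (_×_ to _×ᴷ_)

AlgebraicallyClosed : HeytingField c ℓ₁ ℓ₂ → Set (c ⊔ ℓ₁)
AlgebraicallyClosed K =
  ∀ d (a : Vector Carrier (suc d)) →
  ∃ λ x → x ^ suc d + Σ[ (λ i → a i * x ^ toℕ i) ] ≈ 0#
  where
  open HeytingField K using (Carrier; _≈_; _+_; _*_; 0#; heytingCommutativeRing)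
  open CommutativeRing (HeytingCommutativeRing.commutativeRing heytingCommutativeRing)
    using (rawRing)
  open RawSemiringOps (RawRing.rawSemiring rawRing) using (_^_) renaming (sum to Σ[_])

-- The monoid algebra of M over R: elements are formal linear combinations, equal when
-- every monoid element has the same coefficient in both.
module MonoidAlgebra (R : CommutativeRing c ℓ) (M : RawMonoid 0ℓ 0ℓ)
                     (_≟_ : Decidable (RawMonoid._≈_ M)) where

  private
    module R = CommutativeRing R
    module M = RawMonoid M

  Algebra : Set c
  Algebra = List (R.Carrier × M.Carrier)

  sumR : List R.Carrier → R.Carrier
  sumR = foldr R._+_ R.0#

  coeff : Algebra → M.Carrier → R.Carrier
  coeff u x = sumR (map (λ (r , y) → if does (y ≟ x) then r else R.0#) u)

  infix 4 _≈_
  _≈_ : Rel Algebra ℓ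
  u ≈ v = ∀ x → coeff u x R.≈ coeff v x

  infixr 7 _·_
  _·_ : R.Carrier → Algebra → Algebra
  r · u = map (map₁ (r R.*_)) u

  single : M.Carrier → Algebra
  single x = [ (R.1# , x) ]

  total : List M.Carrier → Algebra
  total = map (R.1# ,_)

  rawRing : RawRing c ℓ
  rawRing = record
    { Carrier = Algebra
    ; _≈_     = _≈_
    ; _+_     = _++_
    ; _*_     = cartesianProductWith (λ (r , x) (s , y) → r R.* s , x M.∙ y)
    ; -_      = map (map₁ (λ r → R.- r))
    ; 0#      = []
    ; 1#      = single M.ε
    }

  open RawRing rawRing public using (_+_; _*_; -_; 0#; 1#)

  lincomb : {I : Set} → List I → (I → R.Carrier) → (I → Algebra) → Algebra
  lincomb is r u = concatMap (λ i → r i · u i) is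

  Span : Pred M.Carrier 0ℓ → Pred Algebra (c ⊔ ℓ)
  Span P u = ∃ λ v → All (P ∘ proj₂) v × u ≈ v

-- B is the carrier of a subalgebra of A.
module Idempotents (A : RawRing a ℓ) (B : Pred (RawRing.Carrier A) b) where
  open RawRing A

  IsIdempotent : Pred Carrier ℓ
  IsIdempotent e = e * e ≈ e

  Orthogonal : Rel Carrier ℓ
  Orthogonal e f = e * f ≈ 0# × f * e ≈ 0#

  record IsPrimitive (e : Carrier) : Set (a ⊔ b ⊔ ℓ) where
    field
      nonzero        : ¬ (e ≈ 0#)
      idempotent     : IsIdempotent e
      indecomposable : ¬ (∃₂ λ f g → B f × B g
                            × ¬ (f ≈ 0#) × ¬ (g ≈ 0#)
                            × IsIdempotent f × IsIdempotent g
                            × Orthogonal f g × e ≈ f + g)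

  ∑ : {I : Set} → List I → (I → Carrier) → Carrier
  ∑ is e = foldr _+_ 0# (map e is)

  -- The index set is I modulo _∼_; `is` should list each index exactly once.
  record IsCFPOI {I : Set} (_∼_ : Rel I 0ℓ) (is : List I) (e : I → Carrier)
         : Set (a ⊔ b ⊔ ℓ) where
    field
      e-cong     : ∀ {i j} → i ∼ j → e i ≈ e j
      member     : ∀ i → B (e i)
      primitive′ : ∀ i → IsPrimitive (e i)
      orthogonal : ∀ {i j} → ¬ (i ∼ j) → e i * e j ≈ 0#
      complete   : ∑ is e ≈ 1#

module Submodules {R : Set c} (M : RawRightModule R a ℓ) where
  open RawRightModule M

  record IsSubmodule (N : Pred Carrierᴹ p) : Set (c ⊔ a ⊔ ℓ ⊔ p) where
    field
      resp     : ∀ {u v} → u ≈ᴹ v → N u → N v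
      0-closed : N 0ᴹ
      +-closed : ∀ {u v} → N u → N v → N (u +ᴹ v)
      -‿closed : ∀ {u} → N u → N (-ᴹ u)
      *-closed : ∀ {u} → N u → ∀ r → N (u *ᵣ r)

  -- N is maximal among the proper submodules of U (all at the level of U).
  record IsMaximalSubmodule (U N : Pred Carrierᴹ p) : Set (c ⊔ a ⊔ ℓ ⊔ lsuc p) where
    field
      isSubmodule : IsSubmodule N
      contained   : ∀ {u} → N u → U u
      proper      : ¬ (∀ {u} → U u → N u)
      maximal     : (N′ : Pred Carrierᴹ p) → IsSubmodule N′ →
                    (∀ {u} → N u → N′ u) → (∀ {u} → N′ u → U u) →
                    ¬ (∀ {u} → U u → N′ u) →
                    ∀ {u} → N′ u → N u

  -- The intersection of U with all maximal submodules of U.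
  rad : Pred Carrierᴹ p → Pred Carrierᴹ (c ⊔ a ⊔ ℓ ⊔ lsuc p)
  rad U u = U u × (∀ N → IsMaximalSubmodule U N → N u)

-- The module upper / lower, for submodules lower ⊆ upper of an ambient module.
-- That they are submodules is not part of the data.
record Subquotient (R : Set c) (a ℓ p q : Level) : Set (c ⊔ lsuc (a ⊔ ℓ ⊔ p ⊔ q)) where
  constructor subquotient
  field
    ambient : RawRightModule R a ℓ

  open RawRightModule ambient public

  field
    upper : Pred Carrierᴹ p
    lower : Pred Carrierᴹ q

  infix 4 _≡ᴹ_
  _≡ᴹ_ : Rel Carrierᴹ q
  u ≡ᴹ v = lower (u +ᴹ (-ᴹ v))

-- R-module isomorphisms, given on representatives: only the values of ⟦_⟧ on
-- M.upper matter.  K-linearity follows when R is a K-algebra acting unitally.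
record _≅_ {R : Set c} {a₁ a₂ ℓ₁ ℓ₂ p₁ p₂ q₁ q₂ : Level}
           (M : Subquotient R a₁ ℓ₁ p₁ q₁) (N : Subquotient R a₂ ℓ₂ p₂ q₂)
           : Set (c ⊔ a₁ ⊔ a₂ ⊔ p₁ ⊔ p₂ ⊔ q₁ ⊔ q₂) where
  private
    module M = Subquotient M
    module N = Subquotient N
  field
    ⟦_⟧        : M.Carrierᴹ → N.Carrierᴹ
    maps-into  : ∀ {u} → M.upper u → N.upper ⟦ u ⟧
    ⟦⟧-cong    : ∀ {u v} → M.upper u → M.upper v → u M.≡ᴹ v → ⟦ u ⟧ N.≡ᴹ ⟦ v ⟧
    +-homo     : ∀ {u v} → M.upper u → M.upper v → ⟦ u M.+ᴹ v ⟧ N.≡ᴹ (⟦ u ⟧ N.+ᴹ ⟦ v ⟧)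
    *-homo     : ∀ {u} → M.upper u → ∀ r → ⟦ u M.*ᵣ r ⟧ N.≡ᴹ (⟦ u ⟧ N.*ᵣ r)
    injective  : ∀ {u v} → M.upper u → M.upper v → ⟦ u ⟧ N.≡ᴹ ⟦ v ⟧ → u M.≡ᴹ v
    surjective : ∀ {v} → N.upper v → ∃ λ u → M.upper u × ⟦ u ⟧ N.≡ᴹ v

infix 4 _≅_

listsOfLength : {A : Set} → ℕ → List A → List (List A)
listsOfLength zero    xs = [ [] ]
listsOfLength (suc k) xs = cartesianProductWith _∷_ xs (listsOfLength k xs)

listsUpTo : {A : Set} → ℕ → List A → List (List A)
listsUpTo k xs = concatMap (λ i → listsOfLength i xs) (upTo (suc k))

allSubsets : ∀ n → List (Subset n)
allSubsets zero    = [ Vec.[] ]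
allSubsets (suc n) = cartesianProductWith Vec._∷_ (inside ∷ outside ∷ []) (allSubsets n)

allPermutations : ∀ n → List (Permutation′ n)
allPermutations zero    = [ Perm.id ]
allPermutations (suc n) =
  cartesianProductWith (Perm.insert zero) (allFin (suc n)) (allPermutations n)

_≟ˢ_ : DecidableEquality (Subset n)
_≟ˢ_ = Vec-≡-dec _≟ᵇ_

Disjoint : Rel (Subset n) 0ℓ
Disjoint P Q = Empty (P ∩ Q)

record IsOrderedSetPartition (Ps : List (Subset n)) : Set where
  constructor mkIsOSP
  field
    nonempty : All Nonempty Ps
    disjoint : AllPairs Disjoint Ps
    covers   : ∀ i → Any (i ∈_) Ps

isOrderedSetPartition? : (Ps : List (Subset n)) → Dec (IsOrderedSetPartition Ps)
isOrderedSetPartition? Ps =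
  map′ (λ (x , y , z) → mkIsOSP x y z) (λ (mkIsOSP x y z) → x , y , z)
    (All.all? nonempty? Ps
     ×-dec AllPairs.allPairs? (λ P Q → ¬? (nonempty? (P ∩ Q))) Ps
     ×-dec all? (λ i → Any.any? (i ∈?_) Ps))

-- The proof is irrelevant, so _≡_ on faces is equality of the lists of blocks.
record Face (n : ℕ) : Set where
  constructor mkFace
  field
    blocks                 : List (Subset n)
    .isOrderedSetPartition : IsOrderedSetPartition blocks

open Face public using (blocks)

_≟ᶠᵃᶜᵉ_ : DecidableEquality (Face n)
mkFace Ps _ ≟ᶠᵃᶜᵉ mkFace Qs _ =
  map′ (λ { refl → refl }) (cong blocks) (List-≡-dec _≟ˢ_ Ps Qs)

-- A face of [n] has at most n blocks.
allFaces : ∀ n → List (Face n)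
allFaces n =
  mapMaybe (λ Ps → Maybe.map (λ pf → mkFace Ps pf) (dec⇒maybe (isOrderedSetPartition? Ps)))
           (listsUpTo n (allSubsets n))

∩-disjoint₁ : ∀ {P P′ : Subset n} Q Q′ → Disjoint P P′ → Disjoint (P ∩ Q) (P′ ∩ Q′)
∩-disjoint₁ {P = P} {P′} Q Q′ d (i , i∈) with x∈p∩q⁻ (P ∩ Q) (P′ ∩ Q′) i∈
... | l , r = d (i , x∈p∩q⁺ (proj₁ (x∈p∩q⁻ P Q l) , proj₁ (x∈p∩q⁻ P′ Q′ r)))

∩-disjoint₂ : ∀ P P′ {Q Q′ : Subset n} → Disjoint Q Q′ → Disjoint (P ∩ Q) (P′ ∩ Q′)
∩-disjoint₂ P P′ {Q} {Q′} d (i , i∈) with x∈p∩q⁻ (P ∩ Q) (P′ ∩ Q′) i∈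
... | l , r = d (i , x∈p∩q⁺ (proj₂ (x∈p∩q⁻ P Q l) , proj₂ (x∈p∩q⁻ P′ Q′ r)))

product-disjoint : ∀ {Ps Qs : List (Subset n)} → AllPairs Disjoint Ps → AllPairs Disjoint Qs →
                   AllPairs Disjoint (cartesianProductWith _∩_ Ps Qs)
product-disjoint [] _ = []
product-disjoint {Ps = P ∷ Ps} {Qs} (dP ∷ dPs) dQs =
  AllPairs.++⁺
    (AllPairs.map⁺ (AllPairs.map (∩-disjoint₂ P P) dQs))
    (product-disjoint dPs dQs)
    (All.map⁺ (All.universal
      (λ Q → All.cartesianProductWith⁺ (≡.setoid _) (≡.setoid _) _∩_ Ps Qs
        (λ P′∈ _ → ∩-disjoint₁ Q _ (All.lookup dP P′∈)))
      Qs))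

filter-covers : ∀ {Ps : List (Subset n)} {i} → Any (i ∈_) Ps → Any (i ∈_) (filter nonempty? Ps)
filter-covers {i = i} i∈ with Any.filter⁺ nonempty? i∈
... | inj₁ i∈′ = i∈′
... | inj₂ ¬ne = contradiction (i , Any.lookup-result i∈) ¬ne

product-isOSP : ∀ {Ps Qs : List (Subset n)} →
                IsOrderedSetPartition Ps → IsOrderedSetPartition Qs →
                IsOrderedSetPartition (filter nonempty? (cartesianProductWith _∩_ Ps Qs))
product-isOSP {Ps = Ps} {Qs} (mkIsOSP _ dP cP) (mkIsOSP _ dQ cQ) = mkIsOSP
  (All.all-filter nonempty? (cartesianProductWith _∩_ Ps Qs))
  (AllPairs.filter⁺ nonempty? (product-disjoint dP dQ))
  (λ i → filter-covers
    (Any.cartesianProductWith⁺ _∩_ (λ x y → x∈p∩q⁺ (x , y)) (cP i) (cQ i)))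

⊤-isOSP : IsOrderedSetPartition [ ⊤ {suc n} ]
⊤-isOSP = mkIsOSP ((zero , ∈⊤) ∷ []) ([] ∷ []) (λ _ → here ∈⊤)

-- Only for n ≥ 1 is the one-block partition an identity face.
faceMonoid : ℕ → RawMonoid 0ℓ 0ℓ
faceMonoid m = record
  { Carrier = Face (suc m)
  ; _≈_     = _≡_
  ; _∙_     = λ (mkFace Ps p) (mkFace Qs q) →
                mkFace (filter nonempty? (cartesianProductWith _∩_ Ps Qs)) (product-isOSP p q)
  ; ε       = mkFace [ ⊤ ] ⊤-isOSP
  }

image : Permutation′ n → Subset n → Subset n
image π P = tabulate (λ i → lookup P (π ⟨$⟩ˡ i))

image⁺ : ∀ (π : Permutation′ n) P {i} → (π ⟨$⟩ˡ i) ∈ P → i ∈ image π P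
image⁺ π P {i} i∈ = lookup⇒[]= i _ (≡.trans (lookup∘tabulate _ i) ([]=⇒lookup i∈))

image⁻ : ∀ (π : Permutation′ n) P {i} → i ∈ image π P → (π ⟨$⟩ˡ i) ∈ P
image⁻ π P {i} i∈ = lookup⇒[]= _ P (≡.trans (≡.sym (lookup∘tabulate _ i)) ([]=⇒lookup i∈))

image-isOSP : ∀ (π : Permutation′ n) {Ps} →
              IsOrderedSetPartition Ps → IsOrderedSetPartition (map (image π) Ps)
image-isOSP π {Ps} (mkIsOSP ne d c) = mkIsOSP
  (All.map⁺ (All.map (λ {P} (i , i∈) → (π ⟨$⟩ʳ i) ,
     image⁺ π P (≡.subst (_∈ P) (≡.sym (Perm.inverseˡ π)) i∈)) ne))
  (AllPairs.map⁺ (AllPairs.map (λ {P} {Q} dPQ (i , i∈) →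
     let l , r = x∈p∩q⁻ (image π P) (image π Q) i∈
     in dPQ ((π ⟨$⟩ˡ i) , x∈p∩q⁺ (image⁻ π P l , image⁻ π Q r))) d))
  (λ i → Any.map⁺ (Any.map (λ {P} → image⁺ π P) (c (π ⟨$⟩ˡ i))))

infixr 8 _◃_
_◃_ : Permutation′ n → Face n → Face n
π ◃ mkFace Ps p = mkFace (map (image π) Ps) (image-isOSP π p)

-- Π n is the set of ordered set partitions modulo _≈Π_, which forgets the
-- order of the blocks; the map σ is the identity on representatives.
Π : ℕ → Set
Π = Face

σ : Face n → Π n
σ f = f

module _ {n : ℕ} where
  open DecSubset (_≟ˢ_ {n}) using (_⊆_; _⊆?_)

  infix 4 _≈Π_ _≈Π?_ _≤Π_
  _≈Π_ : Rel (Π n) 0ℓ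
  X ≈Π Y = blocks X ⊆ blocks Y × blocks Y ⊆ blocks X

  _≈Π?_ : Decidable _≈Π_
  X ≈Π? Y = (blocks X ⊆? blocks Y) ×-dec (blocks Y ⊆? blocks X)

  _≤Π_ : Rel (Π n) 0ℓ
  X ≤Π Y = All (λ P → Any (P ⊆ˢ_) (blocks Y)) (blocks X)

-- One representative of each set partition.
allSetPartitions : ∀ n → List (Π n)
allSetPartitions n = deduplicate _≈Π?_ (allFaces n)

record IsPartition (n : ℕ) (ks : List ℕ) : Set where
  constructor mkIsPartition
  field
    positive   : All (ℕ._> 0) ks
    decreasing : Linked _≥_ ks
    sums       : sum ks ≡ n

isPartition? : ∀ n ks → Dec (IsPartition n ks)
isPartition? n ks =
  map′ (λ (x , y , z) → mkIsPartition x y z) (λ (mkIsPartition x y z) → x , y , z)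
    (All.all? (ℕ._>? 0) ks ×-dec Linked.linked? ℕ._≥?_ ks ×-dec (sum ks ℕ.≟ n))

record Partition (n : ℕ) : Set where
  constructor mkPartition
  field
    parts        : List ℕ
    .isPartition : IsPartition n parts

open Partition public using (parts)

allPartitions : ∀ n → List (Partition n)
allPartitions n =
  mapMaybe (λ ks → Maybe.map (λ pf → mkPartition ks pf) (dec⇒maybe (isPartition? n ks)))
           (listsUpTo n (upTo (suc n)))

module Descending = Sort (Flip.decTotalOrder ≤-decTotalOrder)

blockSizes : Face n → List ℕ
blockSizes f = map ∣_∣ (blocks f)

infix 4 _∈Λ_ _∈Λ?_
_∈Λ_ : Π n → Partition n → Set
X ∈Λ λ′ = Descending.sort (blockSizes X) ≡ parts λ′

_∈Λ?_ : Decidable (_∈Λ_ {n})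
X ∈Λ? λ′ = List-≡-dec ℕ._≟_ _ _

sum-replicate : ∀ k x → sum (replicate k x) ≡ k ℕ.* x
sum-replicate zero    x = refl
sum-replicate (suc k) x = cong (x ℕ.+_) (sum-replicate k x)

Linked-replicate : ∀ k x ys → Linked _≥_ (x ∷ ys) → Linked _≥_ (replicate k x ++ ys)
Linked-replicate zero          x ys l = Linked.tail l
Linked-replicate (suc zero)    x ys l = l
Linked-replicate (suc (suc k)) x ys l = ≤-refl ∷ Linked-replicate (suc k) x ys l

2-ones : ∀ r → r ℕ.< 2 → Linked _≥_ (2 ∷ replicate r 1)
2-ones zero       _ = [-]
2-ones (suc zero) _ = s≤s z≤n ∷ [-]
2-ones (suc (suc r)) (s≤s (s≤s ()))

twos-isPartition : ∀ n → IsPartition n (replicate (n / 2) 2 ++ replicate (n % 2) 1)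
twos-isPartition n = mkIsPartition
  (All.++⁺ (All.replicate⁺ (n / 2) (s≤s z≤n)) (All.replicate⁺ (n % 2) (s≤s z≤n)))
  (Linked-replicate (n / 2) 2 _ (2-ones (n % 2) (m%n<n n 2)))
  (begin
    sum (replicate (n / 2) 2 ++ replicate (n % 2) 1)        ≡⟨ sum-++ (replicate (n / 2) 2) _ ⟩
    sum (replicate (n / 2) 2) ℕ.+ sum (replicate (n % 2) 1)
      ≡⟨ ≡.cong₂ ℕ._+_ (sum-replicate (n / 2) 2) (sum-replicate (n % 2) 1) ⟩
    n / 2 ℕ.* 2 ℕ.+ n % 2 ℕ.* 1                             ≡⟨ cong (n / 2 ℕ.* 2 ℕ.+_) (*-identityʳ (n % 2)) ⟩
    n / 2 ℕ.* 2 ℕ.+ n % 2                                   ≡⟨ +-comm (n / 2 ℕ.* 2) (n % 2) ⟩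
    n % 2 ℕ.+ n / 2 ℕ.* 2                                   ≡⟨ m≡m%n+[m/n]*n n 2 ⟨
    n                                                       ∎)
  where open ≡.≡-Reasoning

twosPartition : ∀ n → Partition n
twosPartition n = mkPartition (replicate (n / 2) 2 ++ replicate (n % 2) 1) (twos-isPartition n)

-- Composition is that of functions: (π ∙ ρ)(i) = π(ρ(i)).
permutationMonoid : ℕ → RawMonoid 0ℓ 0ℓ
permutationMonoid n = record
  { Carrier = Permutation′ n
  ; _≈_     = Perm._≈_
  ; _∙_     = λ π ρ → ρ ∘ₚ π
  ; ε       = Perm.id
  }

_≟ᵖ_ : Decidable (Perm._≈_ {n} {n})
π ≟ᵖ ρ = all? (λ i → (π ⟨$⟩ʳ i) ≟ᶠ (ρ ⟨$⟩ʳ i))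

inversions : Permutation′ n → List (Fin n × Fin n)
inversions {n} π =
  filter (λ (i , j) → (i <? j) ×-dec ((π ⟨$⟩ʳ j) <? (π ⟨$⟩ʳ i)))
         (cartesianProduct (allFin n) (allFin n))

-- The index i : Fin m stands for the position i + 1 ∈ [m], so that Subset m
-- is the set of subsets of [n - 1] with n = m + 1.
Des : ∀ {m} → Permutation′ (suc m) → Subset m
Des π = tabulate (λ i → does ((π ⟨$⟩ʳ suc i) <? (π ⟨$⟩ʳ inject₁ i)))

elements : ∀ {m} → Subset m → List ℕ
elements {m} J = map (suc ∘ toℕ) (filter (_∈? J) (allFin m))

gaps : ℕ → List ℕ → ℕ → List ℕ
gaps a []       n = [ n ∸ a ]
gaps a (b ∷ bs) n = (b ∸ a) ∷ gaps b bs n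

composition : ∀ {m} → Subset m → List ℕ
composition {m} J = gaps 0 (elements J) (suc m)

-- Throughout, [n] is Fin N with n = N = m + 1.
module FaceAlgebra (K : HeytingField c ℓ₁ ℓ₂) (m : ℕ) where

  private
    R : CommutativeRing c ℓ₁
    R = HeytingCommutativeRing.commutativeRing (HeytingField.heytingCommutativeRing K)

    module K = CommutativeRing R

  open RawSemiringOps (RawRing.rawSemiring K.rawRing) using (_^_)

  N : ℕ
  N = suc m

  module KF = MonoidAlgebra R (faceMonoid m) _≟ᶠᵃᶜᵉ_
  module KS = MonoidAlgebra R (permutationMonoid N) _≟ᵖ_

  infixr 8 _•_
  _•_ : Permutation′ N → KF.Algebra → KF.Algebra
  π • u = map (map₂ (π ◃_)) u

  sgn : Permutation′ N → K.Carrier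
  sgn π = (K.- K.1#) ^ length (inversions π)

  Invariant : Pred KF.Algebra ℓ₁
  Invariant u = ∀ π → π • u KF.≈ u

  SignIsotypic : Pred KF.Algebra ℓ₁
  SignIsotypic u = ∀ π → π • u KF.≈ sgn π KF.· u

  -- An element of the descent algebra is given by its coefficients on the x J; it
  -- denotes the element ι d of the group algebra.  The x J being linearly
  -- independent, ι d determines d, and so the value Φ d.
  x : Subset m → KS.Algebra
  x J = KS.total (filter (λ π → Des π ⊆ˢ? J) (allPermutations N))

  Σₙ : Set c
  Σₙ = Subset m → K.Carrier

  ι : Σₙ → KS.Algebra
  ι d = KS.lincomb (allSubsets m) d x

  Φ : Σₙ → KF.Algebra
  Φ d = KF.lincomb (allSubsets m) d
          (λ J → KF.total (filter (λ f → List-≡-dec ℕ._≟_ (blockSizes f) (composition J))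
                                  (allFaces N)))

  faceModule : RawRightModule Σₙ c ℓ₁
  faceModule = record
    { Carrierᴹ = KF.Algebra
    ; _≈ᴹ_     = KF._≈_
    ; _+ᴹ_     = KF._+_
    ; _*ᵣ_     = λ f d → Φ d KF.* f
    ; 0ᴹ       = KF.0#
    ; -ᴹ_      = KF.-_
    }

  groupModule : RawRightModule Σₙ c ℓ₁
  groupModule = record
    { Carrierᴹ = KS.Algebra
    ; _≈ᴹ_     = KS._≈_
    ; _+ᴹ_     = KS._+_
    ; _*ᵣ_     = λ u d → u KS.* ι d
    ; 0ᴹ       = KS.0#
    ; -ᴹ_      = KS.-_
    }

  module WholeAlgebra     = Idempotents KF.rawRing (λ _ → Unit)
  module InvariantAlgebra = Idempotents KF.rawRing Invariant

  record IsSaliolaFamily (Ê : Π N → KF.Algebra) : Set (c ⊔ ℓ₁) where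
    field
      isCFPOI     : WholeAlgebra.IsCFPOI _≈Π_ (allSetPartitions N) Ê
      equivariant : ∀ π X → π • Ê X KF.≈ Ê (π ◃ X)
      annihilated : ∀ f X → ¬ (X ≤Π σ f) → KF.single f KF.* Ê X KF.≈ KF.0#
      supported   : ∀ X → KF.Span (λ f → σ f ≤Π X) (Ê X)
      normalised  : ∀ X → KF.sumR (map (KF.coeff (Ê X)) (filter (λ f → σ f ≈Π? X) (allFaces N)))
                          K.≈ K.1#

  record IsInvariantFamily (Ê : Π N → KF.Algebra) (E : Partition N → KF.Algebra)
         : Set (c ⊔ ℓ₁) where
    field
      isCFPOI   : InvariantAlgebra.IsCFPOI _≡_ (allPartitions N) E
      u u⁻¹     : KF.Algebra
      u-inv     : Invariant u
      u⁻¹-inv   : Invariant u⁻¹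
      uu⁻¹      : u KF.* u⁻¹ KF.≈ KF.1#
      u⁻¹u      : u⁻¹ KF.* u KF.≈ KF.1#
      conjugate : ∀ μ → E μ KF.≈
        u KF.* WholeAlgebra.∑ (filter (_∈Λ? μ) (allSetPartitions N)) Ê KF.* u⁻¹

  signIsotypic : Subquotient Σₙ c ℓ₁ ℓ₁ ℓ₁
  signIsotypic = subquotient faceModule SignIsotypic (KF._≈ KF.0#)

  -- The right ideal Φ⁻¹(e) Σₙ of Σₙ.
  P : KF.Algebra → Pred KS.Algebra (c ⊔ ℓ₁)
  P e a = ∃₂ λ d s → Φ d KF.≈ e × a KS.≈ ι d KS.* ι s

  M : KF.Algebra → Subquotient Σₙ c ℓ₁ (c ⊔ ℓ₁) (lsuc (c ⊔ ℓ₁))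
  M e = subquotient groupModule (P e) (Submodules.rad groupModule (P e))

-- A sign isotypic u has coefficient 0 at any face fixed by a transposition, so it is a multiple of
-- s₀ = ∑ sgn(w) w c₀, where c₀ = ({1}, …, {n}).  The chambers span a copy of ℂSₙ on which the
-- invariant element Φ(d) acts as right multiplication by d (Bidigare).  Hence d acts on s₀ by the
-- scalar ψ(d), for ψ the sign character of ℂSₙ.
--
-- Let Y have type λ = (2, …, 2[, 1]) and let χ(v) be the sum of the coefficients in v of the faces
-- f ≥ Y.  Then ψ(v) = χ(v) for invariant v: the signed sum defining ψ cancels over the faces that
-- separate the two elements i, j of a block of Y, because (i j) preserves v and reverses the sign;
-- and the sign is + on the faces f ≥ Y, which permute blocks of even size around at most one point.
-- As Ê_Y v Ê_Y = χ(v) Ê_Y, and Ê_X v Ê_Y = 0 for distinct X and Y of type λ, it follows that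
-- E_λ v E_λ = ψ(v) E_λ.  So e = Φ⁻¹(E_λ) satisfies e x e = ψ(x) e in Σₙ, the kernel of ψ on eΣₙ is its
-- only maximal submodule, and u ↦ (coefficient of c₀ in u) e is the isomorphism.

module Submission where

open import Algebra.Apartness.Bundles using (HeytingCommutativeRing; HeytingField)
open import Algebra.Bundles using (CommutativeRing; Ring)
open import Algebra.Bundles.Raw using (RawMonoid; RawRing)
import Algebra.Definitions.RawSemiring as RawSemiringOps
import Algebra.Properties.CommutativeMonoid.Sum as Sum
import Algebra.Properties.CommutativeSemigroup as CommutativeSemigroupProperties
import Algebra.Properties.Ring as RingProperties
import Algebra.Solver.Monoid as MonoidSolver
open import Algebra.Structures using (IsMonoid; IsRing)
open import Data.Bool
  using (Bool; _xor_; _∧_; _∨_; false; if_then_else_; not; true)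
  renaming (_≟_ to _≟ᵇ_)
open import Data.Bool.Properties
  using (not-injective; not-involutive; xor-assoc; xor-comm; xor-identityʳ; xor-same;
         xor-∧-commutativeRing; ∧-comm; ∧-distribʳ-xor; ∧-identityʳ; ∧-zeroʳ; ∨-identityʳ;
         ∨-zeroʳ)
open import Data.Fin using (Fin; _<?_; fromℕ<; inject₁; punchIn; punchOut; suc; toℕ; zero)
open import Data.Fin.Induction using (<-weakInduction)
open import Data.Fin.Permutation as Perm
  using (Permutation′; _∘ₚ_; _⟨$⟩ʳ_; _⟨$⟩ˡ_; flip; insert; insert-punchIn; insert-remove;
         inverseʳ; inverseˡ; permutation; remove; transpose)
open import Data.Fin.Properties
  using (<-asym; <-cmp; <-irrefl; all?; any?; fromℕ<-injective; injective⇒≤; punchIn-injective;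
         punchOut-injective; suc-injective; toℕ-fromℕ<; toℕ-injective; toℕ-inject₁)
  renaming (_≟_ to _≟ᶠ_)
open import Data.Fin.Subset
  using (Nonempty; Subset; _-_; _∈_; _∩_; inside; outside; ⁅_⁆; ∣_∣; ⊤; ⊥)
  renaming (_⊆_ to _⊆ˢ_)
open import Data.Fin.Subset.Properties
  using (_∈?_; nonempty?; p⊂q⇒∣p∣<∣q∣; p⊆q⇒∣p∣≤∣q∣; x∈p⇒∣p-x∣<∣p∣; x∈p∧x≢y⇒x∈p-y; x∈p∩q⁺; x∈⁅x⁆;
         ∈⊤; ∣⁅x⁆∣≡1; ∣⊤∣≡n; ∣⊥∣≡0)
  renaming (_⊆?_ to _⊆ˢ?_)
open import Data.List as List
  using (List; []; [_]; _++_; _∷_; allFin; cartesianProduct; cartesianProductWith; concatMap;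
         deduplicate; filter; foldr; length; map; mapMaybe; replicate; upTo)
open import Data.List.Membership.Propositional as Membership using () renaming (_∈_ to _∈ˡ_)
open import Data.List.Membership.Propositional.Properties
  using (∈-allFin; ∈-cartesianProductWith⁺; ∈-cartesianProductWith⁻; ∈-concat⁺′; ∈-filter⁺;
         ∈-lookup; ∈-map⁺; ∈-map⁻; ∈-upTo⁺)
open import Data.List.Properties
  using (map-++; map-cong; map-tabulate; map-∘; ∷-injective; ∷-injectiveʳ)
  renaming (≡-dec to List-≡-dec)
open import Data.List.Relation.Binary.Permutation.Propositional using (_↭_; ↭⇒↭ₛ)
open import Data.List.Relation.Binary.Permutation.Propositional.Properties using (All-resp-↭)
import Data.List.Relation.Binary.Permutation.Setoid.Properties as PermutationS
open import Data.List.Relation.Unary.All as All using (All; []; _∷_)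
import Data.List.Relation.Unary.All.Properties as All
open import Data.List.Relation.Unary.AllPairs as AllPairs using (AllPairs; []; _∷_)
import Data.List.Relation.Unary.AllPairs.Properties as AllPairs
open import Data.List.Relation.Unary.Any as Any using (Any; here; there)
import Data.List.Relation.Unary.Any.Properties as Any
open import Data.List.Relation.Unary.Unique.DecSetoid.Properties using (deduplicate-!)
open import Data.List.Relation.Unary.Unique.Propositional using (Unique)
import Data.List.Relation.Unary.Unique.Propositional.Properties as Unique
import Data.List.Relation.Unary.Unique.Setoid.Properties as UniqueS
import Data.Maybe as Maybe
open import Data.Nat as ℕ using (_%_; _/_; _<_; _∸_; _≤_; suc; s≤s; zero; z≤n; ℕ)
open import Data.Nat.DivMod using (m%n<n)
open import Data.Nat.Properties as ℕ
  using (<⇒≤; <⇒≱; m≤n⇒m<n∨m≡n; n≮n; ≤-antisym; ≤-reflexive; ≤-trans; ≰⇒>)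
open import Data.Product using (_,_; _×_; map₂; proj₁; proj₂; ∃; ∃₂)
open import Data.Sum using (_⊎_; inj₁; inj₂)
open import Data.Vec as Vec using (here; lookup; tabulate; there)
open import Data.Vec.Properties as Vec
  using ([]=⇒lookup; lookup-replicate; lookup-zipWith; lookup⇒[]=; lookup∘tabulate;
         tabulate-cong; tabulate∘lookup)
open import Function using (_∘_; id)
open import Level using (0ℓ; Level; _⊔_)
open import Relation.Binary using (DecSetoid; Decidable; Setoid; _Preserves_⟶_; tri<; tri>; tri≈)
open import Relation.Binary.PropositionalEquality as ≡ using (_≡_; cong; cong₂; refl; subst; subst₂)
import Relation.Binary.Reasoning.Setoid as SetoidReasoning
open import Relation.Nullary using (Dec; contradiction; does; no; yes; ¬_)
open import Relation.Nullary.Decidable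
  using (_×-dec_; _→-dec_; dec-false; dec-true; decidable-stable; dec⇒maybe; recompute; ¬?)
open import Relation.Unary using (Pred) renaming (Decidable to Decidable₁)
open import Defs

-- Signed sums over lists of blocks are awkward, so a face is handled as the total preorder it
-- defines: products become lexicographic refinement, and identities between faces are checked on
-- pairs of points. The sign of a face is the parity of the pairs that it orders strictly against a
-- reference chamber. Ties count for nothing, which is why a face `f` and the chamber `f c₀` have
-- the same sign. That this extension of the sign to faces is multiplicative on invariant elements
-- cannot be read off its formula. It comes from the group algebra through Bidigare's map, and it
-- makes the conjugation by `u` harmless. The cancellation over separating faces relies on a
-- reference chamber in which paired points are adjacent; invariance of `v` permits the change of
-- chamber. Equality in the field is not decidable. Where a classical argument would distinguish
-- zero from nonzero, apartness takes over: cotransitivity yields ψ(e) = 1, and tightness yields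
-- membership in the kernel of ψ.

private variable
  a b : Level
  n m : ℕ
  A : Set a
  B : Set b

-- Finite sums indexed by lists

module ListSum {c ℓ} (R : CommutativeRing c ℓ) where
  open CommutativeRing R renaming (refl to ≈-refl)
  open CommutativeSemigroupProperties +-commutativeSemigroup using (interchange)
  open SetoidReasoning setoid

  ∑ : List A → (A → Carrier) → Carrier
  ∑ xs f = foldr _+_ 0# (map f xs)

  [_]ᵇ : Bool → Carrier
  [ b ]ᵇ = if b then 1# else 0#

  ∑-congᴬ : ∀ {xs : List A} {f g : A → Carrier} → All (λ x → f x ≈ g x) xs → ∑ xs f ≈ ∑ xs g
  ∑-congᴬ []       = ≈-refl
  ∑-congᴬ (p ∷ ps) = +-cong p (∑-congᴬ ps)

  ∑-cong : ∀ (xs : List A) {f g : A → Carrier} → (∀ x → f x ≈ g x) → ∑ xs f ≈ ∑ xs g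
  ∑-cong xs p = ∑-congᴬ (All.universal p xs)

  ∑-zero : ∀ (xs : List A) → ∑ xs (λ _ → 0#) ≈ 0#
  ∑-zero []       = ≈-refl
  ∑-zero (x ∷ xs) = trans (+-identityˡ _) (∑-zero xs)

  ∑-+ : ∀ (xs : List A) (f g : A → Carrier) → ∑ xs (λ x → f x + g x) ≈ ∑ xs f + ∑ xs g
  ∑-+ []       f g = sym (+-identityˡ _)
  ∑-+ (x ∷ xs) f g = trans (+-congˡ (∑-+ xs f g)) (interchange _ _ _ _)

  ∑-*ˡ : ∀ (xs : List A) k (f : A → Carrier) → ∑ xs (λ x → k * f x) ≈ k * ∑ xs f
  ∑-*ˡ []       k f = sym (zeroʳ k)
  ∑-*ˡ (x ∷ xs) k f = trans (+-congˡ (∑-*ˡ xs k f)) (sym (distribˡ k _ _))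

  ∑-++ : ∀ (xs ys : List A) (f : A → Carrier) → ∑ (xs ++ ys) f ≈ ∑ xs f + ∑ ys f
  ∑-++ []       ys f = sym (+-identityˡ _)
  ∑-++ (x ∷ xs) ys f = trans (+-congˡ (∑-++ xs ys f)) (sym (+-assoc _ _ _))

  ∑-map : ∀ (h : A → B) (xs : List A) (f : B → Carrier) → ∑ (map h xs) f ≡ ∑ xs (f ∘ h)
  ∑-map h xs f = ≡.cong (foldr _+_ 0#) (≡.sym (map-∘ xs))

  ∑-concatMap : ∀ (h : A → List B) (xs : List A) (f : B → Carrier) →
                ∑ (concatMap h xs) f ≈ ∑ xs (λ x → ∑ (h x) f)
  ∑-concatMap h []       f = ≈-refl
  ∑-concatMap h (x ∷ xs) f = trans (∑-++ (h x) _ f) (+-congˡ (∑-concatMap h xs f))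

  ∑-swap : ∀ (xs : List A) (ys : List B) (f : A → B → Carrier) →
           ∑ xs (λ x → ∑ ys (f x)) ≈ ∑ ys (λ y → ∑ xs (λ x → f x y))
  ∑-swap []       ys f = sym (∑-zero ys)
  ∑-swap (x ∷ xs) ys f = trans (+-congˡ (∑-swap xs ys f)) (sym (∑-+ ys _ _))

  -- Used to evaluate a product of two algebra elements with the right factor outermost, as is
  -- needed where left and right multiplication are compared.
  ∑-fubini : ∀ (u : List (Carrier × A)) (v : List (Carrier × B)) (f : A → B → Carrier) →
             ∑ u (λ (r , x) → r * ∑ v (λ (s , y) → s * f x y)) ≈
             ∑ v (λ (s , y) → s * ∑ u (λ (r , x) → r * f x y))
  ∑-fubini u v f = begin
    ∑ u (λ (r , x) → r * ∑ v (λ (s , y) → s * f x y))  ≈⟨ ∑-cong u (λ (r , x) → ∑-*ˡ v r _) ⟨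
    ∑ u (λ (r , x) → ∑ v (λ (s , y) → r * (s * f x y)))  ≈⟨ ∑-swap u v _ ⟩
    ∑ v (λ (s , y) → ∑ u (λ (r , x) → r * (s * f x y)))
      ≈⟨ ∑-cong v (λ (s , y) → trans (∑-cong u (λ (r , x) → x∙yz≈y∙xz r s _)) (∑-*ˡ u s _)) ⟩
    ∑ v (λ (s , y) → s * ∑ u (λ (r , x) → r * f x y))  ∎
    where open CommutativeSemigroupProperties *-commutativeSemigroup using (x∙yz≈y∙xz)

  ∑-filter : ∀ {p} {P : Pred A p} (P? : Decidable₁ P) xs (f : A → Carrier) →
             ∑ (filter P? xs) f ≈ ∑ xs (λ x → [ does (P? x) ]ᵇ * f x)
  ∑-filter P? []       f = ≈-refl
  ∑-filter P? (x ∷ xs) f with does (P? x)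
  ... | true  = +-cong (sym (*-identityˡ _)) (∑-filter P? xs f)
  ... | false = trans (∑-filter P? xs f) (sym (trans (+-congʳ (zeroˡ _)) (+-identityˡ _)))

  -- A sum with a single nonzero term, stated for a list of representatives of a relation.
  ∑-δ : ∀ {r} {_∼_ : A → A → Set r} (f g : A → Carrier) {x} {xs : List A} →
        AllPairs (λ y z → ¬ y ∼ z) xs → Any (x ∼_) xs →
        (∀ {y z} → x ∼ y → x ∼ z → y ∼ z) → (∀ {y z} → x ∼ y → x ∼ z → z ∼ y) →
        (∀ y → x ∼ y → f y ≈ g x) → (∀ y → ¬ x ∼ y → f y ≈ 0#) → ∑ xs f ≈ g x
  ∑-δ f g {x} {y ∷ xs} (y≁ ∷ _) (here x∼y) euc _ on off = begin
    f y + ∑ xs f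
      ≈⟨ +-cong (on y x∼y) (∑-congᴬ (All.map (λ {z} ¬y∼z → off z (λ x∼z → ¬y∼z (euc x∼y x∼z))) y≁)) ⟩
    g x + ∑ xs (λ _ → 0#)  ≈⟨ +-congˡ (∑-zero xs) ⟩
    g x + 0#  ≈⟨ +-identityʳ _ ⟩
    g x  ∎
  ∑-δ f g {x} {y ∷ xs} (y≁ ∷ u) (there x∈) euc euc′ on off = begin
    f y + ∑ xs f  ≈⟨ +-cong (off y λ x∼y → All.lookupWith (λ ¬y∼z x∼z → ¬y∼z (euc x∼y x∼z)) y≁ x∈)
                            (∑-δ f g u x∈ euc euc′ on off) ⟩
    0# + g x  ≈⟨ +-identityˡ _ ⟩
    g x  ∎

-- Monoid algebras, tested by linear functionals

module MonoidAlgebraProperties {c ℓ} (R : CommutativeRing c ℓ) (M : RawMonoid 0ℓ 0ℓ)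
    (isMonoid : IsMonoid (RawMonoid._≈_ M) (RawMonoid._∙_ M) (RawMonoid.ε M))
    (_≟_ : Decidable (RawMonoid._≈_ M)) where

  open RawMonoid M using (_∙_; ε) renaming (Carrier to X; _≈_ to _≈ˣ_)
  open MonoidAlgebra R M _≟_
  open ListSum R public
  private
    module R = CommutativeRing R
    module M = IsMonoid isMonoid
    open R using () renaming (Carrier to K; _≈_ to _≈ᴷ_; _+_ to _+ᴷ_; _*_ to _*ᴷ_; -_ to -ᴷ_)
    open SetoidReasoning R.setoid
    module RP = RingProperties R.ring

  Functional : (X → K) → Set ℓ
  Functional φ = φ Preserves _≈ˣ_ ⟶ _≈ᴷ_

  -- The linear extension of `φ`. Coefficients of a product are cumbersome, whereas its pairings are
  -- nested pairings of the factors; identities in the algebra are therefore proved against all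
  -- functionals at once.
  ⟨_,_⟩ : (X → K) → Algebra → K
  ⟨ φ , u ⟩ = ∑ u (λ (r , x) → r *ᴷ φ x)

  opaque
    -- Opaque, so that the decision procedure does not unfold in goals; the lemmas of this block are
    -- its interface.
    δ : X → X → K
    δ x y = [ does (y ≟ x) ]ᵇ

    δ-≈ : ∀ {x y} → x ≈ˣ y → δ x y ≈ᴷ R.1#
    δ-≈ {x} {y} p = R.reflexive (≡.cong [_]ᵇ (dec-true (y ≟ x) (M.sym p)))

    δ-≉ : ∀ {x y} → ¬ x ≈ˣ y → δ x y ≈ᴷ R.0#
    δ-≉ {x} {y} p = R.reflexive (≡.cong [_]ᵇ (dec-false (y ≟ x) (p ∘ M.sym)))

    coeff-δ : ∀ u x → coeff u x ≈ᴷ ⟨ δ x , u ⟩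
    coeff-δ u x = ∑-cong u λ (r , y) → pointwise r (does (y ≟ x))
      where
      pointwise : ∀ r b → (if b then r else R.0#) ≈ᴷ r *ᴷ [ b ]ᵇ
      pointwise r true  = R.sym (R.*-identityʳ r)
      pointwise r false = R.sym (R.zeroʳ r)

  δ-⇔ : ∀ {x y x′ y′} → (x ≈ˣ y → x′ ≈ˣ y′) → (x′ ≈ˣ y′ → x ≈ˣ y) → δ x y ≈ᴷ δ x′ y′
  δ-⇔ {x} {y} f g with x ≟ y
  ... | yes x≈y = R.trans (δ-≈ x≈y) (R.sym (δ-≈ (f x≈y)))
  ... | no  x≉y = R.trans (δ-≉ x≉y) (R.sym (δ-≉ (x≉y ∘ g)))

  δ-functional : ∀ x → Functional (δ x)
  δ-functional x y≈z = δ-⇔ (λ x≈y → M.trans x≈y y≈z) (λ x≈z → M.trans x≈z (M.sym y≈z))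

  private
    decSetoid : DecSetoid 0ℓ 0ℓ
    decSetoid = record
      { isDecEquivalence = record { isEquivalence = M.isEquivalence ; _≟_ = _≟_ } }

    -- A formal combination may list the same monoid element several times. Collecting its terms
    -- along a list of representatives leaves only coefficients, which is what equality in the
    -- algebra controls.
    ⟨⟩-support : ∀ {φ} → Functional φ → ∀ {S} → AllPairs (λ x y → ¬ x ≈ˣ y) S →
                 ∀ u → All (λ (_ , x) → Any (x ≈ˣ_) S) u →
                 ⟨ φ , u ⟩ ≈ᴷ ∑ S (λ x → coeff u x *ᴷ φ x)
    ⟨⟩-support {φ} φ-cong {S} S! [] [] = R.sym (R.trans (∑-cong S (λ x → R.zeroˡ _)) (∑-zero S))
    ⟨⟩-support {φ} φ-cong {S} S! ((r , x) ∷ u) (x∈ ∷ u⊆) = begin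
      r *ᴷ φ x +ᴷ ⟨ φ , u ⟩
        ≈⟨ R.+-cong
             (R.sym (∑-δ (λ y → (if does (x ≟ y) then r else R.0#) *ᴷ φ y) (λ y → r *ᴷ φ y)
               {x} S! x∈ (λ p q → M.trans (M.sym p) q) (λ p q → M.trans (M.sym q) p)
               (λ y x≈y → R.trans (R.*-congʳ (R.reflexive
                    (≡.cong (if_then r else R.0#) (dec-true (x ≟ y) x≈y))))
                    (R.*-congˡ (φ-cong (M.sym x≈y))))
               (λ y x≉y → R.trans (R.*-congʳ (R.reflexive
                    (≡.cong (if_then r else R.0#) (dec-false (x ≟ y) x≉y)))) (R.zeroˡ _))))
             (⟨⟩-support φ-cong S! u u⊆) ⟩
      ∑ S (λ y → (if does (x ≟ y) then r else R.0#) *ᴷ φ y) +ᴷ ∑ S (λ y → coeff u y *ᴷ φ y)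
        ≈⟨ ∑-+ S _ _ ⟨
      ∑ S (λ y → (if does (x ≟ y) then r else R.0#) *ᴷ φ y +ᴷ coeff u y *ᴷ φ y)
        ≈⟨ ∑-cong S (λ y → R.distribʳ _ _ _) ⟨
      ∑ S (λ y → coeff ((r , x) ∷ u) y *ᴷ φ y) ∎

    support : Algebra → List X
    support w = deduplicate _≟_ (map proj₂ w)

    support-covers : (w : Algebra) → All (λ (_ , x) → Any (x ≈ˣ_) (support w)) w
    support-covers w = All.tabulate λ {(r , x)} x∈ →
      Any.deduplicate⁺ _≟_ (λ y≈z p → M.trans p (M.sym y≈z)) (Any.map M.reflexive (∈-map⁺ proj₂ x∈))

  ⟨⟩-cong : ∀ {φ} → Functional φ → ∀ {u v} → u ≈ v → ⟨ φ , u ⟩ ≈ᴷ ⟨ φ , v ⟩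
  ⟨⟩-cong {φ} φ-cong {u} {v} u≈v = begin
    ⟨ φ , u ⟩  ≈⟨ ⟨⟩-support φ-cong S! u (All.++⁻ˡ u covers) ⟩
    ∑ S (λ x → coeff u x *ᴷ φ x)  ≈⟨ ∑-cong S (λ x → R.*-congʳ (u≈v x)) ⟩
    ∑ S (λ x → coeff v x *ᴷ φ x)  ≈⟨ ⟨⟩-support φ-cong S! v (All.++⁻ʳ u covers) ⟨
    ⟨ φ , v ⟩  ∎
    where
    -- One list of representatives covers both sides, so the collected sums can be compared term by
    -- term.
    S = support (u ++ v)
    S! = deduplicate-! decSetoid (map proj₂ (u ++ v))
    covers = support-covers (u ++ v)

  ⟨⟩-congˡ : ∀ {φ χ} → (∀ x → φ x ≈ᴷ χ x) → ∀ u → ⟨ φ , u ⟩ ≈ᴷ ⟨ χ , u ⟩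
  ⟨⟩-congˡ p u = ∑-cong u (λ (r , x) → R.*-congˡ (p x))

  ⟨⟩-ext : ∀ {u v} → (∀ φ → Functional φ → ⟨ φ , u ⟩ ≈ᴷ ⟨ φ , v ⟩) → u ≈ v
  ⟨⟩-ext {u} {v} p x =
    R.trans (coeff-δ u x) (R.trans (p (δ x) (δ-functional x)) (R.sym (coeff-δ v x)))

  ⟨⟩-+ : ∀ φ u v → ⟨ φ , u + v ⟩ ≈ᴷ ⟨ φ , u ⟩ +ᴷ ⟨ φ , v ⟩
  ⟨⟩-+ φ u v = ∑-++ u v _

  ⟨⟩-· : ∀ φ k u → ⟨ φ , k · u ⟩ ≈ᴷ k *ᴷ ⟨ φ , u ⟩
  ⟨⟩-· φ k u = begin
    ⟨ φ , k · u ⟩  ≡⟨ ∑-map _ u _ ⟩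
    ∑ u (λ (r , x) → (k *ᴷ r) *ᴷ φ x)  ≈⟨ ∑-cong u (λ _ → R.*-assoc _ _ _) ⟩
    ∑ u (λ (r , x) → k *ᴷ (r *ᴷ φ x))  ≈⟨ ∑-*ˡ u k _ ⟩
    k *ᴷ ⟨ φ , u ⟩  ∎

  ⟨⟩-neg : ∀ φ u → ⟨ φ , - u ⟩ ≈ᴷ -ᴷ ⟨ φ , u ⟩
  ⟨⟩-neg φ u = begin
    ⟨ φ , - u ⟩  ≡⟨ ∑-map _ u _ ⟩
    ∑ u (λ (r , x) → (-ᴷ r) *ᴷ φ x)
      ≈⟨ ∑-cong u (λ _ → R.trans (R.sym (RP.-‿distribˡ-* _ _)) (R.sym (RP.-1*x≈-x _))) ⟩
    ∑ u (λ (r , x) → (-ᴷ R.1#) *ᴷ (r *ᴷ φ x)) ≈⟨ ∑-*ˡ u _ _ ⟩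
    (-ᴷ R.1#) *ᴷ ⟨ φ , u ⟩  ≈⟨ RP.-1*x≈-x _ ⟩
    -ᴷ ⟨ φ , u ⟩  ∎

  ⟨⟩-single : ∀ φ x → ⟨ φ , single x ⟩ ≈ᴷ φ x
  ⟨⟩-single φ x = R.trans (R.+-identityʳ _) (R.*-identityˡ _)

  ⟨⟩-total : ∀ φ xs → ⟨ φ , total xs ⟩ ≈ᴷ ∑ xs φ
  ⟨⟩-total φ xs = R.trans (R.reflexive (∑-map _ xs _)) (∑-cong xs (λ _ → R.*-identityˡ _))

  ⟨⟩-lincomb : ∀ {I : Set} φ (is : List I) r u →
               ⟨ φ , lincomb is r u ⟩ ≈ᴷ ∑ is (λ i → r i *ᴷ ⟨ φ , u i ⟩)
  ⟨⟩-lincomb φ is r u = R.trans (∑-concatMap _ is _) (∑-cong is (λ i → ⟨⟩-· φ (r i) (u i)))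

  ⟨⟩-* : ∀ φ u v → ⟨ φ , u * v ⟩ ≈ᴷ ⟨ (λ x → ⟨ (λ y → φ (x ∙ y)) , v ⟩) , u ⟩
  ⟨⟩-* φ []            v = R.refl
  ⟨⟩-* φ ((r , x) ∷ u) v = begin
    ∑ (map _ v ++ (u * v)) _  ≈⟨ ∑-++ (map _ v) (u * v) _ ⟩
    ∑ (map _ v) _ +ᴷ ⟨ φ , u * v ⟩  ≈⟨ R.+-cong (begin
        ∑ (map _ v) _  ≡⟨ ∑-map _ v _ ⟩
        ∑ v (λ (s , y) → (r *ᴷ s) *ᴷ φ (x ∙ y))  ≈⟨ ∑-cong v (λ _ → R.*-assoc _ _ _) ⟩
        ∑ v (λ (s , y) → r *ᴷ (s *ᴷ φ (x ∙ y)))  ≈⟨ ∑-*ˡ v r _ ⟩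
        r *ᴷ ⟨ (λ y → φ (x ∙ y)) , v ⟩  ∎) (⟨⟩-* φ u v) ⟩
    _ ∎

  ⟨⟩-zeroˡ : ∀ u → ⟨ (λ _ → R.0#) , u ⟩ ≈ᴷ R.0#
  ⟨⟩-zeroˡ u = R.trans (∑-cong u (λ _ → R.zeroʳ _)) (∑-zero u)

  ⟨⟩-+ˡ : ∀ φ χ u → ⟨ (λ x → φ x +ᴷ χ x) , u ⟩ ≈ᴷ ⟨ φ , u ⟩ +ᴷ ⟨ χ , u ⟩
  ⟨⟩-+ˡ φ χ u = R.trans (∑-cong u (λ _ → R.distribˡ _ _ _)) (∑-+ u _ _)

  ⟨⟩-*ˡ : ∀ k φ u → ⟨ (λ x → k *ᴷ φ x) , u ⟩ ≈ᴷ k *ᴷ ⟨ φ , u ⟩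
  ⟨⟩-*ˡ k φ u = R.trans (∑-cong u (λ _ → x∙yz≈y∙xz _ _ _)) (∑-*ˡ u k _)
    where open CommutativeSemigroupProperties R.*-commutativeSemigroup using (x∙yz≈y∙xz)

  ⟨⟩-*ʳ : ∀ k φ u → ⟨ (λ x → φ x *ᴷ k) , u ⟩ ≈ᴷ ⟨ φ , u ⟩ *ᴷ k
  ⟨⟩-*ʳ k φ u = R.trans (⟨⟩-congˡ (λ x → R.*-comm _ k) u) (R.trans (⟨⟩-*ˡ k φ u) (R.*-comm k _))

  ⟨⟩-shiftˡ : ∀ {φ} → Functional φ → ∀ v → Functional (λ x → ⟨ (λ y → φ (x ∙ y)) , v ⟩)
  ⟨⟩-shiftˡ φ-cong v x≈x′ = ⟨⟩-congˡ (λ y → φ-cong (M.∙-congʳ x≈x′)) v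

  ⟨⟩-mult : ∀ {φ} → (∀ x y → φ (x ∙ y) ≈ᴷ φ x *ᴷ φ y) → ∀ u v → ⟨ φ , u * v ⟩ ≈ᴷ ⟨ φ , u ⟩ *ᴷ ⟨ φ , v ⟩
  ⟨⟩-mult {φ} mult u v = begin
    ⟨ φ , u * v ⟩  ≈⟨ ⟨⟩-* φ u v ⟩
    ⟨ (λ x → ⟨ (λ y → φ (x ∙ y)) , v ⟩) , u ⟩
      ≈⟨ ⟨⟩-congˡ (λ x → R.trans (⟨⟩-congˡ (mult x) v) (⟨⟩-*ˡ (φ x) φ v)) u ⟩
    ⟨ (λ x → φ x *ᴷ ⟨ φ , v ⟩) , u ⟩  ≈⟨ ⟨⟩-*ʳ _ φ u ⟩
    ⟨ φ , u ⟩ *ᴷ ⟨ φ , v ⟩  ∎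

  -- _≈_ unfolds to a pointwise equality, from which its arguments cannot be inferred.
  infix 4 _≋_
  record _≋_ (u v : Algebra) : Set ℓ where
    constructor ≈⇒≋
    field ≋⇒≈ : u ≈ v

  open _≋_ public

  ⟨⟩-cong≋ : ∀ {φ} → Functional φ → ∀ {u v} → u ≋ v → ⟨ φ , u ⟩ ≈ᴷ ⟨ φ , v ⟩
  ⟨⟩-cong≋ φ-cong {u} {v} p = ⟨⟩-cong φ-cong {u} {v} (≋⇒≈ p)

  ≋-ext : ∀ {u v} → (∀ φ → Functional φ → ⟨ φ , u ⟩ ≈ᴷ ⟨ φ , v ⟩) → u ≋ v
  ≋-ext {u} {v} p = ≈⇒≋ (⟨⟩-ext {u} {v} p)

  *-cong : ∀ {u u′ v v′} → u ≋ u′ → v ≋ v′ → u * v ≋ u′ * v′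
  *-cong {u} {u′} {v} {v′} p q = ≋-ext λ φ φ-cong → begin
    ⟨ φ , u * v ⟩  ≈⟨ ⟨⟩-* φ u v ⟩
    ⟨ (λ x → ⟨ (λ y → φ (x ∙ y)) , v ⟩) , u ⟩  ≈⟨ ⟨⟩-cong≋ (⟨⟩-shiftˡ φ-cong v) p ⟩
    ⟨ (λ x → ⟨ (λ y → φ (x ∙ y)) , v ⟩) , u′ ⟩
      ≈⟨ ⟨⟩-congˡ (λ x → ⟨⟩-cong≋ (λ y≈ → φ-cong (M.∙-congˡ y≈)) q) u′ ⟩
    ⟨ (λ x → ⟨ (λ y → φ (x ∙ y)) , v′ ⟩) , u′ ⟩ ≈⟨ ⟨⟩-* φ u′ v′ ⟨
    ⟨ φ , u′ * v′ ⟩  ∎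

  +-cong : ∀ {u u′ v v′} → u ≋ u′ → v ≋ v′ → u + v ≋ u′ + v′
  +-cong {u} {u′} {v} {v′} p q = ≈⇒≋ λ x →
    R.trans (∑-++ u v _) (R.trans (R.+-cong (≋⇒≈ p x) (≋⇒≈ q x)) (R.sym (∑-++ u′ v′ _)))

  isRing : IsRing _≋_ _+_ _*_ -_ 0# 1#
  isRing = record
    { +-isAbelianGroup = record
      { isGroup = record
        { isMonoid = record
          { isSemigroup = record
            { isMagma = record
              { isEquivalence = record
                { refl  = ≈⇒≋ λ x → R.refl
                ; sym   = λ p → ≈⇒≋ λ x → R.sym (≋⇒≈ p x)
                ; trans = λ p q → ≈⇒≋ λ x → R.trans (≋⇒≈ p x) (≋⇒≈ q x)
                }
              ; ∙-cong = +-cong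
              }
            ; assoc = λ u v w → ≋-ext λ φ _ →
                R.trans (⟨⟩-+ φ (u + v) w) (R.trans (R.+-congʳ (⟨⟩-+ φ u v)) (R.trans (R.+-assoc _ _ _)
                  (R.sym (R.trans (⟨⟩-+ φ u (v + w)) (R.+-congˡ (⟨⟩-+ φ v w))))))
            }
          ; identity = (λ u → ≈⇒≋ λ x → R.refl) , λ u → ≋-ext λ φ _ → R.trans (⟨⟩-+ φ u 0#) (R.+-identityʳ _)
          }
        ; inverse = (λ u → ≋-ext λ φ _ →
                      R.trans (⟨⟩-+ φ (- u) u) (R.trans (R.+-congʳ (⟨⟩-neg φ u)) (R.-‿inverseˡ _)))
                  , (λ u → ≋-ext λ φ _ →
                      R.trans (⟨⟩-+ φ u (- u)) (R.trans (R.+-congˡ (⟨⟩-neg φ u)) (R.-‿inverseʳ _)))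
        ; ⁻¹-cong = λ {u} {v} p → ≋-ext λ φ φ-cong →
            R.trans (⟨⟩-neg φ u) (R.trans (R.-‿cong (⟨⟩-cong≋ φ-cong p)) (R.sym (⟨⟩-neg φ v)))
        }
      ; comm = λ u v → ≋-ext λ φ _ →
          R.trans (⟨⟩-+ φ u v) (R.trans (R.+-comm _ _) (R.sym (⟨⟩-+ φ v u)))
      }
    ; *-cong = *-cong
    ; *-assoc = λ u v w → ≋-ext λ φ φ-cong → begin
        ⟨ φ , (u * v) * w ⟩ ≈⟨ R.trans (⟨⟩-* φ (u * v) w) (⟨⟩-* _ u v) ⟩
        ⟨ (λ x → ⟨ (λ y → ⟨ (λ z → φ ((x ∙ y) ∙ z)) , w ⟩) , v ⟩) , u ⟩
          ≈⟨ ⟨⟩-congˡ (λ x → ⟨⟩-congˡ (λ y → ⟨⟩-congˡ (λ z → φ-cong (M.assoc x y z)) w) v) u ⟩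
        ⟨ (λ x → ⟨ (λ y → ⟨ (λ z → φ (x ∙ (y ∙ z))) , w ⟩) , v ⟩) , u ⟩
          ≈⟨ R.trans (⟨⟩-* φ u (v * w)) (⟨⟩-congˡ (λ x → ⟨⟩-* _ v w) u) ⟨
        ⟨ φ , u * (v * w) ⟩ ∎
    ; *-identity =
        (λ u → ≋-ext λ φ φ-cong → R.trans (⟨⟩-* φ 1# u)
            (R.trans (⟨⟩-single (λ x → ⟨ (λ y → φ (x ∙ y)) , u ⟩) ε)
                 (⟨⟩-congˡ (λ x → φ-cong (M.identityˡ x)) u)))
      , (λ u → ≋-ext λ φ φ-cong → R.trans (⟨⟩-* φ u 1#)
                 (⟨⟩-congˡ (λ x → R.trans (⟨⟩-single (λ y → φ (x ∙ y)) ε) (φ-cong (M.identityʳ x))) u))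
    ; distrib =
        (λ u v w → ≋-ext λ φ _ → begin
          ⟨ φ , u * (v + w) ⟩  ≈⟨ ⟨⟩-* φ u (v + w) ⟩
          _  ≈⟨ ⟨⟩-congˡ (λ x → ⟨⟩-+ _ v w) u ⟩
          _  ≈⟨ ⟨⟩-+ˡ _ _ u ⟩
          _  ≈⟨ R.+-cong (⟨⟩-* φ u v) (⟨⟩-* φ u w) ⟨
          _  ≈⟨ ⟨⟩-+ φ (u * v) (u * w) ⟨
          ⟨ φ , (u * v) + (u * w) ⟩  ∎)
      , (λ w u v → ≋-ext λ φ _ → begin
          ⟨ φ , (u + v) * w ⟩  ≈⟨ ⟨⟩-* φ (u + v) w ⟩
          _  ≈⟨ ⟨⟩-+ _ u v ⟩
          _  ≈⟨ R.+-cong (⟨⟩-* φ u w) (⟨⟩-* φ v w) ⟨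
          _  ≈⟨ ⟨⟩-+ φ (u * w) (v * w) ⟨
          ⟨ φ , (u * w) + (v * w) ⟩  ∎)
    }

  ring : Ring c ℓ
  ring = record { isRing = isRing }

  ·-cong : ∀ {k l u v} → k ≈ᴷ l → u ≋ v → k · u ≋ l · v
  ·-cong {k} {l} {u} {v} p q = ≋-ext λ φ φ-cong →
    R.trans (⟨⟩-· φ k u) (R.trans (R.*-cong p (⟨⟩-cong≋ φ-cong q)) (R.sym (⟨⟩-· φ l v)))

  ·-*ˡ : ∀ k u v → (k · u) * v ≋ k · (u * v)
  ·-*ˡ k u v = ≋-ext λ φ _ → begin
    ⟨ φ , (k · u) * v ⟩  ≈⟨ R.trans (⟨⟩-* φ (k · u) v) (⟨⟩-· _ k u) ⟩
    _  ≈⟨ R.*-congˡ (⟨⟩-* φ u v) ⟨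
    _  ≈⟨ ⟨⟩-· φ k (u * v) ⟨
    ⟨ φ , k · (u * v) ⟩  ∎

  ·-*ʳ : ∀ k u v → u * (k · v) ≋ k · (u * v)
  ·-*ʳ k u v = ≋-ext λ φ _ → begin
    ⟨ φ , u * (k · v) ⟩  ≈⟨ R.trans (⟨⟩-* φ u (k · v)) (⟨⟩-congˡ (λ x → ⟨⟩-· _ k v) u) ⟩
    _  ≈⟨ ⟨⟩-*ˡ k _ u ⟩
    _  ≈⟨ R.*-congˡ (⟨⟩-* φ u v) ⟨
    _  ≈⟨ ⟨⟩-· φ k (u * v) ⟨
    ⟨ φ , k · (u * v) ⟩  ∎

  ·-1 : ∀ u → R.1# · u ≋ u
  ·-1 u = ≋-ext λ φ _ → R.trans (⟨⟩-· φ _ u) (R.*-identityˡ _)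

  ·-0 : ∀ u → R.0# · u ≋ 0#
  ·-0 u = ≋-ext λ φ _ → R.trans (⟨⟩-· φ _ u) (R.zeroˡ _)

  ·-neg : ∀ k u → (-ᴷ k) · u ≋ - (k · u)
  ·-neg k u = ≋-ext λ φ _ →
    R.trans (⟨⟩-· φ _ u) (R.trans (R.sym (RP.-‿distribˡ-* _ _))
        (R.sym (R.trans (⟨⟩-neg φ (k · u)) (R.-‿cong (⟨⟩-· φ k u)))))

  ·-assoc : ∀ k l u → k · (l · u) ≋ (k *ᴷ l) · u
  ·-assoc k l u = ≋-ext λ φ _ → R.trans (⟨⟩-· φ k (l · u)) (R.trans (R.*-congˡ (⟨⟩-· φ l u))
    (R.trans (R.sym (R.*-assoc _ _ _)) (R.sym (⟨⟩-· φ _ u))))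

  ·-+ʳ : ∀ k u v → k · (u + v) ≋ (k · u) + (k · v)
  ·-+ʳ k u v = ≋-ext λ φ _ → R.trans (⟨⟩-· φ k (u + v)) (R.trans (R.*-congˡ (⟨⟩-+ φ u v))
    (R.trans (R.distribˡ _ _ _) (R.sym (R.trans (⟨⟩-+ φ (k · u) (k · v))
        (R.+-cong (⟨⟩-· φ k u) (⟨⟩-· φ k v))))))

-- Faces as total preorders

false≢true : ∀ {b} → b ≡ false → ¬ b ≡ true
false≢true refl ()

≢true⇒false : ∀ {b} → ¬ b ≡ true → b ≡ false
≢true⇒false {false} _ = refl
≢true⇒false {true}  p = contradiction refl p

≡-from-⇔ : ∀ {a b} → (a ≡ true → b ≡ true) → (b ≡ true → a ≡ true) → a ≡ b
≡-from-⇔ {true}  {_}     p q = ≡.sym (p refl)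
≡-from-⇔ {false} {false} p q = refl
≡-from-⇔ {false} {true}  p q = q refl

∧-true : ∀ {a b} → a ∧ b ≡ true → a ≡ true × b ≡ true
∧-true {true} {true} _ = refl , refl

∈⇒true : ∀ {P : Subset n} {i} → i ∈ P → lookup P i ≡ true
∈⇒true = []=⇒lookup

true⇒∈ : ∀ {P : Subset n} {i} → lookup P i ≡ true → i ∈ P
true⇒∈ {P = P} {i} = lookup⇒[]= i P

Subset-ext : ∀ {P Q : Subset n} → (∀ i → lookup P i ≡ lookup Q i) → P ≡ Q
Subset-ext {P = P} {Q} eq =
  ≡.trans (≡.sym (tabulate∘lookup P)) (≡.trans (tabulate-cong eq) (tabulate∘lookup Q))

-- A face is a total preorder of [n], i ≤ j meaning that the block of i is not after the block
-- of j.  For i outside all the blocks the value is false.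
le : List (Subset n) → Fin n → Fin n → Bool
le []       i j = false
le (P ∷ Ps) i j = lookup P i ∨ (not (lookup P j) ∧ le Ps i j)

same : List (Subset n) → Fin n → Fin n → Bool
same Ps i j = le Ps i j ∧ le Ps j i

isOSP : (f : Face n) → IsOrderedSetPartition (blocks f)
isOSP (mkFace Ps p) = recompute (isOrderedSetPartition? Ps) p

-- For an arbitrary list, `le Ps i j` says that `i` occurs and that its first occurrence is not
-- after that of `j`, an uncovered `j` counting as last. Transitivity is that of the order of
-- positions.
le-trans : ∀ (Ps : List (Subset n)) {i j k} → le Ps i j ≡ true → le Ps j k ≡ true → le Ps i k ≡ true
le-trans (P ∷ Ps) {i} {j} {k} p q with lookup P i | lookup P j | lookup P k
... | true  | _     | _     = refl
... | false | false | false = le-trans Ps p q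
... | false | false | true  = q

le-covered : ∀ {Ps : List (Subset n)} {i} → Any (i ∈_) Ps → le Ps i i ≡ true
le-covered {Ps = P ∷ Ps} {i} (here i∈) rewrite ∈⇒true i∈ = refl
le-covered {Ps = P ∷ Ps} {i} (there p) with lookup P i
... | true  = refl
... | false = le-covered p

le-total : ∀ {Ps : List (Subset n)} {i j} → le Ps i i ≡ true → le Ps j j ≡ true →
           le Ps i j ≡ false → le Ps j i ≡ true
le-total {Ps = P ∷ Ps} {i} {j} p q r with lookup P i | lookup P j
... | false | true  = refl
... | false | false = le-total {Ps = Ps} p q r

le-uncoveredˡ : ∀ {Ps : List (Subset n)} {i} → All (λ P → lookup P i ≡ false) Ps → ∀ j → le Ps i j ≡ false
le-uncoveredˡ []               j = refl
le-uncoveredˡ {Ps = P ∷ _} (p ∷ ps) j rewrite p | le-uncoveredˡ ps j = ∧-zeroʳ _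

le-uncoveredʳ : ∀ {Ps : List (Subset n)} {j} → All (λ P → lookup P j ≡ false) Ps → ∀ i → le Ps i j ≡ le Ps i i
le-uncoveredʳ []               i = refl
le-uncoveredʳ {Ps = P ∷ _} (p ∷ ps) i rewrite p | le-uncoveredʳ ps i with lookup P i
... | true  = refl
... | false = refl

disjoint⇒uncovered : ∀ {P : Subset n} {Ps i} → All (Disjoint P) Ps → lookup P i ≡ true →
                     All (λ Q → lookup Q i ≡ false) Ps
disjoint⇒uncovered ds i∈ =
  All.map (λ d → ≢true⇒false (λ i∈Q → d (_ , x∈p∩q⁺ (true⇒∈ i∈ , true⇒∈ i∈Q)))) ds

-- The first block is recovered as the set of minimal points. Off this block the tail has the same
-- preorder as the whole list, and the points of the block are uncovered in the tail.
le-ext : ∀ {Ps Qs : List (Subset n)} → All Nonempty Ps → All Nonempty Qs →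
         AllPairs Disjoint Ps → AllPairs Disjoint Qs →
         (∀ i j → le Ps i j ≡ le Qs i j) → Ps ≡ Qs
le-ext [] [] _ _ eq = refl
le-ext {Qs = Qs} [] ((i , i∈) ∷ neQs) _ _ eq =
  contradiction (≡.trans (eq i i) (le-covered {Ps = Qs} (here i∈))) λ ()
le-ext {Ps = Ps} ((i , i∈) ∷ nePs) [] _ _ eq =
  contradiction (≡.trans (≡.sym (eq i i)) (le-covered {Ps = Ps} (here i∈))) λ ()
le-ext {Ps = P ∷ Ps} {Q ∷ Qs} (neP ∷ nePs) (neQ ∷ neQs) (dP ∷ dPs) (dQ ∷ dQs) eq =
  cong₂ _∷_ P≡Q (le-ext nePs neQs dPs dQs tail)
  where
  -- For `j` in `Q`, the right preorder at `(i , j)` is just membership of `i` in `Q`, while the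
  -- left one is true because `i` is in `P`.
  head : ∀ P Q Ps Qs → (∀ i j → le (P ∷ Ps) i j ≡ le (Q ∷ Qs) i j) → Nonempty Q →
         ∀ i → lookup P i ≡ true → lookup Q i ≡ true
  head P Q Ps Qs eq (j , j∈) i i∈ with eq i j
  ... | e rewrite i∈ | ∈⇒true j∈ = ≡.trans (≡.sym (∨-identityʳ _)) (≡.sym e)

  P≡Q : P ≡ Q
  P≡Q = Subset-ext λ i → ≡-from-⇔ (head P Q Ps Qs eq neQ i) (head Q P Qs Ps (λ i j → ≡.sym (eq i j)) neP i)

  agree-off-P : ∀ {i j} → lookup P i ≡ false → lookup P j ≡ false → le Ps i j ≡ le Qs i j
  agree-off-P {i} {j} i∉ j∉ with eq i j
  ... | e rewrite ≡.sym P≡Q | i∉ | j∉ = e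

  tail : ∀ i j → le Ps i j ≡ le Qs i j
  tail i j with lookup P i in pi | lookup P j in pj
  ... | true  | _     = ≡.trans (le-uncoveredˡ (disjoint⇒uncovered dP pi) j)
                          (≡.sym (le-uncoveredˡ
                              (disjoint⇒uncovered dQ (subst (λ P → lookup P i ≡ true) P≡Q pi)) j))
  ... | false | false = agree-off-P pi pj
  -- Neither tail covers `j`, so comparing `i` with it only records whether `i` is covered.
  ... | false | true  = ≡.trans (le-uncoveredʳ (disjoint⇒uncovered dP pj) i) (≡.trans (agree-off-P pi pi)
                          (≡.sym (le-uncoveredʳ
                              (disjoint⇒uncovered dQ (subst (λ P → lookup P j ≡ true) P≡Q pj)) i)))

lef : Face n → Fin n → Fin n → Bool
lef f = le (blocks f)

face-ext : ∀ {f g : Face n} → (∀ i j → lef f i j ≡ lef g i j) → f ≡ g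
face-ext {f = f@(mkFace Ps _)} {g@(mkFace Qs _)} eq
  with le-ext (IsOrderedSetPartition.nonempty (isOSP f)) (IsOrderedSetPartition.nonempty (isOSP g))
              (IsOrderedSetPartition.disjoint (isOSP f)) (IsOrderedSetPartition.disjoint (isOSP g)) eq
... | refl = refl

lef-refl : ∀ (f : Face n) i → lef f i i ≡ true
lef-refl f i = le-covered (IsOrderedSetPartition.covers (isOSP f) i)

lef-total : ∀ (f : Face n) {i j} → lef f i j ≡ false → lef f j i ≡ true
lef-total f {i} {j} = le-total {Ps = blocks f} (lef-refl f i) (lef-refl f j)

lef-trans : ∀ (f : Face n) {i j k} → lef f i j ≡ true → lef f j k ≡ true → lef f i k ≡ true
lef-trans f = le-trans (blocks f)

le-filter : ∀ (Ps : List (Subset n)) i j → le (filter nonempty? Ps) i j ≡ le Ps i j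
le-filter []       i j = refl
le-filter (P ∷ Ps) i j with nonempty? P
... | yes _ rewrite le-filter Ps i j = refl
... | no ¬ne
  rewrite le-filter Ps i j
        | ≢true⇒false {lookup P i} (λ i∈ → ¬ne (i , true⇒∈ i∈))
        | ≢true⇒false {lookup P j} (λ j∈ → ¬ne (j , true⇒∈ j∈)) = refl

lookup-∩ : ∀ (P Q : Subset n) i → lookup (P ∩ Q) i ≡ lookup P i ∧ lookup Q i
lookup-∩ P Q i = lookup-zipWith _∧_ i P Q

private
  ∩-both : ∀ {P : Subset n} {i j} → lookup P i ≡ true → lookup P j ≡ true →
           ∀ Qs Rs → Any (j ∈_) Qs → le (map (P ∩_) Qs ++ Rs) i j ≡ le Qs i j
  ∩-both {P = P} {i} {j} pi pj (Q ∷ Qs) Rs c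
    rewrite lookup-∩ P Q i | lookup-∩ P Q j | pi | pj with c
  ... | here j∈ rewrite ∈⇒true j∈ = refl
  ... | there c′ rewrite ∩-both {P = P} pi pj Qs Rs c′ = refl

  ∩-left : ∀ {P : Subset n} {i j} → lookup P i ≡ true → lookup P j ≡ false →
           ∀ Qs Rs → Any (i ∈_) Qs → le (map (P ∩_) Qs ++ Rs) i j ≡ true
  ∩-left {P = P} {i} {j} pi pj (Q ∷ Qs) Rs c
    rewrite lookup-∩ P Q i | lookup-∩ P Q j | pi | pj with c
  ... | here i∈ rewrite ∈⇒true i∈ = refl
  ... | there c′ rewrite ∩-left {P = P} pi pj Qs Rs c′ = ∨-zeroʳ _

  ∩-right : ∀ {P : Subset n} {i j} → lookup P i ≡ false → lookup P j ≡ true →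
            ∀ Qs Rs → Any (j ∈_) Qs → le (map (P ∩_) Qs ++ Rs) i j ≡ false
  ∩-right {P = P} {i} {j} pi pj (Q ∷ Qs) Rs c
    rewrite lookup-∩ P Q i | lookup-∩ P Q j | pi | pj with c
  ... | here j∈ rewrite ∈⇒true j∈ = refl
  ... | there c′ rewrite ∩-right {P = P} pi pj Qs Rs c′ = ∧-zeroʳ _

  ∩-neither : ∀ {P : Subset n} {i j} → lookup P i ≡ false → lookup P j ≡ false →
              ∀ Qs Rs → le (map (P ∩_) Qs ++ Rs) i j ≡ le Rs i j
  ∩-neither pi pj []       Rs = refl
  ∩-neither {P = P} {i} {j} pi pj (Q ∷ Qs) Rs
    rewrite lookup-∩ P Q i | lookup-∩ P Q j | pi | pj | ∩-neither {P = P} {i} {j} pi pj Qs Rs = refl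

-- The lexicographic preorder: ties of `o` are broken by `o′`.
lex : (Fin n → Fin n → Bool) → (Fin n → Fin n → Bool) → Fin n → Fin n → Bool
lex o o′ i j = o i j ∧ (not (o j i) ∨ o′ i j)

-- The sets `P ∩ Q` with the first `P` stand at the front. They settle the comparison as soon as `P`
-- contains `i` or `j`, because `Qs` covers that point; otherwise they are passed over.
le-product : ∀ (Ps Qs : List (Subset n)) → (∀ i → Any (i ∈_) Qs) →
             ∀ i j → le (cartesianProductWith _∩_ Ps Qs) i j ≡ lex (le Ps) (le Qs) i j
le-product []       Qs c i j = refl
le-product (P ∷ Ps) Qs c i j with lookup P i in pi | lookup P j in pj
... | true  | true  = ∩-both {P = P} pi pj Qs _ (c j)
... | true  | false = ∩-left {P = P} pi pj Qs _ (c i)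
... | false | true  = ∩-right {P = P} pi pj Qs _ (c j)
... | false | false = ≡.trans (∩-neither {P = P} {i} {j} pi pj Qs _) (le-product Ps Qs c i j)

module _ {m : ℕ} where
  open RawMonoid (faceMonoid m) using (_∙_)

  lef-∙ : ∀ f g i j → lef (f ∙ g) i j ≡ lex (lef f) (lef g) i j
  lef-∙ f g i j = ≡.trans (le-filter (cartesianProductWith _∩_ (blocks f) (blocks g)) i j)
    (le-product (blocks f) (blocks g) (IsOrderedSetPartition.covers (isOSP g)) i j)

le-image : ∀ (π : Permutation′ n) Ps i j → le (map (image π) Ps) i j ≡ le Ps (π ⟨$⟩ˡ i) (π ⟨$⟩ˡ j)
le-image π []       i j = refl
le-image π (P ∷ Ps) i j
  rewrite lookup∘tabulate (λ i → lookup P (π ⟨$⟩ˡ i)) i | lookup∘tabulate (λ i → lookup P (π ⟨$⟩ˡ i)) j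
        | le-image π Ps i j = refl

lef-◃ : ∀ (π : Permutation′ n) f i j → lef (π ◃ f) i j ≡ lef f (π ⟨$⟩ˡ i) (π ⟨$⟩ˡ j)
lef-◃ π f = le-image π (blocks f)

same⇒Any : ∀ (Ps : List (Subset n)) {i j} → same Ps i j ≡ true → Any (λ P → i ∈ P × j ∈ P) Ps
same⇒Any (P ∷ Ps) {i} {j} p with lookup P i in pi | lookup P j in pj
... | true  | true  = here (true⇒∈ pi , true⇒∈ pj)
... | false | false = there (same⇒Any Ps p)

disjoint⇒∉ : ∀ {P : Subset n} {Ps i} → All (Disjoint P) Ps → Any (i ∈_) Ps → lookup P i ≡ false
disjoint⇒∉ ds i∈ = ≢true⇒false λ i∈P → All.lookupWith
  (λ d i∈Q → d (_ , x∈p∩q⁺ (true⇒∈ i∈P , i∈Q))) ds i∈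

Any⇒same : ∀ {Ps : List (Subset n)} {i j} → AllPairs Disjoint Ps → Any (λ P → i ∈ P × j ∈ P) Ps →
    same Ps i j ≡ true
Any⇒same {Ps = P ∷ Ps} (d ∷ ds) (here (i∈ , j∈)) rewrite ∈⇒true i∈ | ∈⇒true j∈ = refl
Any⇒same {Ps = P ∷ Ps} {i} {j} (d ∷ ds) (there p)
  rewrite disjoint⇒∉ d (Any.map proj₁ p) | disjoint⇒∉ d (Any.map proj₂ p) = Any⇒same ds p

samef : Face n → Fin n → Fin n → Bool
samef f = same (blocks f)

same-sym : ∀ (f : Face n) {i j} → samef f i j ≡ true → samef f j i ≡ true
same-sym f {i} {j} p = ≡.trans (∧-comm (lef f j i) (lef f i j)) p

same-elim : ∀ (f : Face n) {i j} → samef f i j ≡ true → lef f i j ≡ true × lef f j i ≡ true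
same-elim f {i} {j} = ∧-true {lef f i j} {lef f j i}

same-intro : ∀ (f : Face n) {i j} → lef f i j ≡ true → lef f j i ≡ true → samef f i j ≡ true
same-intro f p q rewrite p | q = refl

same-refl : ∀ (f : Face n) i → samef f i i ≡ true
same-refl f i = same-intro f (lef-refl f i) (lef-refl f i)

same-trans : ∀ (f : Face n) {i j k} → samef f i j ≡ true → samef f j k ≡ true → samef f i k ≡ true
same-trans f p q with same-elim f p | same-elim f q
... | a , b | c , d = same-intro f (lef-trans f a c) (lef-trans f d b)

infix 4 _⊑_
-- Refinement read on the equivalence relations rather than on the blocks, so that it interacts
-- directly with the preorders of products and of translates.
_⊑_ : Face n → Face n → Set
X ⊑ Y = ∀ {i j} → samef X i j ≡ true → samef Y i j ≡ true

≤Π⇒⊑ : ∀ {X Y : Face n} → X ≤Π Y → X ⊑ Y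
≤Π⇒⊑ {X = X} {Y} X≤Y s =
  let P⊆ , (i∈ , j∈) = All.lookupAny X≤Y (same⇒Any (blocks X) s)
  in Any⇒same (IsOrderedSetPartition.disjoint (isOSP Y)) (Any.map (λ P⊆Q → P⊆Q i∈ , P⊆Q j∈) P⊆)

block-char : ∀ (f : Face n) {P i} → P ∈ˡ blocks f → i ∈ P → ∀ j → lookup P j ≡ samef f i j
block-char f {P} {i} P∈ i∈ j = ≡-from-⇔
  (λ j∈ → Any⇒same ds (Any.map (λ { refl → i∈ , true⇒∈ j∈ }) P∈))
  (λ s → go ds P∈ (same⇒Any (blocks f) s))
  where
  ds = IsOrderedSetPartition.disjoint (isOSP f)
  go : ∀ {Ps} → AllPairs Disjoint Ps → P ∈ˡ Ps → Any (λ Q → i ∈ Q × j ∈ Q) Ps → lookup P j ≡ true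
  go _        (here refl) (here (_ , j∈)) = ∈⇒true j∈
  go (d ∷ _)  (here refl) (there q)       = contradiction
      (All.lookupWith (λ d (i∈Q , _) → d (_ , x∈p∩q⁺ (i∈ , i∈Q))) d q) λ ()
  go (d ∷ _)  (there p)   (here (i∈Q , _)) = contradiction (_ , x∈p∩q⁺ (i∈Q , i∈)) (All.lookup d p)
  go (_ ∷ ds) (there p)   (there q)       = go ds p q

⊑-antisym : ∀ {X Y : Face n} → X ⊑ Y → Y ⊑ X → X ≈Π Y
⊑-antisym {X = X} {Y} p q = half {X} {Y} p q , half {Y} {X} q p
  where
  half : ∀ {X Y : Face _} → X ⊑ Y → Y ⊑ X → ∀ {P} → P ∈ˡ blocks X → P ∈ˡ blocks Y
  half {X} {Y} p q {P} P∈ =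
    let i , i∈P = All.lookup (IsOrderedSetPartition.nonempty (isOSP X)) P∈
        Q , Q∈ , i∈Q = Membership.find (IsOrderedSetPartition.covers (isOSP Y) i)
    in subst (_∈ˡ blocks Y) (Subset-ext λ j → ≡.trans (block-char Y Q∈ i∈Q j)
         (≡.trans (≡-from-⇔ q p) (≡.sym (block-char X P∈ i∈P j)))) Q∈

module _ {m : ℕ} where
  open RawMonoid (faceMonoid m) using (_∙_; ε)

  lex-assoc : ∀ (o o′ o″ : Fin n → Fin n → Bool) i j → lex (lex o o′) o″ i j ≡ lex o (lex o′ o″) i j
  lex-assoc o o′ o″ i j with o i j | o j i
  ... | false | _     = refl
  ... | true  | false = refl
  ... | true  | true  = refl

  ε-lef : ∀ i j → lef ε i j ≡ true
  ε-lef i j rewrite lookup-replicate i inside = refl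

  face-assoc : ∀ f g h → (f ∙ g) ∙ h ≡ f ∙ (g ∙ h)
  face-assoc f g h = face-ext λ i j → begin
    lef ((f ∙ g) ∙ h) i j  ≡⟨ lef-∙ (f ∙ g) h i j ⟩
    lex (lef (f ∙ g)) (lef h) i j
      ≡⟨ cong₂ (λ a b → a ∧ (not b ∨ lef h i j)) (lef-∙ f g i j) (lef-∙ f g j i) ⟩
    lex (lex (lef f) (lef g)) (lef h) i j  ≡⟨ lex-assoc (lef f) (lef g) (lef h) i j ⟩
    lex (lef f) (lex (lef g) (lef h)) i j
      ≡⟨ cong (λ b → lef f i j ∧ (not (lef f j i) ∨ b)) (lef-∙ g h i j) ⟨
    lex (lef f) (lef (g ∙ h)) i j  ≡⟨ lef-∙ f (g ∙ h) i j ⟨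
    lef (f ∙ (g ∙ h)) i j  ∎
    where open ≡.≡-Reasoning

  face-identityˡ : ∀ f → ε ∙ f ≡ f
  face-identityˡ f = face-ext λ i j → ≡.trans (lef-∙ ε f i j)
    (cong₂ (λ a b → a ∧ (not b ∨ lef f i j)) (ε-lef i j) (ε-lef j i))

  face-identityʳ : ∀ f → f ∙ ε ≡ f
  face-identityʳ f = face-ext λ i j → ≡.trans (lef-∙ f ε i j) (helper i j)
    where
    helper : ∀ i j → lex (lef f) (lef ε) i j ≡ lef f i j
    helper i j rewrite ε-lef i j with lef f j i
    ... | true  = ∧-identityʳ _
    ... | false = ∧-identityʳ _

  faceIsMonoid : IsMonoid _≡_ _∙_ ε
  faceIsMonoid = record
    { isSemigroup = record
      { isMagma = record { isEquivalence = ≡.isEquivalence ; ∙-cong = cong₂ _∙_ }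
      ; assoc   = face-assoc
      }
    ; identity = face-identityˡ , face-identityʳ
    }

  ◃-∙ : ∀ π f g → π ◃ (f ∙ g) ≡ (π ◃ f) ∙ (π ◃ g)
  ◃-∙ π f g = face-ext λ i j → begin
    lef (π ◃ (f ∙ g)) i j  ≡⟨ lef-◃ π (f ∙ g) i j ⟩
    lef (f ∙ g) (π ⟨$⟩ˡ i) (π ⟨$⟩ˡ j)  ≡⟨ lef-∙ f g _ _ ⟩
    lex (lef f) (lef g) (π ⟨$⟩ˡ i) (π ⟨$⟩ˡ j)
      ≡⟨ cong₂ (λ a b → a ∧ (not b ∨ lef g (π ⟨$⟩ˡ i) (π ⟨$⟩ˡ j))) (lef-◃ π f i j) (lef-◃ π f j i) ⟨
    lef (π ◃ f) i j ∧ (not (lef (π ◃ f) j i) ∨ lef g (π ⟨$⟩ˡ i) (π ⟨$⟩ˡ j))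
      ≡⟨ cong (λ c → lef (π ◃ f) i j ∧ (not (lef (π ◃ f) j i) ∨ c)) (lef-◃ π g i j) ⟨
    lex (lef (π ◃ f)) (lef (π ◃ g)) i j  ≡⟨ lef-∙ (π ◃ f) (π ◃ g) i j ⟨
    lef ((π ◃ f) ∙ (π ◃ g)) i j  ∎
    where open ≡.≡-Reasoning

-- The action of permutations on faces

⟨$⟩ˡ-cong : ∀ {π ρ : Permutation′ n} → π Perm.≈ ρ → ∀ i → π ⟨$⟩ˡ i ≡ ρ ⟨$⟩ˡ i
⟨$⟩ˡ-cong {π = π} {ρ} p i = begin
  π ⟨$⟩ˡ i  ≡⟨ cong (π ⟨$⟩ˡ_) (inverseʳ ρ) ⟨
  π ⟨$⟩ˡ (ρ ⟨$⟩ʳ (ρ ⟨$⟩ˡ i))  ≡⟨ cong (π ⟨$⟩ˡ_) (p _) ⟨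
  π ⟨$⟩ˡ (π ⟨$⟩ʳ (ρ ⟨$⟩ˡ i))  ≡⟨ inverseˡ π ⟩
  ρ ⟨$⟩ˡ i  ∎
  where open ≡.≡-Reasoning

⟨$⟩ʳ-injective : ∀ (π : Permutation′ n) {i j} → π ⟨$⟩ʳ i ≡ π ⟨$⟩ʳ j → i ≡ j
⟨$⟩ʳ-injective π p = ≡.trans (≡.sym (inverseˡ π)) (≡.trans (cong (π ⟨$⟩ˡ_) p) (inverseˡ π))

⟨$⟩ˡ-injective : ∀ (π : Permutation′ n) {i j} → π ⟨$⟩ˡ i ≡ π ⟨$⟩ˡ j → i ≡ j
⟨$⟩ˡ-injective π = ⟨$⟩ʳ-injective (flip π)

◃-cong : ∀ {π ρ : Permutation′ n} → π Perm.≈ ρ → ∀ f → π ◃ f ≡ ρ ◃ f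
◃-cong {π = π} {ρ} p f = face-ext λ i j → ≡.trans (lef-◃ π f i j)
  (≡.trans (cong₂ (lef f) (⟨$⟩ˡ-cong {π = π} {ρ} p i) (⟨$⟩ˡ-cong {π = π} {ρ} p j)) (≡.sym (lef-◃ ρ f i j)))

◃-comp : ∀ (π ρ : Permutation′ n) f → π ◃ (ρ ◃ f) ≡ (ρ ∘ₚ π) ◃ f
◃-comp π ρ f = face-ext λ i j →
  ≡.trans (lef-◃ π (ρ ◃ f) i j) (≡.trans (lef-◃ ρ f _ _) (≡.sym (lef-◃ (ρ ∘ₚ π) f i j)))

◃-id : ∀ (f : Face n) → Perm.id ◃ f ≡ f
◃-id f = face-ext (lef-◃ Perm.id f)

◃-inverseˡ : ∀ (π : Permutation′ n) f → flip π ◃ (π ◃ f) ≡ f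
◃-inverseˡ π f = ≡.trans (◃-comp (flip π) π f)
    (≡.trans (◃-cong {π = π ∘ₚ flip π} {ρ = Perm.id} (λ i → inverseˡ π {i}) f) (◃-id f))

◃-inverseʳ : ∀ (π : Permutation′ n) f → π ◃ (flip π ◃ f) ≡ f
◃-inverseʳ π f = ≡.trans (◃-comp π (flip π) f)
    (≡.trans (◃-cong {π = flip π ∘ₚ π} {ρ = Perm.id} (λ i → inverseʳ π {i}) f) (◃-id f))

same-◃ : ∀ (π : Permutation′ n) f i j → samef (π ◃ f) i j ≡ samef f (π ⟨$⟩ˡ i) (π ⟨$⟩ˡ j)
same-◃ π f i j = cong₂ _∧_ (lef-◃ π f i j) (lef-◃ π f j i)

permIsMonoid : ∀ n → IsMonoid {A = Permutation′ n} Perm._≈_ (λ π ρ → ρ ∘ₚ π) Perm.id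
permIsMonoid n = record
  { isSemigroup = record
    { isMagma = record
      { isEquivalence = record { refl = λ _ → refl ; sym = λ p i → ≡.sym (p i) ; trans = λ p q i →
            ≡.trans (p i) (q i) }
      ; ∙-cong = λ {π} {π′} {ρ} {ρ′} p q i → ≡.trans (cong (π ⟨$⟩ʳ_) (q i)) (p (ρ′ ⟨$⟩ʳ i))
      }
    ; assoc = λ _ _ _ _ → refl
    }
  ; identity = (λ _ _ → refl) , (λ _ _ → refl)
  }

blockSizes-◃ : ∀ (π : Permutation′ n) f → blockSizes (π ◃ f) ≡ blockSizes f
blockSizes-◃ π f = ≡.trans (≡.sym (map-∘ (blocks f))) (map-cong (∣image∣ π) (blocks f))
  where
  open Sum ℕ.+-0-commutativeMonoid using (sum; sum-permute; sum-cong-≗)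

  ∣_∣-sum : ∀ {n} (P : Subset n) → ∣ P ∣ ≡ sum (λ i → if lookup P i then 1 else 0)
  ∣ Vec.[] ∣-sum            = refl
  ∣ inside Vec.∷ P ∣-sum    = cong suc ∣ P ∣-sum
  ∣ outside Vec.∷ P ∣-sum   = ∣ P ∣-sum

  ∣image∣ : ∀ {n} (π : Permutation′ n) P → ∣ image π P ∣ ≡ ∣ P ∣
  ∣image∣ π P = begin
    ∣ image π P ∣  ≡⟨ ∣ image π P ∣-sum ⟩
    sum (λ i → if lookup (image π P) i then 1 else 0)
      ≡⟨ sum-cong-≗ {_} {λ i → if lookup (image π P) i then 1 else 0} {λ i →
          if lookup P (π ⟨$⟩ˡ i) then 1 else 0} (λ i → cong (if_then 1 else 0) (lookup∘tabulate _ i)) ⟩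
    sum (λ i → if lookup P (π ⟨$⟩ˡ i) then 1 else 0)  ≡⟨ sum-permute _ (flip π) ⟨
    sum (λ i → if lookup P i then 1 else 0)  ≡⟨ ∣ P ∣-sum ⟨
    ∣ P ∣  ∎
    where open ≡.≡-Reasoning

-- Standard faces, with consecutive intervals as blocks

-- `J` is read as a set of cuts between neighbours. A cut at the head closes the first block after
-- `zero`; without it, `zero` joins the first block of the remaining points.
firstBlock : Subset m → Subset (suc m)
firstBlock Vec.[]              = inside Vec.∷ Vec.[]
firstBlock (inside  Vec.∷ J)   = inside Vec.∷ ⊥
firstBlock (outside Vec.∷ J)   = inside Vec.∷ firstBlock J

restBlocks : Subset m → List (Subset (suc m))
restBlocks Vec.[]              = []
restBlocks (inside  Vec.∷ J)   = map (outside Vec.∷_) (firstBlock J ∷ restBlocks J)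
restBlocks (outside Vec.∷ J)   = map (outside Vec.∷_) (restBlocks J)

stdBlocks : Subset m → List (Subset (suc m))
stdBlocks J = firstBlock J ∷ restBlocks J

zero∈firstBlock : ∀ (J : Subset m) → lookup (firstBlock J) zero ≡ true
zero∈firstBlock Vec.[]            = refl
zero∈firstBlock (inside  Vec.∷ J) = refl
zero∈firstBlock (outside Vec.∷ J) = refl

private
  outside-disjoint : ∀ x (P Q : Subset n) → Disjoint P Q → Disjoint (x Vec.∷ P) (outside Vec.∷ Q)
  outside-disjoint inside  P Q d (suc i , there p) = d (i , p)
  outside-disjoint outside P Q d (suc i , there p) = d (i , p)

  ⊥-disjoint : ∀ (P : Subset n) → Disjoint ⊥ P
  ⊥-disjoint P (i , p) = false≢true
    (≡.trans (lookup-∩ ⊥ P i) (cong (_∧ lookup P i) (lookup-replicate i outside))) (∈⇒true p)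

stdBlocks-isOSP : ∀ (J : Subset m) → IsOrderedSetPartition (stdBlocks J)
stdBlocks-isOSP Vec.[] = mkIsOSP ((zero , here) ∷ []) ([] ∷ []) λ { zero → here here }
stdBlocks-isOSP (inside Vec.∷ J) with stdBlocks-isOSP J
... | mkIsOSP ne d c = mkIsOSP
  ((zero , here) ∷ All.map⁺ (All.map (λ (i , p) → suc i , there p) ne))
  (All.map⁺ (All.universal (λ P → outside-disjoint inside ⊥ P (⊥-disjoint P)) (stdBlocks J)) ∷ AllPairs.map⁺
      (AllPairs.map (λ {P} {Q} → outside-disjoint outside P Q) d))
  λ { zero → here here ; (suc i) → there (Any.map⁺ (Any.map there (c i))) }
stdBlocks-isOSP (outside Vec.∷ J) with stdBlocks-isOSP J
... | mkIsOSP (_ ∷ ne) (d ∷ ds) c = mkIsOSP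
  ((zero , here) ∷ All.map⁺ (All.map (λ (i , p) → suc i , there p) ne))
  (All.map⁺ (All.map (λ {Q} → outside-disjoint inside (firstBlock J) Q) d) ∷ AllPairs.map⁺
      (AllPairs.map (λ {P} {Q} → outside-disjoint outside P Q) ds))
  λ { zero → here here ; (suc i) → covers i (c i) }
  where
  covers : ∀ i → Any (i ∈_) (stdBlocks J) → Any (suc i ∈_) (stdBlocks (outside Vec.∷ J))
  covers i (here p)  = here (there p)
  covers i (there p) = there (Any.map⁺ (Any.map there p))

stdFace : Subset m → Face (suc m)
stdFace J = mkFace (stdBlocks J) (stdBlocks-isOSP J)

le-outside : ∀ (Ps : List (Subset n)) i j → le (map (outside Vec.∷_) Ps) (suc i) (suc j) ≡ le Ps i j
le-outside []       i j = refl
le-outside (P ∷ Ps) i j rewrite le-outside Ps i j = refl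

-- Weak compatibility with the natural order, required between neighbours only; transitivity extends
-- it to all pairs.
Monotone : Face (suc m) → Set
Monotone f = ∀ i → lef f (inject₁ i) (suc i) ≡ true

stdFace-monotone : ∀ (J : Subset m) → Monotone (stdFace J)
stdFace-monotone (inside  Vec.∷ J) zero    = refl
stdFace-monotone (outside Vec.∷ J) zero    = refl
stdFace-monotone (inside  Vec.∷ J) (suc i)
  rewrite lookup-replicate (inject₁ i) outside | lookup-replicate (suc i) outside
        | le-outside (restBlocks J) (inject₁ i) (suc i) = stdFace-monotone J i
stdFace-monotone (outside Vec.∷ J) (suc i)
  rewrite le-outside (restBlocks J) (inject₁ i) (suc i) = stdFace-monotone J i

stdFace-step : ∀ (J : Subset m) i → lef (stdFace J) (suc i) (inject₁ i) ≡ not (lookup J i)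
stdFace-step (inside  Vec.∷ J) zero    = refl
stdFace-step (outside Vec.∷ J) zero rewrite zero∈firstBlock J = refl
stdFace-step (inside  Vec.∷ J) (suc i)
  rewrite lookup-replicate (inject₁ i) outside | lookup-replicate (suc i) outside
        | le-outside (restBlocks J) (suc i) (inject₁ i) = stdFace-step J i
stdFace-step (outside Vec.∷ J) (suc i)
  rewrite le-outside (restBlocks J) (suc i) (inject₁ i) = stdFace-step J i

private
  ∣outside∣ : ∀ (Ps : List (Subset n)) → map ∣_∣ (map (outside Vec.∷_) Ps) ≡ map ∣_∣ Ps
  ∣outside∣ Ps = ≡.sym (map-∘ Ps)

  sucHead : List ℕ → List ℕ
  sucHead []       = []
  sucHead (x ∷ xs) = suc x ∷ xs

  gaps-suc : ∀ a bs n → gaps (suc a) (map suc bs) (suc n) ≡ gaps a bs n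
  gaps-suc a []       n = refl
  gaps-suc a (b ∷ bs) n = cong ((b ∸ a) ∷_) (gaps-suc b bs n)

  -- The first gap is measured from 0, so shifting all cuts and the end by one lengthens this gap
  -- and no other.
  gaps-zero : ∀ bs n → gaps 0 (map suc bs) (suc n) ≡ sucHead (gaps 0 bs n)
  gaps-zero []       n = refl
  gaps-zero (b ∷ bs) n = cong (suc b ∷_) (gaps-suc b bs n)

  elements-tail : ∀ x (J : Subset m) →
    map (ℕ.suc ∘ toℕ) (filter (_∈? (x Vec.∷ J)) (List.tabulate suc)) ≡ map ℕ.suc (elements J)
  elements-tail {m} x J = ≡.trans (go (List.allFin m) (List.tabulate suc) (≡.sym (map-tabulate id suc)))
      (map-∘ _)
    where
    go : ∀ is js → js ≡ map suc is →
         map (ℕ.suc ∘ toℕ) (filter (_∈? (x Vec.∷ J)) js) ≡ map (ℕ.suc ∘ ℕ.suc ∘ toℕ) (filter (_∈? J) is)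
    go []       _ refl = refl
    go (i ∷ is) _ refl with does (i ∈? J)
    ... | true  = cong (ℕ.suc (ℕ.suc (toℕ i)) ∷_) (go is _ refl)
    ... | false = go is _ refl

blockSizes-stdFace : ∀ (J : Subset m) → blockSizes (stdFace J) ≡ composition J
blockSizes-stdFace Vec.[] = refl
blockSizes-stdFace {suc m} (inside Vec.∷ J) = begin
  suc ∣ ⊥ {n = suc m} ∣ ∷ map ∣_∣ (map (outside Vec.∷_) (stdBlocks J))
    ≡⟨ cong₂ (λ a b → suc a ∷ b) (∣⊥∣≡0 (suc m)) (∣outside∣ (stdBlocks J)) ⟩
  1 ∷ blockSizes (stdFace J)  ≡⟨ cong (1 ∷_) (blockSizes-stdFace J) ⟩
  1 ∷ gaps 0 (elements J) (suc m)  ≡⟨ cong (1 ∷_) (gaps-suc 0 (elements J) (suc m)) ⟨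
  1 ∷ gaps 1 (map suc (elements J)) (suc (suc m))
    ≡⟨ cong (λ es → 1 ∷ gaps 1 es (suc (suc m))) (elements-tail inside J) ⟨
  composition (inside Vec.∷ J)  ∎
  where open ≡.≡-Reasoning
blockSizes-stdFace {suc m} (outside Vec.∷ J) = begin
  suc ∣ firstBlock J ∣ ∷ map ∣_∣ (map (outside Vec.∷_) (restBlocks J))
    ≡⟨ cong (ℕ.suc ∣ firstBlock J ∣ ∷_) (∣outside∣ (restBlocks J)) ⟩
  sucHead (blockSizes (stdFace J))  ≡⟨ cong sucHead (blockSizes-stdFace J) ⟩
  sucHead (gaps 0 (elements J) (suc m)) ≡⟨ gaps-zero (elements J) (suc m) ⟨
  gaps 0 (map suc (elements J)) (suc (suc m))
    ≡⟨ cong (λ es → gaps 0 es (suc (suc m))) (elements-tail outside J) ⟨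
  composition (outside Vec.∷ J)  ∎
  where open ≡.≡-Reasoning

∣firstBlock∣ : ∀ (J : Subset m) → ∃ λ k → ∣ firstBlock J ∣ ≡ suc k
∣firstBlock∣ Vec.[]            = 0 , refl
∣firstBlock∣ (inside  Vec.∷ J) = _ , refl
∣firstBlock∣ (outside Vec.∷ J) = _ , refl

-- The first size tells whether there is a cut after `zero`: with a cut it is 1, and without one it
-- is at least 2 because `firstBlock` is never empty.
blockSizes-injective : ∀ (J J′ : Subset m) → blockSizes (stdFace J) ≡ blockSizes (stdFace J′) → J ≡ J′
blockSizes-injective Vec.[] Vec.[] _ = refl
blockSizes-injective (inside Vec.∷ J) (inside Vec.∷ J′) eq = cong (inside Vec.∷_)
  (blockSizes-injective J J′ (≡.trans (≡.sym (∣outside∣ (stdBlocks J)))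
      (≡.trans (∷-injectiveʳ eq) (∣outside∣ (stdBlocks J′)))))
blockSizes-injective (outside Vec.∷ J) (outside Vec.∷ J′) eq with ∷-injective eq
... | h , t = cong (outside Vec.∷_) (blockSizes-injective J J′ (cong₂ _∷_ (ℕ.suc-injective h)
      (≡.trans (≡.sym (∣outside∣ (restBlocks J))) (≡.trans t (∣outside∣ (restBlocks J′))))))
blockSizes-injective {suc m} (inside Vec.∷ J) (outside Vec.∷ J′) eq with ∷-injective eq | ∣firstBlock∣ J′
... | h , _ | k , e rewrite e | ∣⊥∣≡0 (suc m) with () ← h
blockSizes-injective {suc m} (outside Vec.∷ J) (inside Vec.∷ J′) eq with ∷-injective eq | ∣firstBlock∣ J
... | h , _ | k , e rewrite e | ∣⊥∣≡0 (suc m) with () ← h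

composition-injective : ∀ (J J′ : Subset m) → composition J ≡ composition J′ → J ≡ J′
composition-injective J J′ eq =
  blockSizes-injective J J′ (≡.trans (blockSizes-stdFace J) (≡.trans eq (≡.sym (blockSizes-stdFace J′))))

-- Monotone faces are determined by their ties between neighbours

≤-suc-split : ∀ {i : Fin (suc m)} {j : Fin m} → toℕ i ≤ toℕ (suc j) → i ≡ suc j ⊎ toℕ i ≤ toℕ (inject₁ j)
≤-suc-split {j = j} le with m≤n⇒m<n∨m≡n le
... | inj₁ (s≤s i≤j) = inj₂ (≤-trans i≤j (≤-reflexive (≡.sym (toℕ-inject₁ j))))
... | inj₂ eq        = inj₁ (toℕ-injective eq)

module _ (f : Face (suc m)) (mono : Monotone f) where

  monotone : ∀ {i j} → toℕ i ≤ toℕ j → lef f i j ≡ true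
  monotone {i} {j} = <-weakInduction (λ j → ∀ i → toℕ i ≤ toℕ j → lef f i j ≡ true) base step j i
    where
    base : ∀ i → toℕ i ≤ 0 → lef f i zero ≡ true
    base zero _ = lef-refl f zero

    step : ∀ j → (∀ i → toℕ i ≤ toℕ (inject₁ j) → lef f i (inject₁ j) ≡ true) →
           ∀ i → toℕ i ≤ toℕ (suc j) → lef f i (suc j) ≡ true
    step j ih i i≤ with ≤-suc-split i≤
    ... | inj₁ refl = lef-refl f (suc j)
    ... | inj₂ i≤j  = lef-trans f (ih i i≤j) (mono j)

module _ (f g : Face (suc m)) (monoᶠ : Monotone f) (monoᵍ : Monotone g) where

  -- If a monotone face places a larger point `j` no later than `i`, all points from `i` to `j` are
  -- tied. Hence every tie is a chain of ties between neighbours, and these are transferred by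
  -- `steps`.
  descent-⇒ : (∀ i → lef f (suc i) (inject₁ i) ≡ true → lef g (suc i) (inject₁ i) ≡ true) →
              ∀ {i j} → toℕ i ≤ toℕ j → lef f j i ≡ true → lef g j i ≡ true
  descent-⇒ steps {i} {j} = <-weakInduction
    (λ j → ∀ i → toℕ i ≤ toℕ j → lef f j i ≡ true → lef g j i ≡ true) base step j i
    where
    base : ∀ i → toℕ i ≤ 0 → lef f zero i ≡ true → lef g zero i ≡ true
    base zero _ _ = lef-refl g zero

    step : ∀ j → (∀ i → toℕ i ≤ toℕ (inject₁ j) → lef f (inject₁ j) i ≡ true → lef g (inject₁ j) i ≡ true) →
           ∀ i → toℕ i ≤ toℕ (suc j) → lef f (suc j) i ≡ true → lef g (suc j) i ≡ true
    step j ih i i≤ p with ≤-suc-split i≤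
    ... | inj₁ refl = lef-refl g (suc j)
    ... | inj₂ i≤j  = lef-trans g (steps j (lef-trans f p (monotone f monoᶠ i≤j)))
                                  (ih i i≤j (lef-trans f (monoᶠ j) p))

monotone-ext : ∀ {f g : Face (suc m)} → Monotone f → Monotone g →
               (∀ i → lef f (suc i) (inject₁ i) ≡ lef g (suc i) (inject₁ i)) → f ≡ g
monotone-ext {f = f} {g} monoᶠ monoᵍ eq = face-ext λ i j → go i j (toℕ i ℕ.≤? toℕ j)
  where
  go : ∀ i j → Dec (toℕ i ≤ toℕ j) → lef f i j ≡ lef g i j
  go i j (yes i≤j) = ≡.trans (monotone f monoᶠ i≤j) (≡.sym (monotone g monoᵍ i≤j))
  go i j (no  i≰j) = ≡-from-⇔
    (descent-⇒ f g monoᶠ monoᵍ (λ i → ≡.trans (≡.sym (eq i))) (<⇒≤ (≰⇒> i≰j)))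
    (descent-⇒ g f monoᵍ monoᶠ (λ i → ≡.trans (eq i)) (<⇒≤ (≰⇒> i≰j)))

ascents : Face (suc m) → Subset m
ascents f = tabulate λ i → not (lef f (suc i) (inject₁ i))

monotone⇒stdFace : ∀ {f : Face (suc m)} → Monotone f → f ≡ stdFace (ascents f)
monotone⇒stdFace {f = f} mono = monotone-ext mono (stdFace-monotone (ascents f)) λ i → begin
  lef f (suc i) (inject₁ i)  ≡⟨ not-involutive _ ⟨
  not (not (lef f (suc i) (inject₁ i)))  ≡⟨ cong not (lookup∘tabulate _ i) ⟨
  not (lookup (ascents f) i)  ≡⟨ stdFace-step (ascents f) i ⟨
  lef (stdFace (ascents f)) (suc i) (inject₁ i) ∎
  where open ≡.≡-Reasoning

-- Chambers and permutations

IsChamber : Face n → Set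
IsChamber f = ∀ {i j} → samef f i j ≡ true → i ≡ j

-- The chamber ({1}, {2}, …, {n}).
c₀ : Face (suc m)
c₀ = stdFace ⊤

c₀-step : ∀ (i : Fin m) → lef c₀ (suc i) (inject₁ i) ≡ false
c₀-step i = ≡.trans (stdFace-step ⊤ i) (cong not (lookup-replicate i inside))

c₀-≤ : ∀ {i j : Fin (suc m)} → toℕ i ≤ toℕ j → lef c₀ i j ≡ true
c₀-≤ = monotone c₀ (stdFace-monotone ⊤)

c₀-> : ∀ {i j : Fin (suc m)} → toℕ j < toℕ i → lef c₀ i j ≡ false
c₀-> {i = suc i} {j} (s≤s j≤i) = ≢true⇒false λ p → false≢true (c₀-step i)
  (lef-trans c₀ {suc i} {j} {inject₁ i} p (c₀-≤ (≤-trans j≤i (≤-reflexive (≡.sym (toℕ-inject₁ i))))))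

c₀-≤⁻ : ∀ {i j : Fin (suc m)} → lef c₀ i j ≡ true → toℕ i ≤ toℕ j
c₀-≤⁻ {i = i} {j} p with toℕ i ℕ.≤? toℕ j
... | yes i≤j = i≤j
... | no  i≰j = contradiction p (false≢true (c₀-> (≰⇒> i≰j)))

c₀-chamber : IsChamber (c₀ {m})
c₀-chamber {_} {i} {j} p with same-elim c₀ {i} {j} p
... | a , b = toℕ-injective (≤-antisym (c₀-≤⁻ a) (c₀-≤⁻ b))

◃-chamber : ∀ (π : Permutation′ n) f → IsChamber f → IsChamber (π ◃ f)
◃-chamber π f ch {i} {j} p = ⟨$⟩ˡ-injective π (ch (≡.trans (≡.sym (same-◃ π f i j)) p))

module _ {m : ℕ} where
  open RawMonoid (faceMonoid m) using (_∙_)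

  ∙-le⁻ˡ : ∀ f g {i j} → lef (f ∙ g) i j ≡ true → lef f i j ≡ true
  ∙-le⁻ˡ f g {i} {j} p = proj₁ (∧-true (≡.trans (≡.sym (lef-∙ f g i j)) p))

  ∙-le⁻ʳ : ∀ f g {i j} → lef (f ∙ g) i j ≡ true → lef f j i ≡ true → lef g i j ≡ true
  ∙-le⁻ʳ f g {i} {j} p q with proj₂ (∧-true {lef f i j} (≡.trans (≡.sym (lef-∙ f g i j)) p))
  ... | r rewrite q = r

  ∙-le-same : ∀ f g {i j} → samef f i j ≡ true → lef (f ∙ g) i j ≡ lef g i j
  ∙-le-same f g {i} {j} p with same-elim f p
  ... | a , b = ≡.trans (lef-∙ f g i j) (cong₂ (λ a b → a ∧ (not b ∨ lef g i j)) a b)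

  ∙-le-lt : ∀ f g {i j} → lef f j i ≡ false → lef (f ∙ g) i j ≡ true
  ∙-le-lt f g {i} {j} p = ≡.trans (lef-∙ f g i j) (cong₂ (λ a b → a ∧ (not b ∨ lef g i j)) (lef-total f p) p)

  ∙-le-gt : ∀ f g {i j} → lef f i j ≡ false → lef (f ∙ g) i j ≡ false
  ∙-le-gt f g {i} {j} p = ≡.trans (lef-∙ f g i j) (cong (_∧ (not (lef f j i) ∨ lef g i j)) p)

  ∙-same⁻ : ∀ f g {i j} → samef (f ∙ g) i j ≡ true → samef f i j ≡ true × samef g i j ≡ true
  ∙-same⁻ f g p with same-elim (f ∙ g) p
  ... | a , b with ∙-le⁻ˡ f g a | ∙-le⁻ˡ f g b
  ... | c | d = same-intro f c d , same-intro g (∙-le⁻ʳ f g a d) (∙-le⁻ʳ f g b c)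

  ∙-chamber : ∀ f g → IsChamber g → IsChamber (f ∙ g)
  ∙-chamber f g ch p = ch (proj₂ (∙-same⁻ f g p))

  -- Two points tied in `f` are tied in `g`, so `g` has no tie left to break.
  ∙-absorb : ∀ {f g} → f ⊑ g → f ∙ g ≡ f
  ∙-absorb {f} {g} f⊑g = face-ext λ i j → ≡-from-⇔ (∙-le⁻ˡ f g) λ p → go i j p _ refl
    where
    go : ∀ i j → lef f i j ≡ true → ∀ b → lef f j i ≡ b → lef (f ∙ g) i j ≡ true
    go i j p false q = ∙-le-lt f g q
    go i j p true  q = ≡.trans (∙-le-same f g (same-intro f p q))
        (proj₁ (same-elim g (f⊑g (same-intro f p q))))

-- Pigeonhole: punching out a missed value would embed `Fin (suc n)` into `Fin n`.
injective⇒surjective : ∀ {n} (f : Fin n → Fin n) → (∀ {i j} → f i ≡ f j → i ≡ j) → ∀ y → ∃ λ x → f x ≡ y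
injective⇒surjective {suc n} f inj y with any? (λ x → f x ≟ᶠ y)
... | yes p = p
... | no ¬p = contradiction (injective⇒≤ {f = λ x → punchOut {i = y} {f x} (λ eq → ¬p (x , ≡.sym eq))}
                (λ eq → inj (punchOut-injective {i = y} _ _ eq))) ℕ.1+n≰n

module _ (z : Face (suc m)) (ch : IsChamber z) where

  private
    below : Fin (suc m) → Subset (suc m)
    below i = tabulate λ k → not (lef z i k)

    ∈below : ∀ {i k} → lef z i k ≡ false → k ∈ below i
    ∈below {i} {k} p = true⇒∈ (≡.trans (lookup∘tabulate (λ k → not (lef z i k)) k) (cong not p))

    below∈ : ∀ {i k} → k ∈ below i → lef z i k ≡ false
    below∈ {i} {k} k∈ = not-injective (≡.trans (≡.sym (lookup∘tabulate (λ k → not (lef z i k)) k))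
        (∈⇒true k∈))

    rank : Fin (suc m) → ℕ
    rank i = ∣ below i ∣

    ∉below : ∀ i → ¬ (i ∈ below i)
    ∉below i i∈ = false≢true (below∈ i∈) (lef-refl z i)

    rank-< : ∀ i → rank i < suc m
    rank-< i = subst (rank i <_) (∣⊤∣≡n (suc m)) (p⊂q⇒∣p∣<∣q∣ ((λ _ → ∈⊤) , i , ∈⊤ , ∉below i))

    rank-strict : ∀ {i j} → lef z j i ≡ false → rank i < rank j
    rank-strict {i} {j} p = p⊂q⇒∣p∣<∣q∣
      ( (λ {k} k∈ → ∈below (≢true⇒false λ q → false≢true (below∈ k∈) (lef-trans z (lef-total z p) q)))
      , i , ∈below p , ∉below i )

    pos : Fin (suc m) → Fin (suc m)
    pos i = fromℕ< (rank-< i)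

    toℕ-pos : ∀ i → toℕ (pos i) ≡ rank i
    toℕ-pos i = toℕ-fromℕ< (rank-< i)

    rank-mono : ∀ {i j} → lef z i j ≡ true → rank i ≤ rank j
    rank-mono {i} {j} p = by-cases _ refl
      where
      by-cases : ∀ b → lef z j i ≡ b → rank i ≤ rank j
      by-cases true  q = ≤-reflexive (cong rank (ch (same-intro z p q)))
      by-cases false q = <⇒≤ (rank-strict q)

    rank-mono⁻ : ∀ {i j} → rank i ≤ rank j → lef z i j ≡ true
    rank-mono⁻ {i} {j} p = by-cases _ refl
      where
      by-cases : ∀ b → lef z i j ≡ b → lef z i j ≡ true
      by-cases true  q = q
      by-cases false q = contradiction p (<⇒≱ (rank-strict q))

    pos-injective : ∀ {i j} → pos i ≡ pos j → i ≡ j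
    pos-injective {i} {j} eq = ch (same-intro z (rank-mono⁻ (≤-reflexive r))
        (rank-mono⁻ (≤-reflexive (≡.sym r))))
      where r = fromℕ<-injective _ _ _ _ eq

    surj = injective⇒surjective pos pos-injective

    perm : Permutation′ (suc m)
    perm = permutation (λ k → proj₁ (surj k)) pos
      (λ x → pos-injective (proj₂ (surj (pos x)))) (λ y → proj₂ (surj y))

  -- The permutation sends `k` to the point with exactly `k` points strictly before it in `z`. Its
  -- inverse `pos` counts these points, and strict monotonicity of the count makes it injective.
  chamber⇒perm : ∃ λ w → z ≡ w ◃ c₀
  chamber⇒perm = perm , face-ext λ i j → ≡.trans (≡-from-⇔
    (λ p → c₀-≤ (subst₂ _≤_ (≡.sym (toℕ-pos i)) (≡.sym (toℕ-pos j)) (rank-mono p)))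
    (λ p → rank-mono⁻ (subst₂ _≤_ (toℕ-pos i) (toℕ-pos j) (c₀-≤⁻ p)))) (≡.sym (lef-◃ perm c₀ i j))

increasing⇒≥ : ∀ (f : Fin (suc m) → Fin (suc m)) → (∀ i → toℕ (f (inject₁ i)) < toℕ (f (suc i))) →
               ∀ i → toℕ i ≤ toℕ (f i)
increasing⇒≥ f inc = <-weakInduction (λ i → toℕ i ≤ toℕ (f i)) z≤n
  λ i ih → ≤-trans (s≤s (≤-trans (≤-reflexive (≡.sym (toℕ-inject₁ i))) ih)) (inc i)

-- The permutation `w′⁻¹ w` is strictly increasing, hence at least the identity at every point. The
-- same holds for its inverse, so both are the identity.
w◃c₀-injective : ∀ {w w′ : Permutation′ (suc m)} → w ◃ c₀ ≡ w′ ◃ c₀ → w Perm.≈ w′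
w◃c₀-injective {m} {w} {w′} eq i = toℕ-injective (≤-antisym (half w w′ eq i) (half w′ w (≡.sym eq) i))
  where
  order : ∀ w w′ → w ◃ c₀ ≡ w′ ◃ c₀ → ∀ {i j : Fin (suc m)} → toℕ (w ⟨$⟩ˡ i) ≤ toℕ (w ⟨$⟩ˡ j) →
      toℕ (w′ ⟨$⟩ˡ i) ≤ toℕ (w′ ⟨$⟩ˡ j)
  order w w′ eq {i} {j} p = c₀-≤⁻ (≡.trans (≡.sym (lef-◃ w′ c₀ i j))
      (≡.trans (cong (λ f → lef f i j) (≡.sym eq))
    (≡.trans (lef-◃ w c₀ i j) (c₀-≤ p))))

  below : ∀ w w′ → w ◃ c₀ ≡ w′ ◃ c₀ → ∀ i → toℕ i ≤ toℕ (w′ ⟨$⟩ˡ (w ⟨$⟩ʳ i))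
  below w w′ eq = increasing⇒≥ (λ i → w′ ⟨$⟩ˡ (w ⟨$⟩ʳ i)) λ i → ≰⇒> λ p →
    let i<i : toℕ (suc i) ≤ toℕ (inject₁ i)
        i<i = subst₂ (λ a b → toℕ a ≤ toℕ b) (inverseˡ w) (inverseˡ w) (order w′ w (≡.sym eq) p)
    in n≮n (toℕ i) (≤-trans i<i (≤-reflexive (toℕ-inject₁ i)))

  fixed : ∀ w w′ → w ◃ c₀ ≡ w′ ◃ c₀ → ∀ i → w′ ⟨$⟩ˡ (w ⟨$⟩ʳ i) ≡ i
  fixed w w′ eq i = toℕ-injective (≤-antisym
    (≤-trans (below w′ w (≡.sym eq) (w′ ⟨$⟩ˡ (w ⟨$⟩ʳ i)))
       (≤-reflexive (cong toℕ (≡.trans (cong (w ⟨$⟩ˡ_) (inverseʳ w′)) (inverseˡ w)))))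
    (below w w′ eq i))

  half : ∀ w w′ → w ◃ c₀ ≡ w′ ◃ c₀ → ∀ i → toℕ (w ⟨$⟩ʳ i) ≤ toℕ (w′ ⟨$⟩ʳ i)
  half w w′ eq i = ≤-reflexive (cong toℕ (≡.trans (≡.sym (inverseʳ w′)) (cong (w′ ⟨$⟩ʳ_) (fixed w w′ eq i))))

-- The enumerations are complete and without repetition

allSubsets-unique : ∀ n → Unique (allSubsets n)
allSubsets-unique zero    = [] ∷ []
allSubsets-unique (suc n) = Unique.cartesianProductWith⁺ Vec._∷_ Vec.∷-injective
  (((λ ()) ∷ []) ∷ [] ∷ []) (allSubsets-unique n)

∈-allSubsets : ∀ (P : Subset n) → P ∈ˡ allSubsets n
∈-allSubsets Vec.[]            = here refl
∈-allSubsets (inside  Vec.∷ P) = ∈-cartesianProductWith⁺ Vec._∷_ {xs = inside ∷ outside ∷ []} (here refl)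
    (∈-allSubsets P)
∈-allSubsets (outside Vec.∷ P) = ∈-cartesianProductWith⁺ Vec._∷_ {xs = inside ∷ outside ∷ []}
    (there (here refl)) (∈-allSubsets P)

listsOfLength-unique : ∀ k {xs : List A} → Unique xs → Unique (listsOfLength k xs)
listsOfLength-unique zero    xs! = [] ∷ []
listsOfLength-unique (suc k) xs! = Unique.cartesianProductWith⁺ _∷_ ∷-injective xs!
    (listsOfLength-unique k xs!)

∈-listsOfLength : ∀ {xs : List A} → (∀ x → x ∈ˡ xs) → ∀ ys → ys ∈ˡ listsOfLength (length ys) xs
∈-listsOfLength all []       = here refl
∈-listsOfLength all (y ∷ ys) = ∈-cartesianProductWith⁺ _∷_ (all y) (∈-listsOfLength all ys)

listsOfLength-length : ∀ k {xs : List A} {ys} → ys ∈ˡ listsOfLength k xs → length ys ≡ k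
listsOfLength-length zero    (here refl) = refl
listsOfLength-length (suc k) {xs} ys∈ with ∈-cartesianProductWith⁻ _∷_ xs (listsOfLength k xs) ys∈
... | y , ys , _ , ys∈′ , refl = cong suc (listsOfLength-length k ys∈′)

listsUpTo-unique : ∀ k {xs : List A} → Unique xs → Unique (listsUpTo k xs)
listsUpTo-unique k {xs} xs! = Unique.concat⁺
  (All.map⁺ (All.universal (λ i → listsOfLength-unique i xs!) (upTo (suc k))))
  (AllPairs.map⁺ (AllPairs.map (λ {i} {j} i≢j {ys} (p , q) →
     i≢j (≡.trans (≡.sym (listsOfLength-length i p)) (listsOfLength-length j q))) (Unique.upTo⁺ (suc k))))

∈-listsUpTo : ∀ {k} {xs : List A} → (∀ x → x ∈ˡ xs) → ∀ ys → length ys ≤ k → ys ∈ˡ listsUpTo k xs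
∈-listsUpTo {xs = xs} all ys len = ∈-concat⁺′ (∈-listsOfLength all ys)
  (∈-map⁺ (λ i → listsOfLength i xs) (∈-upTo⁺ (s≤s len)))

private
  -- Abstracting over the decision procedure keeps its unfolding out of the goals.
  module _ (P? : (Ps : List (Subset n)) → Dec (IsOrderedSetPartition Ps)) where
    blocks-mapMaybe : ∀ Pss →
      map blocks (mapMaybe (λ Ps → Maybe.map (λ pf → mkFace Ps pf) (dec⇒maybe (P? Ps))) Pss) ≡ filter P? Pss
    blocks-mapMaybe []         = refl
    blocks-mapMaybe (Ps ∷ Pss) with P? Ps
    ... | yes _ = cong (Ps ∷_) (blocks-mapMaybe Pss)
    ... | no  _ = blocks-mapMaybe Pss

  blocks-allFaces : ∀ n → map blocks (allFaces n) ≡ filter isOrderedSetPartition? (listsUpTo n (allSubsets n))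
  blocks-allFaces n = blocks-mapMaybe isOrderedSetPartition? (listsUpTo n (allSubsets n))

allFaces-unique : ∀ n → Unique (allFaces n)
allFaces-unique n = Unique.map⁻ {f = blocks} (subst Unique (≡.sym (blocks-allFaces n))
  (Unique.filter⁺ isOrderedSetPartition? (listsUpTo-unique n (allSubsets-unique n))))

disjoint-lookup : ∀ {Ps : List (Subset n)} → AllPairs Disjoint Ps → ∀ {i} k l →
                  i ∈ List.lookup Ps k → i ∈ List.lookup Ps l → k ≡ l
disjoint-lookup {Ps = P ∷ Ps} (d ∷ ds) zero    zero    p q = refl
disjoint-lookup {Ps = P ∷ Ps} (d ∷ ds) (suc k) (suc l) p q = cong suc (disjoint-lookup ds k l p q)
disjoint-lookup {Ps = P ∷ Ps} (d ∷ ds) zero    (suc l) p q =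
  contradiction (_ , x∈p∩q⁺ (p , q)) (All.lookup d (∈-lookup l))
disjoint-lookup {Ps = P ∷ Ps} (d ∷ ds) (suc k) zero    p q =
  contradiction (_ , x∈p∩q⁺ (q , p)) (All.lookup d (∈-lookup k))

-- Choosing a point in each block is injective because the blocks are disjoint. The bound on the
-- length in `allFaces` therefore loses no face.
length-blocks : ∀ (f : Face n) → length (blocks f) ≤ n
length-blocks f = injective⇒≤ {f = λ k → proj₁ (element k)} λ {k} {l} eq →
  disjoint-lookup (IsOrderedSetPartition.disjoint (isOSP f)) k l (proj₂ (element k))
    (subst (_∈ List.lookup (blocks f) l) (≡.sym eq) (proj₂ (element l)))
  where
  element : ∀ k → ∃ (_∈ List.lookup (blocks f) k)
  element k = All.lookup (IsOrderedSetPartition.nonempty (isOSP f)) (∈-lookup k)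

∈-allFaces : ∀ (f : Face n) → f ∈ˡ allFaces n
∈-allFaces {n} f with ∈-map⁻ blocks (subst (blocks f ∈ˡ_) (≡.sym (blocks-allFaces n))
  (∈-filter⁺ isOrderedSetPartition? (∈-listsUpTo ∈-allSubsets (blocks f) (length-blocks f)) (isOSP f)))
... | g , g∈ , eq = subst (_∈ˡ allFaces n) (≡.sym (blocks-injective eq)) g∈
  where
  blocks-injective : ∀ {f g : Face n} → blocks f ≡ blocks g → f ≡ g
  blocks-injective refl = refl

permSetoid : ℕ → Setoid _ _
permSetoid n = record
  { Carrier = Permutation′ n ; _≈_ = Perm._≈_
  ; isEquivalence = record { refl = λ _ → refl ; sym = λ p i → ≡.sym (p i) ; trans = λ p q i →
        ≡.trans (p i) (q i) } }

allPermutations-unique : ∀ n → AllPairs (λ π ρ → ¬ π Perm.≈ ρ) (allPermutations n)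
allPermutations-unique zero    = [] ∷ []
allPermutations-unique (suc n) =
  UniqueS.cartesianProductWith⁺ (≡.setoid (Fin (suc n))) (permSetoid n) (permSetoid (suc n)) (insert zero)
    (λ {i} {j} {π} {ρ} eq → head (eq zero) , λ k → punchIn-injective i _ _ (begin
      punchIn i (π ⟨$⟩ʳ k)  ≡⟨ insert-punchIn zero i π k ⟨
      insert zero i π ⟨$⟩ʳ suc k  ≡⟨ eq (suc k) ⟩
      insert zero j ρ ⟨$⟩ʳ suc k  ≡⟨ insert-punchIn zero j ρ k ⟩
      punchIn j (ρ ⟨$⟩ʳ k)  ≡⟨ cong (λ i → punchIn i (ρ ⟨$⟩ʳ k)) (head (eq zero)) ⟨
      punchIn i (ρ ⟨$⟩ʳ k)  ∎))
    (Unique.allFin⁺ (suc n)) (allPermutations-unique n)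
  where
  open ≡.≡-Reasoning
  -- At `zero`, `insert zero i π` computes to `i`, so the identity function suffices to read
  -- `eq zero` as `i ≡ j`.
  head : ∀ {a b : Fin (suc n)} → a ≡ b → a ≡ b
  head p = p

insert-cong : ∀ {n} (i : Fin (suc n)) {π ρ : Permutation′ n} → π Perm.≈ ρ →
    insert zero i π Perm.≈ insert zero i ρ
insert-cong i p zero    = refl
insert-cong i p (suc k) = cong (punchIn i) (p k)

∈-allPermutations : ∀ (π : Permutation′ n) → Any (π Perm.≈_) (allPermutations n)
∈-allPermutations {zero}  π = here λ ()
∈-allPermutations {suc n} π = Any.cartesianProductWith⁺ (insert zero)
  (λ { {i} {ρ} refl p k → ≡.trans (≡.sym (insert-remove zero π k)) (insert-cong i {remove zero π} {ρ} p k) })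
  (∈-allFin (π ⟨$⟩ʳ zero)) (∈-allPermutations (remove zero π))

-- Parity of inversions, as sums over the field with two elements

open Sum (CommutativeRing.+-commutativeMonoid xor-∧-commutativeRing)
  using (sum; sum-cong-≗; sum-permute; ∑-comm; ∑-distrib-+)

xor-cancel : ∀ {a b} → a ≡ b → a xor b ≡ false
xor-cancel {a} refl = xor-same a

sum-false : ∀ {n} {f : Fin n → Bool} → (∀ i → f i ≡ false) → sum f ≡ false
sum-false {zero}  p = refl
sum-false {suc n} p = cong₂ _xor_ (p zero) (sum-false (λ i → p (suc i)))

sum-one : ∀ {n} (f : Fin n → Bool) i → (∀ j → ¬ j ≡ i → f j ≡ false) → sum f ≡ f i
sum-one f zero    p = ≡.trans (cong (f zero xor_) (sum-false (λ i → p (suc i) λ ()))) (xor-identityʳ _)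
sum-one f (suc i) p rewrite p zero (λ ()) = sum-one (f ∘ suc) i (λ j j≢i → p (suc j) (j≢i ∘ suc-injective))

sum-two : ∀ {n} (f : Fin n → Bool) i j → ¬ i ≡ j → (∀ k → ¬ k ≡ i → ¬ k ≡ j → f k ≡ false) →
    sum f ≡ f i xor f j
sum-two f zero    zero    i≢j p = contradiction refl i≢j
sum-two f zero    (suc j) i≢j p = cong (f zero xor_) (sum-one (f ∘ suc) j λ k k≢j →
    p (suc k) (λ ()) (k≢j ∘ suc-injective))
sum-two f (suc i) zero    i≢j p = ≡.trans (cong (f zero xor_) (sum-one (f ∘ suc) i λ k k≢i →
    p (suc k) (k≢i ∘ suc-injective) λ ()))
                                        (xor-comm (f zero) _)
sum-two f (suc i) (suc j) i≢j p rewrite p zero (λ ()) (λ ()) =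
  sum-two (f ∘ suc) i j (i≢j ∘ cong suc) λ k k≢i k≢j → p (suc k) (k≢i ∘ suc-injective) (k≢j ∘ suc-injective)

_<ᵇ_ : Fin n → Fin n → Bool
i <ᵇ j = does (i <? j)

-- A tournament: of the two directions between distinct points exactly one holds. This is what the
-- strict orders of chambers and the pullbacks of the natural order have in common.
record Strict (o : Fin n → Fin n → Bool) : Set where
  field
    irrefl  : ∀ i → o i i ≡ false
    connex  : ∀ {i j} → ¬ i ≡ j → o j i ≡ not (o i j)

<ᵇ-strict : Strict (_<ᵇ_ {n})
<ᵇ-strict {n} = record { irrefl = λ i → dec-false (i <? i) (<-irrefl {n} refl) ; connex = connex }
  where
  connex : ∀ {i j : Fin n} → ¬ i ≡ j → (j <ᵇ i) ≡ not (i <ᵇ j)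
  connex {i} {j} i≢j with <-cmp i j
  ... | tri< i<j _ _ = ≡.trans (dec-false (j <? i) (<-asym {n} i<j))
      (cong not (≡.sym (dec-true (i <? j) i<j)))
  ... | tri≈ _ i≡j _ = contradiction i≡j i≢j
  ... | tri> _ _ j<i = ≡.trans (dec-true (j <? i) j<i)
      (cong not (≡.sym (dec-false (i <? j) (<-asym {n} j<i))))

pullback-strict : ∀ {o : Fin n → Fin n → Bool} (π : Permutation′ n) → Strict o →
    Strict (λ i j → o (π ⟨$⟩ʳ i) (π ⟨$⟩ʳ j))
pullback-strict π s = record
  { irrefl = λ i → Strict.irrefl s _
  ; connex = λ i≢j → Strict.connex s (i≢j ∘ ⟨$⟩ʳ-injective π)
  }

-- Opaque so that F can be inferred from ⨁ F.
opaque
  ⨁ : (Fin n → Fin n → Bool) → Bool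
  ⨁ F = sum λ i → sum λ j → F i j

module _ {n : ℕ} where
  opaque
    unfolding ⨁

    ⨁-rows : ∀ (F : Fin n → Fin n → Bool) {f} → (∀ i → sum (F i) ≡ f i) → ⨁ F ≡ sum f
    ⨁-rows F {f} p = sum-cong-≗ {n} {λ i → sum (F i)} {f} p

    ⨁-cong : ∀ {F G : Fin n → Fin n → Bool} → (∀ i j → F i j ≡ G i j) → ⨁ F ≡ ⨁ G
    ⨁-cong {F} {G} p = sum-cong-≗ {n} {λ i → sum (F i)} {λ i → sum (G i)} λ i →
        sum-cong-≗ {n} {F i} {G i} (p i)

    ⨁-xor : ∀ (F G : Fin n → Fin n → Bool) → ⨁ (λ i j → F i j xor G i j) ≡ ⨁ F xor ⨁ G
    ⨁-xor F G = ≡.trans (sum-cong-≗ {n} {λ i → sum (λ j → F i j xor G i j)} {λ i →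
        sum (F i) xor sum (G i)} λ i → ∑-distrib-+ (F i) (G i))
      (∑-distrib-+ (λ i → sum (F i)) (λ i → sum (G i)))

    ⨁-swap : ∀ (F : Fin n → Fin n → Bool) → ⨁ F ≡ ⨁ (λ i j → F j i)
    ⨁-swap = ∑-comm

    ⨁-permute : ∀ (F : Fin n → Fin n → Bool) (π : Permutation′ n) → ⨁ F ≡ ⨁ (λ i j → F (π ⟨$⟩ʳ i) (π ⟨$⟩ʳ j))
    ⨁-permute F π = ≡.trans (sum-permute (λ i → sum (F i)) π)
      (sum-cong-≗ {n} {λ i → sum (F (π ⟨$⟩ʳ i))} {λ i → sum (λ j → F (π ⟨$⟩ʳ i) (π ⟨$⟩ʳ j))} λ i →
          sum-permute (F (π ⟨$⟩ʳ i)) π)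

  -- Modulo 2, the entries at `(i , j)` and `(j , i)` cancel; the natural order selects one entry of
  -- each such pair.
  ⨁-symmetric : ∀ (F : Fin n → Fin n → Bool) → (∀ i → F i i ≡ false) → (∀ i j → F i j ≡ F j i) → ⨁ F ≡ false
  ⨁-symmetric F irr symm = begin
    ⨁ F  ≡⟨ ⨁-cong split ⟩
    ⨁ (λ i j → ((i <ᵇ j) ∧ F i j) xor ((j <ᵇ i) ∧ F i j))  ≡⟨ ⨁-xor _ _ ⟩
    ⨁ (λ i j → (i <ᵇ j) ∧ F i j) xor ⨁ (λ i j → (j <ᵇ i) ∧ F i j)
      ≡⟨ xor-cancel (≡.trans (⨁-swap (λ i j → (i <ᵇ j) ∧ F i j)) (⨁-cong λ i j →
          cong ((j <ᵇ i) ∧_) (symm j i))) ⟩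
    false  ∎
    where
    open ≡.≡-Reasoning
    split : ∀ i j → F i j ≡ ((i <ᵇ j) ∧ F i j) xor ((j <ᵇ i) ∧ F i j)
    split i j with i ≟ᶠ j
    ... | yes refl rewrite irr i | ∧-zeroʳ (i <ᵇ i) = refl
    ... | no  i≢j rewrite Strict.connex <ᵇ-strict i≢j with i <ᵇ j
    ...   | true  = ≡.sym (xor-identityʳ _)
    ...   | false = refl

-- The parity of the pairs that the two relations order oppositely. For a strict `o`, the condition
-- `o i j` counts each unordered pair once; a tie of `o′` is no inversion.
inv : (o o′ : Fin n → Fin n → Bool) → Bool
inv o o′ = ⨁ λ i j → o i j ∧ o′ j i

inv-cong : ∀ {o p o′ p′ : Fin n → Fin n → Bool} → (∀ i j → o i j ≡ p i j) → (∀ i j → o′ i j ≡ p′ i j) →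
    inv o o′ ≡ inv p p′
inv-cong e e′ = ⨁-cong λ i j → cong₂ _∧_ (e i j) (e′ j i)

-- A pair is inverted from `o` to `q` exactly when it is inverted in one, but not both, of the two
-- steps. With ordered pairs this appears as symmetry of the sum of the three terms, which then
-- vanishes modulo 2.
inv-cocycle : ∀ {o p q : Fin n → Fin n → Bool} → Strict o → Strict p → Strict q →
    inv o p xor inv p q ≡ inv o q
inv-cocycle {o = o} {p} {q} so sp sq = from-xor (begin
  (inv o p xor inv p q) xor inv o q
    ≡⟨ cong (_xor inv o q) (⨁-xor _ _) ⟨
  ⨁ (λ i j → (o i j ∧ p j i) xor (p i j ∧ q j i)) xor inv o q  ≡⟨ ⨁-xor _ _ ⟨
  ⨁ (λ i j → ((o i j ∧ p j i) xor (p i j ∧ q j i)) xor (o i j ∧ q j i))  ≡⟨ ⨁-symmetric _ irr symm ⟩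
  false  ∎)
  where
  open ≡.≡-Reasoning
  from-xor : ∀ {a b} → a xor b ≡ false → a ≡ b
  from-xor {true}  {true}  _ = refl
  from-xor {false} {false} _ = refl

  irr : ∀ i → ((o i i ∧ p i i) xor (p i i ∧ q i i)) xor (o i i ∧ q i i) ≡ false
  irr i rewrite Strict.irrefl so i | Strict.irrefl sp i = refl

  symm : ∀ i j → ((o i j ∧ p j i) xor (p i j ∧ q j i)) xor (o i j ∧ q j i) ≡
                 ((o j i ∧ p i j) xor (p j i ∧ q i j)) xor (o j i ∧ q i j)
  symm i j with i ≟ᶠ j
  ... | yes refl = refl
  ... | no  i≢j rewrite Strict.connex so i≢j | Strict.connex sp i≢j | Strict.connex sq i≢j
    with o i j | p i j | q i j
  ...   | true  | true  | true  = refl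
  ...   | true  | true  | false = refl
  ...   | true  | false | true  = refl
  ...   | true  | false | false = refl
  ...   | false | true  | true  = refl
  ...   | false | true  | false = refl
  ...   | false | false | true  = refl
  ...   | false | false | false = refl

odd : Permutation′ n → Bool
odd π = inv _<ᵇ_ (λ i j → (π ⟨$⟩ʳ i) <ᵇ (π ⟨$⟩ʳ j))

odd-cong : ∀ {π ρ : Permutation′ n} → π Perm.≈ ρ → odd π ≡ odd ρ
odd-cong p = inv-cong (λ _ _ → refl) (λ i j → cong₂ _<ᵇ_ (p i) (p j))

-- The cocycle identity for the natural order, its pullback along `ρ` and its pullback along the
-- composite. Reindexing by `ρ` turns the second term into `odd π`.
odd-∘ : ∀ (π ρ : Permutation′ n) → odd (ρ ∘ₚ π) ≡ odd π xor odd ρ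
odd-∘ π ρ = begin
  odd (ρ ∘ₚ π)
    ≡⟨ inv-cocycle <ᵇ-strict (pullback-strict ρ <ᵇ-strict) (pullback-strict (ρ ∘ₚ π) <ᵇ-strict) ⟨
  odd ρ xor inv (λ i j → (ρ ⟨$⟩ʳ i) <ᵇ (ρ ⟨$⟩ʳ j)) (λ i j → (π ⟨$⟩ʳ (ρ ⟨$⟩ʳ i)) <ᵇ (π ⟨$⟩ʳ (ρ ⟨$⟩ʳ j)))
    ≡⟨ cong (odd ρ xor_) (⨁-permute (λ i j → (i <ᵇ j) ∧ ((π ⟨$⟩ʳ j) <ᵇ (π ⟨$⟩ʳ i))) ρ) ⟨
  odd ρ xor odd π  ≡⟨ xor-comm (odd ρ) (odd π) ⟩
  odd π xor odd ρ  ∎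
  where open ≡.≡-Reasoning

odd-flip : ∀ (π : Permutation′ n) → odd (flip π) ≡ odd π
odd-flip π = begin
  odd (flip π)
    ≡⟨ ⨁-permute (λ i j → (i <ᵇ j) ∧ ((π ⟨$⟩ˡ j) <ᵇ (π ⟨$⟩ˡ i))) π ⟩
  ⨁ (λ i j → ((π ⟨$⟩ʳ i) <ᵇ (π ⟨$⟩ʳ j)) ∧ ((π ⟨$⟩ˡ (π ⟨$⟩ʳ j)) <ᵇ (π ⟨$⟩ˡ (π ⟨$⟩ʳ i))))
    ≡⟨ ⨁-cong (λ i j → ≡.trans (cong₂ (λ a b → ((π ⟨$⟩ʳ i) <ᵇ (π ⟨$⟩ʳ j)) ∧ (a <ᵇ b)) (inverseˡ π)
        (inverseˡ π)) (∧-comm ((π ⟨$⟩ʳ i) <ᵇ (π ⟨$⟩ʳ j)) (j <ᵇ i))) ⟩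
  ⨁ (λ i j → (j <ᵇ i) ∧ ((π ⟨$⟩ʳ i) <ᵇ (π ⟨$⟩ʳ j)))
    ≡⟨ ⨁-swap _ ⟩
  odd π ∎
  where open ≡.≡-Reasoning

-- For an involution τ, (a , b) ↦ (τ b , τ a) permutes the inversions, and the inversions it fixes
-- are the pairs (a , τ a) with a < τ a.
odd-involution : ∀ (τ : Permutation′ n) → (∀ i → τ ⟨$⟩ʳ (τ ⟨$⟩ʳ i) ≡ i) → odd τ ≡ sum λ a → a <ᵇ (τ ⟨$⟩ʳ a)
odd-involution {n} τ invol = begin
  ⨁ F  ≡⟨ ⨁-cong split ⟩
  ⨁ (λ a b → (less a b xor greater a b) xor equal a b)
    ≡⟨ ≡.trans (⨁-xor _ _) (cong (_xor ⨁ equal) (⨁-xor _ _)) ⟩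
  (⨁ less xor ⨁ greater) xor ⨁ equal  ≡⟨ cong (_xor ⨁ equal) (xor-cancel reindex) ⟩
  ⨁ equal  ≡⟨ ⨁-rows equal row ⟩
  sum (λ a → a <ᵇ t a)  ∎
  where
  open ≡.≡-Reasoning
  t = τ ⟨$⟩ʳ_
  F less greater equal : Fin n → Fin n → Bool
  F a b = (a <ᵇ b) ∧ (t b <ᵇ t a)
  less a b = (a <ᵇ t b) ∧ F a b
  greater a b = (t b <ᵇ a) ∧ F a b
  equal a b = does (a ≟ᶠ t b) ∧ F a b

  split : ∀ a b → F a b ≡ (less a b xor greater a b) xor equal a b
  split a b with <-cmp a (t b)
  ... | tri< p q r rewrite dec-true (a <? t b) p | dec-false (a ≟ᶠ t b) q | dec-false (t b <? a) r
                         | xor-identityʳ (F a b) = ≡.sym (xor-identityʳ _)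
  ... | tri≈ p q r rewrite dec-false (a <? t b) p | dec-true (a ≟ᶠ t b) q | dec-false (t b <? a) r = refl
  ... | tri> p q r rewrite dec-false (a <? t b) p | dec-false (a ≟ᶠ t b) q | dec-true (t b <? a) r =
      ≡.sym (xor-identityʳ _)

  reindex : ⨁ less ≡ ⨁ greater
  reindex = ≡.trans (⨁-permute less τ) (≡.trans (⨁-swap _) (⨁-cong λ a b → begin
    (t b <ᵇ t (t a)) ∧ ((t b <ᵇ t a) ∧ (t (t a) <ᵇ t (t b)))
      ≡⟨ cong₂ (λ x y → (t b <ᵇ x) ∧ ((t b <ᵇ t a) ∧ (x <ᵇ y))) (invol a) (invol b) ⟩
    (t b <ᵇ a) ∧ ((t b <ᵇ t a) ∧ (a <ᵇ b))
      ≡⟨ cong ((t b <ᵇ a) ∧_) (∧-comm (t b <ᵇ t a) (a <ᵇ b)) ⟩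
    greater a b  ∎))

  row : ∀ a → sum (equal a) ≡ a <ᵇ t a
  row a = ≡.trans (sum-one (equal a) (t a) off) on
    where
    off : ∀ b → ¬ b ≡ t a → equal a b ≡ false
    off b b≢ rewrite dec-false (a ≟ᶠ t b) (λ a≡ → b≢ (≡.trans (≡.sym (invol b)) (cong t (≡.sym a≡)))) = refl
    on : equal a (t a) ≡ a <ᵇ t a
    on rewrite invol a | dec-true (a ≟ᶠ a) refl with a <ᵇ t a
    ... | true  = refl
    ... | false = refl

involution : (t : Fin n → Fin n) → (∀ i → t (t i) ≡ i) → Permutation′ n
involution t p = permutation t t p p

module _ (i j : Fin n) where

  transpose-≡ˡ : transpose i j ⟨$⟩ʳ i ≡ j
  transpose-≡ˡ rewrite dec-true (i ≟ᶠ i) refl = refl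

  transpose-≡ʳ : transpose i j ⟨$⟩ʳ j ≡ i
  transpose-≡ʳ with j ≟ᶠ i
  ... | yes refl = refl
  ... | no _ rewrite dec-true (j ≟ᶠ j) refl = refl

  transpose-≢ : ∀ {k} → ¬ k ≡ i → ¬ k ≡ j → transpose i j ⟨$⟩ʳ k ≡ k
  transpose-≢ {k} k≢i k≢j rewrite dec-false (k ≟ᶠ i) k≢i | dec-false (k ≟ᶠ j) k≢j = refl

  transpose-involutive : ∀ k → transpose i j ⟨$⟩ʳ (transpose i j ⟨$⟩ʳ k) ≡ k
  transpose-involutive k = by-cases (k ≟ᶠ i) (k ≟ᶠ j)
    where
    by-cases : Dec (k ≡ i) → Dec (k ≡ j) → transpose i j ⟨$⟩ʳ (transpose i j ⟨$⟩ʳ k) ≡ k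
    by-cases (yes refl) _          = ≡.trans (cong (transpose i j ⟨$⟩ʳ_) transpose-≡ˡ) transpose-≡ʳ
    by-cases (no _)     (yes refl) = ≡.trans (cong (transpose i j ⟨$⟩ʳ_) transpose-≡ʳ) transpose-≡ˡ
    by-cases (no p)     (no q)     = ≡.trans (cong (transpose i j ⟨$⟩ʳ_) (transpose-≢ p q)) (transpose-≢ p q)

  transpose-ˡ : ∀ k → transpose i j ⟨$⟩ˡ k ≡ transpose i j ⟨$⟩ʳ k
  transpose-ˡ k = ≡.trans (cong (transpose i j ⟨$⟩ˡ_) (≡.sym (transpose-involutive k)))
      (inverseˡ (transpose i j))

  -- In the count of `odd-involution`, fixed points contribute nothing, and of `i` and `j` exactly
  -- one is smaller than its image.
  odd-transpose : ¬ i ≡ j → odd (transpose i j) ≡ true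
  odd-transpose i≢j = begin
    odd (transpose i j)
      ≡⟨ odd-involution (transpose i j) transpose-involutive ⟩
    sum (λ a → a <ᵇ (transpose i j ⟨$⟩ʳ a))
      ≡⟨ sum-two (λ a → a <ᵇ (transpose i j ⟨$⟩ʳ a)) i j i≢j
           (λ k p q → ≡.trans (cong (k <ᵇ_) (transpose-≢ p q)) (Strict.irrefl <ᵇ-strict k)) ⟩
    (i <ᵇ (transpose i j ⟨$⟩ʳ i)) xor (j <ᵇ (transpose i j ⟨$⟩ʳ j))
      ≡⟨ cong₂ (λ a b → (i <ᵇ a) xor (j <ᵇ b)) transpose-≡ˡ transpose-≡ʳ ⟩
    (i <ᵇ j) xor (j <ᵇ i)
      ≡⟨ cong ((i <ᵇ j) xor_) (Strict.connex <ᵇ-strict i≢j) ⟩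
    (i <ᵇ j) xor not (i <ᵇ j)
      ≡⟨ xor-not (i <ᵇ j) ⟩
    true ∎
    where
    open ≡.≡-Reasoning
    xor-not : ∀ a → a xor not a ≡ true
    xor-not true  = refl
    xor-not false = refl

-- Modulo 2 the two points of an orbit of `t` cancel, and only fixed points could remain. The
-- natural order selects one point of each two-element orbit.
sum-invariant : ∀ (t : Fin n → Fin n) → (∀ i → t (t i) ≡ i) → (f : Fin n → Bool) →
                (∀ i → f (t i) ≡ f i) → (∀ i → t i ≡ i → f i ≡ false) → sum f ≡ false
sum-invariant {n} t invol f f-inv f-fix = begin
  sum f  ≡⟨ sum-cong-≗ {n} {f} {λ i → less i xor greater i} split ⟩
  sum (λ i → less i xor greater i)  ≡⟨ ∑-distrib-+ less greater ⟩
  sum less xor sum greater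
    ≡⟨ xor-cancel (≡.trans (sum-permute less (involution t invol))
                                                        (sum-cong-≗ {n} {λ i → less (t i)} {greater} λ i →
                                                          cong₂ _∧_ (cong (t i <ᵇ_) (invol i)) (f-inv i))) ⟩
  false  ∎
  where
  open ≡.≡-Reasoning
  less greater : Fin n → Bool
  less i = (i <ᵇ t i) ∧ f i
  greater i = (t i <ᵇ i) ∧ f i

  split : ∀ i → f i ≡ less i xor greater i
  split i with t i ≟ᶠ i
  ... | yes p rewrite f-fix i p | ∧-zeroʳ (i <ᵇ t i) | ∧-zeroʳ (t i <ᵇ i) = refl
  ... | no  p rewrite Strict.connex <ᵇ-strict p with t i <ᵇ i
  ...   | true  = refl
  ...   | false = ≡.sym (xor-identityʳ _)

parity : List Bool → Bool
parity = foldr _xor_ false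

parity-++ : ∀ xs ys → parity (xs ++ ys) ≡ parity xs xor parity ys
parity-++ []       ys = refl
parity-++ (x ∷ xs) ys = ≡.trans (cong (x xor_) (parity-++ xs ys)) (≡.sym (xor-assoc x _ _))

parity-tabulate : ∀ {n} (f : Fin n → Bool) → parity (List.tabulate f) ≡ sum f
parity-tabulate {zero}  f = refl
parity-tabulate {suc n} f = cong (f zero xor_) (parity-tabulate (f ∘ suc))

-- Connects `sgn`, defined by the length of a filtered list of pairs, with the double sum `⨁`.
parity-allFin² : ∀ (F : Fin n → Fin n → Bool) →
  parity (map (λ (i , j) → F i j) (cartesianProduct (allFin n) (allFin n))) ≡ ⨁ F
parity-allFin² {n} F = begin
  parity (map (λ (i , j) → F i j) (cartesianProduct (allFin n) (allFin n))) ≡⟨ go (allFin n) ⟩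
  parity (map (λ i → sum (F i)) (allFin n)) ≡⟨ cong parity (map-tabulate (λ i → i) (λ i → sum (F i))) ⟩
  parity (List.tabulate (λ i → sum (F i)))  ≡⟨ parity-tabulate (λ i → sum (F i)) ⟩
  sum (λ i → sum (F i))  ≡⟨ ⨁-rows F (λ i → refl) ⟨
  ⨁ F  ∎
  where
  open ≡.≡-Reasoning
  go : ∀ is → parity (map (λ (i , j) → F i j) (cartesianProduct is (allFin n))) ≡ parity
      (map (λ i → sum (F i)) is)
  go []       = refl
  go (i ∷ is) = begin
    parity (map (λ (i , j) → F i j) (map (i ,_) (allFin n) ++ cartesianProduct is (allFin n)))
      ≡⟨ cong parity (map-++ _ (map (i ,_) (allFin n)) _) ⟩
    parity (map (λ (i , j) → F i j) (map (i ,_) (allFin n)) ++ map (λ (i , j) → F i j)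
        (cartesianProduct is (allFin n)))
      ≡⟨ parity-++ (map (λ (i , j) → F i j) (map (i ,_) (allFin n))) _ ⟩
    parity (map (λ (i , j) → F i j) (map (i ,_) (allFin n))) xor parity
        (map (λ (i , j) → F i j) (cartesianProduct is (allFin n)))
      ≡⟨ cong₂ _xor_ (≡.trans (cong parity (≡.trans (≡.sym (map-∘ (allFin n)))
          (map-tabulate (λ j → j) (F i)))) (parity-tabulate (F i))) (go is) ⟩
    sum (F i) xor parity (map (λ i → sum (F i)) is) ∎

lt : Face n → Fin n → Fin n → Bool
lt f i j = not (lef f j i)

chamber-strict : ∀ {f : Face n} → IsChamber f → Strict (lt f)
chamber-strict {f = f} ch = record
  { irrefl = λ i → cong not (lef-refl f i)
  ; connex = λ {i} {j} i≢j → cong not (by-cases i≢j _ refl)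
  }
  where
  by-cases : ∀ {i j} → ¬ i ≡ j → ∀ b → lef f j i ≡ b → lef f i j ≡ not (lef f j i)
  by-cases i≢j true  p = ≡.trans (≢true⇒false λ q → i≢j (ch (same-intro f q p))) (cong not (≡.sym p))
  by-cases i≢j false p = ≡.trans (lef-total f p) (cong not (≡.sym p))

lt-c₀ : ∀ (i j : Fin (suc m)) → lt c₀ i j ≡ (i <ᵇ j)
lt-c₀ i j = by-cases (i <? j)
  where
  by-cases : Dec (toℕ i ℕ.< toℕ j) → lt c₀ i j ≡ (i <ᵇ j)
  by-cases (yes i<j) = ≡.trans (cong not (c₀-> i<j)) (≡.sym (dec-true (i <? j) i<j))
  by-cases (no  i≮j) = ≡.trans (cong not (c₀-≤ (ℕ.≮⇒≥ i≮j))) (≡.sym (dec-false (i <? j) i≮j))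

-- Set partitions of type (2, ..., 2[, 1])

-- Y has blocks of size two, t swapping the elements of each, and at most one singleton.
record Pairing (Y : Face n) : Set where
  field
    t        : Fin n → Fin n
    t-same   : ∀ i → samef Y i (t i) ≡ true
    t-unique : ∀ {i j} → samef Y i j ≡ true → j ≡ i ⊎ j ≡ t i
    t-fixed  : ∀ {i j} → t i ≡ i → t j ≡ j → i ≡ j

  t-involutive : ∀ i → t (t i) ≡ i
  t-involutive i with t-unique (same-sym Y (t-same i))
  ... | inj₁ i≡ti  = ≡.trans (cong t (≡.sym i≡ti)) (≡.sym i≡ti)
  ... | inj₂ i≡tti = ≡.sym i≡tti

  t-≢ : ∀ {i j} → samef Y i j ≡ true → ¬ j ≡ i → j ≡ t i
  t-≢ s j≢i with t-unique s
  ... | inj₁ j≡i  = contradiction j≡i j≢i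
  ... | inj₂ j≡ti = j≡ti

module _ (n : ℕ) where
  private
    sizes : List ℕ
    sizes = replicate (n / 2) 2 ++ replicate (n % 2) 1

    sizes-1-2 : All (λ k → k ≡ 1 ⊎ k ≡ 2) sizes
    sizes-1-2 = All.++⁺ (All.replicate⁺ (n / 2) (inj₂ refl)) (All.replicate⁺ (n % 2) (inj₁ refl))

    -- That at most one part is 1 is put as a symmetric condition on pairs, since such a condition
    -- passes along the permutation from the sorted sizes to the list of blocks.
    NotBoth1 : ℕ → ℕ → Set
    NotBoth1 a b = ¬ (a ≡ 1 × b ≡ 1)

    sizes-one-1 : AllPairs NotBoth1 sizes
    sizes-one-1 = twos (n / 2) (ones (n % 2) (m%n<n n 2))
      where
      ones : ∀ r → r < 2 → AllPairs NotBoth1 (replicate r 1)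
      ones zero          _ = []
      ones (suc zero)    _ = [] ∷ []
      ones (suc (suc r)) (s≤s (s≤s ()))

      twos : ∀ k {ks} → AllPairs NotBoth1 ks → AllPairs NotBoth1 (replicate k 2 ++ ks)
      twos zero    p = p
      twos (suc k) p = All.universal (λ { _ (() , _) }) _ ∷ twos k p

  module _ (Y : Face n) (Y∈ : Y ∈Λ twosPartition n) where
    private
      perm : sizes ↭ blockSizes Y
      perm = subst (_↭ blockSizes Y) Y∈ (Descending.sort-↭ (blockSizes Y))

      block-1-2 : All (λ P → ∣ P ∣ ≡ 1 ⊎ ∣ P ∣ ≡ 2) (blocks Y)
      block-1-2 = All.map⁻ (All-resp-↭ perm sizes-1-2)

      block-one-1 : AllPairs (λ P Q → NotBoth1 ∣ P ∣ ∣ Q ∣) (blocks Y)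
      block-one-1 = AllPairs.map⁻ (PermutationS.AllPairs-resp-↭ (≡.setoid ℕ)
        (λ p (a , b) → p (b , a)) ((λ { refl p → p }) , (λ { refl p → p })) (↭⇒↭ₛ perm) sizes-one-1)

      block : ∀ i → ∃ λ P → P ∈ˡ blocks Y × i ∈ P
      block i = Membership.find (IsOrderedSetPartition.covers (isOSP Y) i)

      ∈block : ∀ i {j} → samef Y i j ≡ true → j ∈ proj₁ (block i)
      ∈block i {j} s with block i
      ... | P , P∈ , i∈ = true⇒∈ (≡.trans (block-char Y P∈ i∈ j) s)

      at-most-2 : ∀ {i j k} → samef Y i j ≡ true → samef Y i k ≡ true → ¬ j ≡ i → ¬ k ≡ i → k ≡ j
      at-most-2 {i} {j} {k} sj sk j≢i k≢i with k ≟ᶠ j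
      ... | yes k≡j = k≡j
      ... | no  k≢j = contradiction ≤2 (ℕ.<⇒≱ >2)
        where
        P = proj₁ (block i)
        >2 : 2 < ∣ P ∣
        -- Removing `i`, `j` and `k` from `P` in turn lowers the size three times.
        >2 = ℕ.≤-<-trans (ℕ.≤-<-trans (ℕ.≤-<-trans z≤n
          (x∈p⇒∣p-x∣<∣p∣ (x∈p∧x≢y⇒x∈p-y (x∈p∧x≢y⇒x∈p-y (∈block i sk) k≢i) k≢j)))
          (x∈p⇒∣p-x∣<∣p∣ (x∈p∧x≢y⇒x∈p-y (∈block i sj) j≢i)))
          (x∈p⇒∣p-x∣<∣p∣ (∈block i (same-refl Y i)))
        ≤2 : ∣ P ∣ ≤ 2
        ≤2 with All.lookup block-1-2 (proj₁ (proj₂ (block i)))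
        ... | inj₁ eq = ℕ.≤-trans (ℕ.≤-reflexive eq) (s≤s z≤n)
        ... | inj₂ eq = ℕ.≤-reflexive eq

      Partner : Fin n → Set
      Partner i = ∃ λ j → samef Y i j ≡ true × ¬ j ≡ i

      partner? : ∀ i → Dec (Partner i)
      partner? i = any? λ j → (samef Y i j ≟ᵇ true) ×-dec ¬? (j ≟ᶠ i)

      single : ∀ i → ¬ Partner i → ∣ proj₁ (block i) ∣ ≡ 1
      single i ¬p with All.lookup block-1-2 (proj₁ (proj₂ (block i)))
      ... | inj₁ eq = eq
      ... | inj₂ eq = contradiction (subst₂ _≤_ eq (∣⁅x⁆∣≡1 i) (p⊆q⇒∣p∣≤∣q∣ ⊆single)) λ { (s≤s ()) }
        where
        ⊆single : ∀ {j} → j ∈ proj₁ (block i) → j ∈ ⁅ i ⁆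
        ⊆single {j} j∈ with j ≟ᶠ i
        ... | yes refl = x∈⁅x⁆ i
        ... | no  j≢i  = contradiction (j ,
          ≡.trans (≡.sym (block-char Y (proj₁ (proj₂ (block i))) (proj₂ (proj₂ (block i))) j))
              (∈⇒true j∈) , j≢i) ¬p

      one-single : ∀ {Ps : List (Subset n)} → AllPairs (λ P Q → NotBoth1 ∣ P ∣ ∣ Q ∣) Ps →
                   ∀ {P Q} → P ∈ˡ Ps → Q ∈ˡ Ps → ∣ P ∣ ≡ 1 → ∣ Q ∣ ≡ 1 → P ≡ Q
      one-single (_ ∷ _)  (here refl) (here refl) _ _ = refl
      one-single (d ∷ _)  (here refl) (there q)   a b = contradiction (a , b) (All.lookup d q)
      one-single (d ∷ _)  (there p)   (here refl) a b = contradiction (b , a) (All.lookup d p)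
      one-single (_ ∷ ns) (there p)   (there q)   a b = one-single ns p q a b

      -- A point alone in its block is its own partner. This makes `t` total, and the singleton
      -- becomes visible as the fixed point of `t`.
      partner : ∀ {i} → Dec (Partner i) → Fin n
      partner {i} (yes (j , _)) = j
      partner {i} (no _)        = i

    pairing : Pairing Y
    pairing = record
      { t        = λ i → partner (partner? i)
      ; t-same   = λ i → t-same (partner? i)
      ; t-unique = λ {i} s → t-unique (partner? i) s
      ; t-fixed  = λ {i} {j} p q → t-fixed (partner? i) (partner? j) p q
      }
      where
      t-same : ∀ {i} (d : Dec (Partner i)) → samef Y i (partner d) ≡ true
      t-same (yes (j , s , _)) = s
      t-same (no _)            = same-refl Y _

      t-unique : ∀ {i j} (d : Dec (Partner i)) → samef Y i j ≡ true → j ≡ i ⊎ j ≡ partner d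
      t-unique {i} {j} d s with j ≟ᶠ i
      t-unique d s | yes j≡i = inj₁ j≡i
      t-unique (yes (k , s′ , k≢i)) s | no j≢i = inj₂ (at-most-2 s′ s k≢i j≢i)
      t-unique (no ¬p)              s | no j≢i = contradiction (_ , s , j≢i) ¬p

      t-fixed : ∀ {i j} (d : Dec (Partner i)) (e : Dec (Partner j)) → partner d ≡ i → partner e ≡ j → i ≡ j
      t-fixed (yes (_ , _ , k≢i)) _ p _ = contradiction p k≢i
      t-fixed (no _) (yes (_ , _ , k≢j)) _ q = contradiction q k≢j
      -- Points without partner lie in blocks of size 1. There is only one such block, so distinct
      -- `i` and `j` would share it and be partners.
      t-fixed {i} {j} (no ¬p) (no ¬q) _ _ with i ≟ᶠ j
      ... | yes i≡j = i≡j
      ... | no  i≢j = contradiction (j , i~j , λ p → i≢j (≡.sym p)) ¬p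
        where
        Pᵢ = block i
        Pⱼ = block j
        i~j : samef Y i j ≡ true
        i~j = ≡.trans (≡.sym (block-char Y (proj₁ (proj₂ Pᵢ)) (proj₂ (proj₂ Pᵢ)) j)) (∈⇒true
          (subst (j ∈_) (≡.sym (one-single block-one-1 (proj₁ (proj₂ Pᵢ)) (proj₁ (proj₂ Pⱼ)) (single i ¬p)
              (single j ¬q)))
            (proj₂ (proj₂ Pⱼ))))

-- Of two distinct points in a block of `Y`, at least one is not fixed by the pairing of `X`. Its
-- partner in `X` is also in its block of `Y`, hence is the other point. So comparable set
-- partitions of this type are equal.
pairing-⊑ : ∀ {X Y : Face n} → Pairing X → Pairing Y → X ⊑ Y → Y ⊑ X
pairing-⊑ {X = X} {Y} pX pY X⊑Y {i} {j} s with i ≟ᶠ j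
... | yes refl = same-refl X i
... | no  i≢j with PX.t i ≟ᶠ i | PX.t j ≟ᶠ j
  where module PX = Pairing pX ; module PY = Pairing pY
... | no ti≢i | _ = subst (λ k → samef X i k ≡ true)
        (≡.trans (Pairing.t-≢ pY (X⊑Y (Pairing.t-same pX i)) ti≢i)
            (≡.sym (Pairing.t-≢ pY s (λ p → i≢j (≡.sym p)))))
        (Pairing.t-same pX i)
... | yes _ | no tj≢j = same-sym X (subst (λ k → samef X j k ≡ true)
        (≡.trans (Pairing.t-≢ pY (X⊑Y (Pairing.t-same pX j)) tj≢j)
            (≡.sym (Pairing.t-≢ pY (same-sym Y s) i≢j)))
        (Pairing.t-same pX j))
... | yes p | yes q = contradiction (Pairing.t-fixed pX p q) i≢j

-- Inversions against the adapted chamber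

lef-resp : ∀ (f : Face n) {i i′ j j′} → samef f i i′ ≡ true → samef f j j′ ≡ true → lef f i j ≡ lef f i′ j′
lef-resp f s s′ with same-elim f s | same-elim f s′
... | ii′ , i′i | jj′ , j′j = ≡-from-⇔
  (λ p → lef-trans f i′i (lef-trans f p jj′)) (λ p → lef-trans f ii′ (lef-trans f p j′j))

transpose-same : ∀ {f : Face n} {i j} → samef f i j ≡ true → transpose i j ◃ f ≡ f
transpose-same {f = f} {i} {j} s = face-ext λ a b →
  ≡.trans (lef-◃ (transpose i j) f a b) (lef-resp f (fixes a) (fixes b))
  where
  fixes : ∀ a → samef f (transpose i j ⟨$⟩ˡ a) a ≡ true
  fixes a = subst (λ b → samef f b a ≡ true) (≡.sym (transpose-ˡ i j a)) (go (a ≟ᶠ i) (a ≟ᶠ j))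
    where
    go : Dec (a ≡ i) → Dec (a ≡ j) → samef f (transpose i j ⟨$⟩ʳ a) a ≡ true
    go (yes refl) _ = subst (λ b → samef f b i ≡ true) (≡.sym (transpose-≡ˡ i j)) (same-sym f s)
    go (no _) (yes refl) = subst (λ b → samef f b j ≡ true) (≡.sym (transpose-≡ʳ i j)) s
    go (no q) (no r) = subst (λ b → samef f b a ≡ true) (≡.sym (transpose-≢ i j q r)) (same-refl f a)

module _ {m : ℕ} (Y : Face (suc m)) (p : Pairing Y) where
  open Pairing p
  open RawMonoid (faceMonoid m) using (_∙_)

  -- In this chamber the two elements of each block of Y are adjacent.
  adapted : Face (suc m)
  adapted = Y ∙ c₀

  private
    z = adapted

  adapted-chamber : IsChamber adapted
  adapted-chamber = ∙-chamber Y c₀ c₀-chamber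

  private
    lt-adapted : ∀ {a b} → samef Y a b ≡ false → lt z a b ≡ lt Y a b
    lt-adapted {a} {b} ns = cong not (go _ refl _ refl)
      where
      go : ∀ x → lef Y b a ≡ x → ∀ y → lef Y a b ≡ y → lef z b a ≡ lef Y b a
      go false e _     _ = ≡.trans (∙-le-gt Y c₀ e) (≡.sym e)
      go true  e false q = ≡.trans (∙-le-lt Y c₀ q) (≡.sym e)
      go true  e true  q = contradiction (same-intro Y q e) (false≢true ns)

    -- Points of different blocks of `Y` are ordered by `Y` alone; the factor `c₀` acts only inside
    -- the blocks.
    lt-adapted-resp : ∀ {a a′ b b′} → samef Y a a′ ≡ true → samef Y b b′ ≡ true → samef Y a b ≡ false →
                      lt z a′ b′ ≡ lt z a b
    lt-adapted-resp {a} {a′} {b} {b′} sa sb ns = begin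
      lt z a′ b′  ≡⟨ lt-adapted ns′ ⟩
      lt Y a′ b′  ≡⟨ cong not (lef-resp Y sb sa) ⟨
      lt Y a b  ≡⟨ lt-adapted ns ⟨
      lt z a b  ∎
      where
      open ≡.≡-Reasoning
      ns′ : samef Y a′ b′ ≡ false
      ns′ = ≢true⇒false λ s → false≢true ns (same-trans Y sa (same-trans Y s (same-sym Y sb)))

    z-strict : Strict (lt z)
    z-strict = chamber-strict {f = z} adapted-chamber

  module _ (f : Face (suc m)) where

    -- `D a b` depends only on the blocks of `a` and `b` in `Y`. Rows `a` and `t a` cancel; in the
    -- row of a fixed point `a`, columns `b` and `t b` cancel. At most the entry at `(a , a)`
    -- remains, and it is false.
    inv-adapted-⊑ : Y ⊑ f → inv (lt z) (lt f) ≡ false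
    inv-adapted-⊑ Y⊑f = ≡.trans (⨁-rows D {λ a → sum (D a)} (λ _ → refl))
      (sum-invariant t t-involutive (λ a → sum (D a)) (λ a →
          sum-cong (λ b → D-inv (t-same a) (same-refl Y b)))
        λ a ta≡a → sum-invariant t t-involutive (D a) (λ b → D-inv (same-refl Y a) (t-same b))
          λ b tb≡b → subst (λ b → D a b ≡ false) (t-fixed ta≡a tb≡b)
              (cong (_∧ lt f a a) (Strict.irrefl z-strict a)))
      where
      D : Fin (suc m) → Fin (suc m) → Bool
      D a b = lt z a b ∧ lt f b a

      sum-cong : ∀ {F G : Fin (suc m) → Bool} → (∀ i → F i ≡ G i) → sum F ≡ sum G
      sum-cong {F} {G} = sum-cong-≗ {suc m} {F} {G}

      D-same : ∀ {a b} → samef Y a b ≡ true → D a b ≡ false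
      D-same {a} {b} s rewrite proj₁ (same-elim f (Y⊑f s)) = ∧-zeroʳ (lt z a b)

      D-inv : ∀ {a a′ b b′} → samef Y a a′ ≡ true → samef Y b b′ ≡ true → D a′ b′ ≡ D a b
      D-inv {a} {a′} {b} {b′} sa sb = go _ refl
        where
        go : ∀ x → samef Y a b ≡ x → D a′ b′ ≡ D a b
        go true  s  = ≡.trans (D-same (same-trans Y (same-sym Y sa) (same-trans Y s sb))) (≡.sym (D-same s))
        go false ns = cong₂ _∧_ (lt-adapted-resp sa sb ns) (≡.sym (cong not (lef-resp f (Y⊑f sa) (Y⊑f sb))))

    -- After reindexing by the transposition, the two counts differ only in the order `z` against
    -- its translate. As `i` and `t i` are adjacent in `z`, these orders disagree on this pair
    -- alone; `f` separates it, so the parity changes by one.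
    inv-adapted-swap : ∀ {i} → samef f i (t i) ≡ false →
                       inv (lt z) (lt (transpose i (t i) ◃ f)) ≡ not (inv (lt z) (lt f))
    inv-adapted-swap {i} ns = from-xor (begin
      inv (lt z) (lt (transpose i j ◃ f)) xor inv (lt z) (lt f)
        ≡⟨ cong (_xor inv (lt z) (lt f)) (≡.trans (⨁-permute _ (transpose i j)) (⨁-cong λ a b →
            cong (lt z (τ a) (τ b) ∧_)
             (cong not (≡.trans (lef-◃ (transpose i j) f (τ a) (τ b)) (cong₂ (lef f) (τˡτ a) (τˡτ b)))))) ⟩
      ⨁ (λ a b → lt z (τ a) (τ b) ∧ lt f b a) xor ⨁ (λ a b → lt z a b ∧ lt f b a)
        ≡⟨ ⨁-xor _ _ ⟨
      ⨁ (λ a b → (lt z (τ a) (τ b) ∧ lt f b a) xor (lt z a b ∧ lt f b a))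
        ≡⟨ ⨁-cong (λ a b → ∧-distribʳ-xor (lt f b a) (lt z (τ a) (τ b)) (lt z a b)) ⟨
      ⨁ F
        ≡⟨ ⨁-rows F {λ a → sum (F a)} (λ _ → refl) ⟩
      sum (λ a → sum (F a))
        ≡⟨ sum-two (λ a → sum (F a)) i j i≢j (λ a a≢i a≢j → sum-false {f = F a} λ b →
             F-off (λ (p , _) → a≢i p) (λ (p , _) → a≢j p)) ⟩
      sum (F i) xor sum (F j)
        ≡⟨ cong₂ _xor_ (sum-one (F i) j (λ b b≢j → F-off (λ (_ , p) → b≢j p) (λ (p , _) → i≢j p)))
                       (sum-one (F j) i (λ b b≢i → F-off (λ (p , _) → i≢j (≡.sym p)) (λ (_ , p) → b≢i p))) ⟩
      F i j xor F j i
        ≡⟨ cong₂ _xor_ (F-on i j (transpose-≡ˡ i j) (transpose-≡ʳ i j) i≢j)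
                       (F-on j i (transpose-≡ʳ i j) (transpose-≡ˡ i j) (λ p → i≢j (≡.sym p))) ⟩
      lt f j i xor lt f i j
        ≡⟨ separated _ refl _ refl ⟩
      true ∎)
      where
      open ≡.≡-Reasoning
      j = t i
      τ = transpose i j ⟨$⟩ʳ_
      i≢j : ¬ i ≡ j
      i≢j p = false≢true ns (subst (λ k → samef f i k ≡ true) p (same-refl f i))

      from-xor : ∀ {a b} → a xor b ≡ true → a ≡ not b
      from-xor {true}  {false} _ = refl
      from-xor {false} {true}  _ = refl

      τˡτ : ∀ a → transpose i j ⟨$⟩ˡ τ a ≡ a
      τˡτ a = ≡.trans (transpose-ˡ i j (τ a)) (transpose-involutive i j a)

      F : Fin (suc m) → Fin (suc m) → Bool
      F a b = (lt z (τ a) (τ b) xor lt z a b) ∧ lt f b a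

      τ-same : ∀ a → samef Y a (τ a) ≡ true
      τ-same a = go (a ≟ᶠ i) (a ≟ᶠ j)
        where
        go : Dec (a ≡ i) → Dec (a ≡ j) → samef Y a (τ a) ≡ true
        go (yes refl) _ = subst (λ b → samef Y i b ≡ true) (≡.sym (transpose-≡ˡ i j)) (t-same i)
        go (no _) (yes refl) = subst (λ b → samef Y j b ≡ true) (≡.sym (transpose-≡ʳ i j))
            (same-sym Y (t-same i))
        go (no p) (no q) = subst (λ b → samef Y a b ≡ true) (≡.sym (transpose-≢ i j p q)) (same-refl Y a)

      F-off : ∀ {a b} → ¬ (a ≡ i × b ≡ j) → ¬ (a ≡ j × b ≡ i) → F a b ≡ false
      F-off {a} {b} ¬ij ¬ji = cong (_∧ lt f b a) (xor-cancel (go _ refl))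
        where
        off : a ≡ b ⊎ b ≡ t a → lt z (τ a) (τ b) ≡ lt z a b
        off (inj₁ refl) = ≡.trans (Strict.irrefl z-strict (τ a)) (≡.sym (Strict.irrefl z-strict a))
        off (inj₂ b≡ta) = cong₂ (lt z) (transpose-≢ i j a≢i a≢j) (transpose-≢ i j b≢i b≢j)
          where
          a≢i : ¬ a ≡ i
          a≢i refl = ¬ij (refl , b≡ta)
          a≢j : ¬ a ≡ j
          a≢j refl = ¬ji (refl , ≡.trans b≡ta (t-involutive i))
          b≢i : ¬ b ≡ i
          b≢i refl = a≢j (≡.trans (≡.sym (t-involutive a)) (cong t (≡.sym b≡ta)))
          b≢j : ¬ b ≡ j
          b≢j refl = a≢i (≡.trans (≡.sym (t-involutive a)) (≡.trans (cong t (≡.sym b≡ta)) (t-involutive i)))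

        go : ∀ x → samef Y a b ≡ x → lt z (τ a) (τ b) ≡ lt z a b
        go false ns = lt-adapted-resp (τ-same a) (τ-same b) ns
        go true  s with t-unique s
        ... | inj₁ b≡a  = off (inj₁ (≡.sym b≡a))
        ... | inj₂ b≡ta = off (inj₂ b≡ta)

      F-on : ∀ a b → τ a ≡ b → τ b ≡ a → ¬ a ≡ b → F a b ≡ lt f b a
      F-on a b p q a≢b rewrite p | q | Strict.connex z-strict a≢b with lt z a b
      ... | true  = refl
      ... | false = refl

      separated : ∀ x → lef f i j ≡ x → ∀ y → lef f j i ≡ y → lt f j i xor lt f i j ≡ true
      separated true  p true  q = contradiction (same-intro f p q) (false≢true ns)
      separated true  p false q rewrite p | q = refl
      separated false p true  q rewrite p | q = refl
      separated false p false q = contradiction (lef-total f p) (false≢true q)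

-- Descents and the products of faces with `c₀`

chamber? : ∀ {n} (f : Face n) → Dec (IsChamber f)
chamber? f with all? (λ i → all? (λ j → (samef f i j ≟ᵇ true) →-dec (i ≟ᶠ j)))
... | yes p = yes (λ {i} {j} → p i j)
... | no ¬p = no (λ ch → ¬p (λ i j → ch))

module _ {m : ℕ} where
  open RawMonoid (faceMonoid m) using (_∙_)
  open ≡.≡-Reasoning

  module _ (w : Permutation′ (suc m)) where

    Des⇒ : ∀ {i} → i ∈ Des w → toℕ (w ⟨$⟩ʳ suc i) < toℕ (w ⟨$⟩ʳ inject₁ i)
    Des⇒ {i} i∈ = by-cases (toℕ (w ⟨$⟩ʳ suc i) ℕ.<? toℕ (w ⟨$⟩ʳ inject₁ i))
      where
      by-cases : Dec (toℕ (w ⟨$⟩ʳ suc i) < toℕ (w ⟨$⟩ʳ inject₁ i)) →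
          toℕ (w ⟨$⟩ʳ suc i) < toℕ (w ⟨$⟩ʳ inject₁ i)
      by-cases (yes p) = p
      by-cases (no ¬p) = contradiction (≡.trans
          (≡.sym (lookup∘tabulate (λ i → does ((w ⟨$⟩ʳ suc i) <? (w ⟨$⟩ʳ inject₁ i))) i)) (∈⇒true i∈))
        (false≢true (dec-false ((w ⟨$⟩ʳ suc i) <? (w ⟨$⟩ʳ inject₁ i)) ¬p))

    ⇒Des : ∀ {i} → toℕ (w ⟨$⟩ʳ suc i) < toℕ (w ⟨$⟩ʳ inject₁ i) → i ∈ Des w
    ⇒Des {i} p = true⇒∈ (≡.trans (lookup∘tabulate (λ i → does ((w ⟨$⟩ʳ suc i) <? (w ⟨$⟩ʳ inject₁ i))) i)
      (dec-true ((w ⟨$⟩ʳ suc i) <? (w ⟨$⟩ʳ inject₁ i)) p))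

    module _ (f : Face (suc m)) (fc₀ : f ∙ c₀ ≡ w ◃ c₀) where
      private
        g = flip w ◃ f

        gw⁻¹c₀ : g ∙ (flip w ◃ c₀) ≡ c₀
        gw⁻¹c₀ = ≡.trans (≡.sym (◃-∙ (flip w) f c₀)) (≡.trans (cong (flip w ◃_) fc₀) (◃-inverseˡ w c₀))

        step : ∀ i → lef (g ∙ (flip w ◃ c₀)) (inject₁ i) (suc i) ≡ true
        step i = ≡.trans (cong (λ h → lef h (inject₁ i) (suc i)) gw⁻¹c₀) (stdFace-monotone ⊤ i)

        g-monotone : Monotone g
        g-monotone i = ∙-le⁻ˡ g (flip w ◃ c₀) (step i)

      -- Translating by `w⁻¹` gives `g ∙ (w⁻¹ c₀) ≡ c₀`, so `g` is monotone and hence standard. At a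
      -- descent of `w` the factor `w⁻¹ c₀` has the neighbours in the wrong order, so `g` has to
      -- separate them.
      straightened : ∃ λ J → f ≡ w ◃ stdFace J × Des w ⊆ˢ J
      straightened = ascents g
        , ≡.trans (≡.sym (◃-inverseʳ w f)) (cong (λ f → w ◃ f) (monotone⇒stdFace {f = g} g-monotone))
        , λ {i} i∈ → true⇒∈ (≡.trans (lookup∘tabulate (λ i → not (lef g (suc i) (inject₁ i))) i)
            (cong not (≢true⇒false λ p →
            ℕ.<⇒≱ (Des⇒ i∈) (c₀-≤⁻ {i = w ⟨$⟩ʳ inject₁ i} {w ⟨$⟩ʳ suc i}
                (≡.trans (≡.sym (lef-◃ (flip w) c₀ (inject₁ i) (suc i)))
              (∙-le⁻ʳ g (flip w ◃ c₀) (step i) p))))))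

      of-type⇒ : ∀ {J} → blockSizes f ≡ composition J → f ≡ w ◃ stdFace J × Des w ⊆ˢ J
      of-type⇒ {J} type = subst (λ J → f ≡ w ◃ stdFace J × Des w ⊆ˢ J) J′≡J (proj₂ straightened)
        where
        J′ = proj₁ straightened
        f≡ = proj₁ (proj₂ straightened)
        J′≡J : J′ ≡ J
        J′≡J = composition-injective J′ J (begin
          composition J′  ≡⟨ blockSizes-stdFace J′ ⟨
          blockSizes (stdFace J′)  ≡⟨ blockSizes-◃ w (stdFace J′) ⟨
          blockSizes (w ◃ stdFace J′) ≡⟨ cong blockSizes f≡ ⟨
          blockSizes f  ≡⟨ type ⟩
          composition J  ∎)

    -- After translation by `w⁻¹`, neighbours cut by `J` are already in order. Those left tied are
    -- not descents of `w`, so `w⁻¹ c₀` breaks the tie in the natural order.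
    of-type⇐ : ∀ {J} → Des w ⊆ˢ J → (w ◃ stdFace J) ∙ c₀ ≡ w ◃ c₀
    of-type⇐ {J} Des⊆ = begin
      (w ◃ stdFace J) ∙ c₀  ≡⟨ cong ((w ◃ stdFace J) ∙_) (◃-inverseʳ w c₀) ⟨
      (w ◃ stdFace J) ∙ (w ◃ (flip w ◃ c₀))  ≡⟨ ◃-∙ w (stdFace J) (flip w ◃ c₀) ⟨
      w ◃ (stdFace J ∙ (flip w ◃ c₀))  ≡⟨ cong (w ◃_) product≡c₀ ⟩
      w ◃ c₀  ∎
      where
      f = stdFace J
      g = flip w ◃ c₀

      ascending : ∀ {i} → lef f (suc i) (inject₁ i) ≡ true → toℕ (w ⟨$⟩ʳ inject₁ i) ≤ toℕ (w ⟨$⟩ʳ suc i)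
      ascending {i} p = ℕ.≮⇒≥ λ q → false≢true
        (not-injective {y = false} (≡.trans (≡.sym (stdFace-step J i)) p)) (∈⇒true (Des⊆ (⇒Des q)))

      mono : ∀ i b → lef f (suc i) (inject₁ i) ≡ b → lef (f ∙ g) (inject₁ i) (suc i) ≡ true
      mono i false p = ∙-le-lt f g p
      mono i true  p = ≡.trans (∙-le-same f g (same-intro f (stdFace-monotone J i) p))
        (≡.trans (lef-◃ (flip w) c₀ (inject₁ i) (suc i)) (c₀-≤ (ascending p)))

      strict : ∀ i b → lef f (suc i) (inject₁ i) ≡ b → lef (f ∙ g) (suc i) (inject₁ i) ≡ false
      strict i false p = ∙-le-gt f g p
      strict i true  p = ≡.trans (∙-le-same f g (same-intro f p (stdFace-monotone J i)))
        (≡.trans (lef-◃ (flip w) c₀ (suc i) (inject₁ i)) (c₀-> (ℕ.≤∧≢⇒< (ascending p)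
          λ q → ℕ.1+n≢n (≡.trans (≡.sym (cong toℕ (⟨$⟩ʳ-injective w (toℕ-injective q)))) (toℕ-inject₁ i)))))

      product≡c₀ : f ∙ g ≡ c₀
      product≡c₀ = monotone-ext (λ i → mono i _ refl) (stdFace-monotone ⊤)
        (λ i → ≡.trans (strict i _ refl) (≡.sym (c₀-step i)))

  -- The chamber `f ∙ c₀` supplies the permutation that straightens `f`. Statements about invariant
  -- elements are thereby reduced to standard faces.
  orbit : ∀ (f : Face (suc m)) → ∃₂ λ w J → f ≡ w ◃ stdFace J
  orbit f =
    let w , eq = chamber⇒perm (f ∙ c₀) (∙-chamber f c₀ c₀-chamber)
        J , f≡ , _ = straightened w f eq
    in w , J , f≡

  orbit-elim : ∀ {p} (P : Face (suc m) → Set p) → (∀ w J → P (w ◃ stdFace J)) → ∀ f → P f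
  orbit-elim P h f = let w , J , f≡ = orbit f in subst P (≡.sym f≡) (h w J)

-- Bidigare's antiisomorphism

module Bidigare {c ℓ₁ ℓ₂ : Level} (K : HeytingField c ℓ₁ ℓ₂) (m : ℕ) where

  open FaceAlgebra K m

  R : CommutativeRing c ℓ₁
  R = HeytingCommutativeRing.commutativeRing (HeytingField.heytingCommutativeRing K)

  module R = CommutativeRing R
  module F = MonoidAlgebraProperties R (faceMonoid m) faceIsMonoid _≟ᶠᵃᶜᵉ_
  module S = MonoidAlgebraProperties R (permutationMonoid N) (permIsMonoid N) _≟ᵖ_

  open RawMonoid (faceMonoid m) using (_∙_)
  open ListSum R
  open SetoidReasoning R.setoid

  functional : ∀ (φ : Face N → R.Carrier) → F.Functional φ
  functional φ refl = R.refl

  -- Like _≋_, so that the argument can be inferred.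
  record Inv (v : KF.Algebra) : Set ℓ₁ where
    constructor mkInv
    field isInvariant : Invariant v
  open Inv public

  ⟨⟩-• : ∀ φ π u → F.⟨ φ , π • u ⟩ ≡ F.⟨ (λ f → φ (π ◃ f)) , u ⟩
  ⟨⟩-• φ π u = ∑-map _ u _

  invariant-⟨⟩ : ∀ {v} → Inv v → ∀ φ π → F.⟨ (λ f → φ (π ◃ f)) , v ⟩ R.≈ F.⟨ φ , v ⟩
  invariant-⟨⟩ {v} inv φ π = R.trans (R.reflexive (≡.sym (⟨⟩-• φ π v)))
      (F.⟨⟩-cong (functional φ) {π • v} {v} (isInvariant inv π))

  coeff-• : ∀ π u f → KF.coeff (π • u) f R.≈ KF.coeff u (flip π ◃ f)
  coeff-• π u f = begin
    KF.coeff (π • u) f  ≈⟨ F.coeff-δ (π • u) f ⟩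
    F.⟨ F.δ f , π • u ⟩  ≡⟨ ⟨⟩-• (F.δ f) π u ⟩
    F.⟨ (λ g → F.δ f (π ◃ g)) , u ⟩
      ≈⟨ F.⟨⟩-congˡ (λ g → F.δ-⇔ (λ { refl → ◃-inverseˡ π g }) (λ { refl → ≡.sym (◃-inverseʳ π f) })) u ⟩
    F.⟨ F.δ (flip π ◃ f) , u ⟩  ≈⟨ F.coeff-δ u (flip π ◃ f) ⟨
    KF.coeff u (flip π ◃ f)  ∎

  *-invariant : ∀ {u v} → Inv u → Inv v → Inv (u KF.* v)
  *-invariant {u} {v} inv-u inv-v = mkInv λ π → F.⟨⟩-ext {π • (u KF.* v)} {u KF.* v} λ φ _ → begin
    F.⟨ φ , π • (u KF.* v) ⟩  ≡⟨ ⟨⟩-• φ π (u KF.* v) ⟩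
    F.⟨ (λ f → φ (π ◃ f)) , u KF.* v ⟩  ≈⟨ F.⟨⟩-* _ u v ⟩
    F.⟨ (λ f → F.⟨ (λ g → φ (π ◃ (f ∙ g))) , v ⟩) , u ⟩
      ≈⟨ F.⟨⟩-congˡ (λ f → F.⟨⟩-congˡ (λ g → R.reflexive (cong φ (◃-∙ π f g))) v) u ⟩
    F.⟨ (λ f → F.⟨ (λ g → φ ((π ◃ f) ∙ (π ◃ g))) , v ⟩) , u ⟩
      ≈⟨ F.⟨⟩-congˡ (λ f → invariant-⟨⟩ inv-v (λ g → φ ((π ◃ f) ∙ g)) π) u ⟩
    F.⟨ (λ f → F.⟨ (λ g → φ ((π ◃ f) ∙ g)) , v ⟩) , u ⟩
      ≈⟨ invariant-⟨⟩ inv-u (λ f → F.⟨ (λ g → φ (f ∙ g)) , v ⟩) π ⟩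
    F.⟨ (λ f → F.⟨ (λ g → φ (f ∙ g)) , v ⟩) , u ⟩  ≈⟨ F.⟨⟩-* φ u v ⟨
    F.⟨ φ , u KF.* v ⟩  ∎

  ofType : Subset m → Face N → Bool
  ofType J f = does (List-≡-dec ℕ._≟_ (blockSizes f) (composition J))

  facesOfType : Subset m → List (Face N)
  facesOfType J = filter (λ f → List-≡-dec ℕ._≟_ (blockSizes f) (composition J)) (allFaces N)

  ⟨⟩-Φ : ∀ φ d → F.⟨ φ , Φ d ⟩ R.≈ ∑ (allSubsets m) (λ J →
      d J R.* ∑ (allFaces N) (λ f → [ ofType J f ]ᵇ R.* φ f))
  ⟨⟩-Φ φ d = R.trans (F.⟨⟩-lincomb φ (allSubsets m) d (λ J → KF.total (facesOfType J)))
      (∑-cong (allSubsets m) λ J → R.*-congˡ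
    (R.trans (F.⟨⟩-total φ (facesOfType J)) (∑-filter (λ f →
        List-≡-dec ℕ._≟_ (blockSizes f) (composition J)) (allFaces N) φ)))

  ⟨⟩-ι : ∀ φ d → S.⟨ φ , ι d ⟩ R.≈
         ∑ (allSubsets m) (λ J → d J R.* ∑ (allPermutations N) (λ w → [ does (Des w ⊆ˢ? J) ]ᵇ R.* φ w))
  ⟨⟩-ι φ d = R.trans (S.⟨⟩-lincomb φ (allSubsets m) d x) (∑-cong (allSubsets m) λ J → R.*-congˡ
    (R.trans (S.⟨⟩-total φ (filter (λ w → Des w ⊆ˢ? J) (allPermutations N)))
      (∑-filter (λ w → Des w ⊆ˢ? J) (allPermutations N) φ)))

  coeff-Φ : ∀ d f → KF.coeff (Φ d) f R.≈ ∑ (allSubsets m) (λ J → d J R.* [ ofType J f ]ᵇ)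
  coeff-Φ d f = R.trans (F.coeff-δ (Φ d) f) (R.trans (⟨⟩-Φ (F.δ f) d) (∑-cong (allSubsets m) λ J → R.*-congˡ
    (∑-δ (λ g → [ ofType J g ]ᵇ R.* F.δ f g) (λ g → [ ofType J g ]ᵇ) {f} (allFaces-unique N) (∈-allFaces f)
      (λ p q → ≡.trans (≡.sym p) q) (λ p q → ≡.trans (≡.sym q) p)
      (λ { g refl → R.trans (R.*-congˡ (F.δ-≈ refl)) (R.*-identityʳ _) })
      (λ g f≢g → R.trans (R.*-congˡ (F.δ-≉ f≢g)) (R.zeroʳ _)))))

  blockSizes-orbit : ∀ w J → blockSizes (w ◃ stdFace {m} J) ≡ composition J
  blockSizes-orbit w J = ≡.trans (blockSizes-◃ w (stdFace J)) (blockSizes-stdFace J)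

  -- The action preserves block sizes, and `composition` is injective, so the face occurs in the
  -- image of a single `x J`.
  coeff-Φ-orbit : ∀ d w J → KF.coeff (Φ d) (w ◃ stdFace J) R.≈ d J
  coeff-Φ-orbit d w J = R.trans (coeff-Φ d (w ◃ stdFace J))
    (∑-δ (λ J′ → d J′ R.* [ ofType J′ (w ◃ stdFace J) ]ᵇ) d {J} (allSubsets-unique m) (∈-allSubsets J)
      (λ p q → ≡.trans (≡.sym p) q) (λ p q → ≡.trans (≡.sym q) p)
      (λ { _ refl → R.trans (R.*-congˡ (R.reflexive
          (cong [_]ᵇ (dec-true (List-≡-dec ℕ._≟_ _ _) (blockSizes-orbit w J))))) (R.*-identityʳ _) })
      (λ J′ J≢J′ → R.trans (R.*-congˡ (R.reflexive (cong [_]ᵇ (dec-false (List-≡-dec ℕ._≟_ _ _)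
        (λ p → J≢J′ (composition-injective J J′ (≡.trans (≡.sym (blockSizes-orbit w J)) p))))))) (R.zeroʳ _)))

  Φ-invariant : ∀ d → Inv (Φ d)
  Φ-invariant d = mkInv λ π → orbit-elim (λ f → KF.coeff (π • Φ d) f R.≈ KF.coeff (Φ d) f) λ w J → begin
    KF.coeff (π • Φ d) (w ◃ stdFace J)  ≈⟨ coeff-• π (Φ d) (w ◃ stdFace J) ⟩
    KF.coeff (Φ d) (flip π ◃ (w ◃ stdFace J))
      ≡⟨ cong (KF.coeff (Φ d)) (◃-comp (flip π) w (stdFace J)) ⟩
    KF.coeff (Φ d) ((w ∘ₚ flip π) ◃ stdFace J)  ≈⟨ coeff-Φ-orbit d (w ∘ₚ flip π) J ⟩
    d J  ≈⟨ coeff-Φ-orbit d w J ⟨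
    KF.coeff (Φ d) (w ◃ stdFace J)  ∎

  -- The faces `stdFace J` represent the orbits, so their coefficients determine an invariant
  -- element.
  Φ⁻¹ : KF.Algebra → Σₙ
  Φ⁻¹ v J = KF.coeff v (stdFace J)

  Φ-Φ⁻¹ : ∀ {v} → Inv v → Φ (Φ⁻¹ v) F.≋ v
  Φ-Φ⁻¹ {v} inv = F.≈⇒≋ (orbit-elim (λ f → KF.coeff (Φ (Φ⁻¹ v)) f R.≈ KF.coeff v f) λ w J → begin
    KF.coeff (Φ (Φ⁻¹ v)) (w ◃ stdFace J)  ≈⟨ coeff-Φ-orbit (Φ⁻¹ v) w J ⟩
    KF.coeff v (stdFace J)  ≡⟨ cong (KF.coeff v) (◃-inverseˡ w (stdFace J)) ⟨
    KF.coeff v (flip w ◃ (w ◃ stdFace J))  ≈⟨ coeff-• w v (w ◃ stdFace J) ⟨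
    KF.coeff (w • v) (w ◃ stdFace J)  ≈⟨ isInvariant inv w (w ◃ stdFace J) ⟩
    KF.coeff v (w ◃ stdFace J)  ∎)

  -- The identification of ℂSₙ with the span of the chambers.
  θ : KS.Algebra → KF.Algebra
  θ = map (map₂ (_◃ c₀))

  ⟨⟩-θ : ∀ φ a → F.⟨ φ , θ a ⟩ ≡ S.⟨ (λ w → φ (w ◃ c₀)) , a ⟩
  ⟨⟩-θ φ a = ∑-map _ a _

  coeff-θ : ∀ a w → KF.coeff (θ a) (w ◃ c₀) R.≈ KS.coeff a w
  coeff-θ a w = begin
    KF.coeff (θ a) (w ◃ c₀)  ≈⟨ F.coeff-δ (θ a) (w ◃ c₀) ⟩
    F.⟨ F.δ (w ◃ c₀) , θ a ⟩  ≡⟨ ⟨⟩-θ (F.δ (w ◃ c₀)) a ⟩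
    S.⟨ (λ x → F.δ (w ◃ c₀) (x ◃ c₀)) , a ⟩
      ≈⟨ S.⟨⟩-congˡ (λ x → R.trans (F.δ-⇔ {w ◃ c₀} {x ◃ c₀} {x ◃ c₀} {w ◃ c₀} ≡.sym ≡.sym)
                                                  (δ-w x)) a ⟩
    S.⟨ S.δ w , a ⟩  ≈⟨ S.coeff-δ a w ⟨
    KS.coeff a w  ∎
    where
    δ-w : ∀ x → F.δ (x ◃ c₀) (w ◃ c₀) R.≈ S.δ w x
    δ-w x = by-cases (w ≟ᵖ x)
      where
      by-cases : Dec (w Perm.≈ x) → F.δ (x ◃ c₀) (w ◃ c₀) R.≈ S.δ w x
      by-cases (yes p) = R.trans (F.δ-≈ (≡.sym (◃-cong {π = w} {x} p c₀))) (R.sym (S.δ-≈ {w} {x} p))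
      by-cases (no ¬p) = R.trans (F.δ-≉ (λ q → ¬p (w◃c₀-injective {w = w} {x} (≡.sym q))))
          (R.sym (S.δ-≉ {w} {x} ¬p))

  θ-injective : ∀ {a b} → θ a F.≋ θ b → a S.≋ b
  θ-injective {a} {b} p = S.≈⇒≋ λ w → R.trans (R.sym (coeff-θ a w)) (R.trans (F.≋⇒≈ p (w ◃ c₀)) (coeff-θ b w))

  -- For a chamber z = w c₀, both sides are 1 if Des w ⊆ J, and 0 otherwise.
  count : ∀ z J → ∑ (allFaces N) (λ f → [ ofType J f ]ᵇ R.* F.δ z (f ∙ c₀)) R.≈
                  ∑ (allPermutations N) (λ w → [ does (Des w ⊆ˢ? J) ]ᵇ R.* F.δ z (w ◃ c₀))
  count z J = by-chamber (chamber? z)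
    where
    lhs = λ f → [ ofType J f ]ᵇ R.* F.δ z (f ∙ c₀)
    rhs = λ w → [ does (Des w ⊆ˢ? J) ]ᵇ R.* F.δ z (w ◃ c₀)

    all-zero : ∀ {A : Set} (xs : List A) {f : A → R.Carrier} → (∀ x → f x R.≈ R.0#) → ∑ xs f R.≈ R.0#
    all-zero xs p = R.trans (∑-cong xs p) (∑-zero xs)

    both-one : ∀ {x y} → x R.≈ R.1# → y R.≈ R.1# → x R.* y R.≈ R.1#
    both-one p q = R.trans (R.*-cong p q) (R.*-identityˡ _)

    []-true : ∀ {b} → b ≡ true → [ b ]ᵇ R.≈ R.1#
    []-true refl = R.refl
    []-false : ∀ {b} → b ≡ false → [ b ]ᵇ R.≈ R.0#
    []-false refl = R.refl

    type? : ∀ f → Dec (blockSizes f ≡ composition J)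
    type? f = List-≡-dec ℕ._≟_ (blockSizes f) (composition J)

    by-descents : ∀ w₀ → z ≡ w₀ ◃ c₀ → Dec (Des w₀ ⊆ˢ J) → ∑ (allFaces N) lhs R.≈ ∑ (allPermutations N) rhs
    by-descents w₀ z≡ (yes Des⊆) = R.trans
      (∑-δ lhs (λ _ → R.1#) {w₀ ◃ stdFace J} (allFaces-unique N) (∈-allFaces (w₀ ◃ stdFace J))
        (λ p q → ≡.trans (≡.sym p) q) (λ p q → ≡.trans (≡.sym q) p)
        (λ { _ refl → both-one ([]-true (dec-true (type? (w₀ ◃ stdFace J)) (blockSizes-orbit w₀ J)))
                               (F.δ-≈ (≡.trans z≡ (≡.sym (of-type⇐ w₀ Des⊆)))) })
        (λ f f≢ → off f f≢ (type? f)))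
      (R.sym (∑-δ rhs (λ _ → R.1#) {w₀} (allPermutations-unique N) (∈-allPermutations w₀)
        (λ {x} {y} p q i → ≡.trans (≡.sym (p i)) (q i)) (λ {x} {y} p q i → ≡.trans (≡.sym (q i)) (p i))
        (λ w w₀≈w → both-one ([]-true (dec-true (Des w ⊆ˢ? J) (λ {i} i∈ → Des⊆ (⇒Des w₀
                       (subst₂ (λ a b → toℕ a < toℕ b) (≡.sym (w₀≈w (suc i))) (≡.sym (w₀≈w (inject₁ i)))
                           (Des⇒ w i∈))))))
                             (F.δ-≈ (≡.trans z≡ (◃-cong {π = w₀} {w} w₀≈w c₀))))
        (λ w w₀≉w → R.trans (R.*-congˡ (F.δ-≉ (λ p →
            w₀≉w (w◃c₀-injective {w = w₀} {w} (≡.trans (≡.sym z≡) p))))) (R.zeroʳ _))))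
      where
      open ≡ using (subst₂)
      off : ∀ f → ¬ (w₀ ◃ stdFace J ≡ f) → Dec (blockSizes f ≡ composition J) → lhs f R.≈ R.0#
      off f f≢ (yes type) = R.trans (R.*-congˡ
          (F.δ-≉ (λ p → f≢ (≡.sym (proj₁ (of-type⇒ w₀ f (≡.trans (≡.sym p) z≡) type)))))) (R.zeroʳ _)
      off f f≢ (no ¬type) = R.trans (R.*-congʳ ([]-false (dec-false (type? f) ¬type))) (R.zeroˡ _)
    by-descents w₀ z≡ (no Des⊈) = R.trans (all-zero (allFaces N) (λ f → off f (type? f)))
      (R.sym (all-zero (allPermutations N) λ w → off′ w (w₀ ≟ᵖ w)))
      where
      open ≡ using (subst₂)
      off : ∀ f → Dec (blockSizes f ≡ composition J) → lhs f R.≈ R.0#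
      off f (yes type) = R.trans (R.*-congˡ (F.δ-≉ (λ p →
          Des⊈ (proj₂ (of-type⇒ w₀ f (≡.trans (≡.sym p) z≡) type))))) (R.zeroʳ _)
      off f (no ¬type) = R.trans (R.*-congʳ ([]-false (dec-false (type? f) ¬type))) (R.zeroˡ _)
      off′ : ∀ w → Dec (w₀ Perm.≈ w) → rhs w R.≈ R.0#
      off′ w (yes w₀≈w) = R.trans (R.*-congʳ ([]-false
          (dec-false (Des w ⊆ˢ? J) (λ Des⊆ → Des⊈ (λ {i} i∈ → Des⊆ (⇒Des w
                       (subst₂ (λ a b → toℕ a < toℕ b) (w₀≈w (suc i)) (w₀≈w (inject₁ i)) (Des⇒ w₀ i∈))))))))
                           (R.zeroˡ _)
      off′ w (no w₀≉w)  = R.trans (R.*-congˡ (F.δ-≉ (λ p →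
          w₀≉w (w◃c₀-injective {w = w₀} {w} (≡.trans (≡.sym z≡) p))))) (R.zeroʳ _)

    by-chamber : Dec (IsChamber z) → ∑ (allFaces N) lhs R.≈ ∑ (allPermutations N) rhs
    by-chamber (no ¬ch) = R.trans
      (all-zero (allFaces N) λ f → R.trans (R.*-congˡ (F.δ-≉ λ p →
          ¬ch (subst IsChamber (≡.sym p) (∙-chamber f c₀ c₀-chamber)))) (R.zeroʳ _))
      (R.sym (all-zero (allPermutations N) λ w →
          R.trans (R.*-congˡ (F.δ-≉ λ p → ¬ch (subst IsChamber (≡.sym p) (◃-chamber w c₀ c₀-chamber))))
          (R.zeroʳ _)))
    by-chamber (yes ch) = let w₀ , z≡ = chamber⇒perm z ch in by-descents w₀ z≡ (Des w₀ ⊆ˢ? J)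

  Φ-c₀ : ∀ d → Φ d KF.* KF.single c₀ KF.≈ θ (ι d)
  Φ-c₀ d z = begin
    KF.coeff (Φ d KF.* KF.single c₀) z  ≈⟨ F.coeff-δ (Φ d KF.* KF.single c₀) z ⟩
    F.⟨ F.δ z , Φ d KF.* KF.single c₀ ⟩  ≈⟨ F.⟨⟩-* (F.δ z) (Φ d) (KF.single c₀) ⟩
    F.⟨ (λ f → F.⟨ (λ g → F.δ z (f ∙ g)) , KF.single c₀ ⟩) , Φ d ⟩
      ≈⟨ F.⟨⟩-congˡ (λ f → F.⟨⟩-single (λ g → F.δ z (f ∙ g)) c₀) (Φ d) ⟩
    F.⟨ (λ f → F.δ z (f ∙ c₀)) , Φ d ⟩  ≈⟨ ⟨⟩-Φ (λ f → F.δ z (f ∙ c₀)) d ⟩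
    ∑ (allSubsets m) (λ J → d J R.* ∑ (allFaces N) (λ f → [ ofType J f ]ᵇ R.* F.δ z (f ∙ c₀)))
      ≈⟨ ∑-cong (allSubsets m) (λ J → R.*-congˡ (count z J)) ⟩
    ∑ (allSubsets m) (λ J → d J R.* ∑ (allPermutations N) (λ w → [ does (Des w ⊆ˢ? J) ]ᵇ R.* F.δ z (w ◃ c₀)))
      ≈⟨ ⟨⟩-ι (λ w → F.δ z (w ◃ c₀)) d ⟨
    S.⟨ (λ w → F.δ z (w ◃ c₀)) , ι d ⟩  ≡⟨ ⟨⟩-θ (F.δ z) (ι d) ⟨
    F.⟨ F.δ z , θ (ι d) ⟩  ≈⟨ F.coeff-δ (θ (ι d)) z ⟨
    KF.coeff (θ (ι d)) z  ∎

  ⟨⟩-Φ-c₀ : ∀ φ d → F.⟨ (λ f → φ (f ∙ c₀)) , Φ d ⟩ R.≈ S.⟨ (λ w → φ (w ◃ c₀)) , ι d ⟩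
  ⟨⟩-Φ-c₀ φ d = begin
    F.⟨ (λ f → φ (f ∙ c₀)) , Φ d ⟩
      ≈⟨ F.⟨⟩-congˡ (λ f → F.⟨⟩-single (λ g → φ (f ∙ g)) c₀) (Φ d) ⟨
    F.⟨ (λ f → F.⟨ (λ g → φ (f ∙ g)) , KF.single c₀ ⟩) , Φ d ⟩  ≈⟨ F.⟨⟩-* φ (Φ d) (KF.single c₀) ⟨
    F.⟨ φ , Φ d KF.* KF.single c₀ ⟩
      ≈⟨ F.⟨⟩-cong (functional φ) {Φ d KF.* KF.single c₀} {θ (ι d)} (Φ-c₀ d) ⟩
    F.⟨ φ , θ (ι d) ⟩  ≡⟨ ⟨⟩-θ φ (ι d) ⟩
    S.⟨ (λ w → φ (w ◃ c₀)) , ι d ⟩  ∎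

  -- By invariance, the product of `Φ d` with `w ◃ c₀` is the translate by `w` of its product with
  -- `c₀`. The latter is `θ (ι d)`, and translating it by `w` is multiplication by `w` on the left
  -- in the group algebra.
  θ-*ι : ∀ a d → θ (a KS.* ι d) F.≋ Φ d KF.* θ a
  θ-*ι a d = F.≋-ext λ φ _ → begin
    F.⟨ φ , θ (a KS.* ι d) ⟩  ≡⟨ ⟨⟩-θ φ (a KS.* ι d) ⟩
    S.⟨ (λ w → φ (w ◃ c₀)) , a KS.* ι d ⟩  ≈⟨ S.⟨⟩-* (λ w → φ (w ◃ c₀)) a (ι d) ⟩
    S.⟨ (λ w → S.⟨ (λ x → φ ((x ∘ₚ w) ◃ c₀)) , ι d ⟩) , a ⟩  ≈⟨ S.⟨⟩-congˡ (λ w → begin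
      S.⟨ (λ x → φ ((x ∘ₚ w) ◃ c₀)) , ι d ⟩
        ≈⟨ S.⟨⟩-congˡ (λ x → R.reflexive (cong φ (≡.sym (◃-comp w x c₀)))) (ι d) ⟩
      S.⟨ (λ x → φ (w ◃ (x ◃ c₀))) , ι d ⟩  ≈⟨ ⟨⟩-Φ-c₀ (λ z → φ (w ◃ z)) d ⟨
      F.⟨ (λ f → φ (w ◃ (f ∙ c₀))) , Φ d ⟩
        ≈⟨ F.⟨⟩-congˡ (λ f → R.reflexive (cong φ (◃-∙ w f c₀))) (Φ d) ⟩
      F.⟨ (λ f → φ ((w ◃ f) ∙ (w ◃ c₀))) , Φ d ⟩
        ≈⟨ invariant-⟨⟩ (Φ-invariant d) (λ f → φ (f ∙ (w ◃ c₀))) w ⟩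
      F.⟨ (λ f → φ (f ∙ (w ◃ c₀))) , Φ d ⟩  ∎) a ⟩
    S.⟨ (λ w → F.⟨ (λ f → φ (f ∙ (w ◃ c₀))) , Φ d ⟩) , a ⟩
      ≈⟨ ∑-fubini a (Φ d) (λ w f → φ (f ∙ (w ◃ c₀))) ⟩
    F.⟨ (λ f → S.⟨ (λ w → φ (f ∙ (w ◃ c₀))) , a ⟩) , Φ d ⟩
      ≈⟨ F.⟨⟩-congˡ (λ f → R.reflexive (⟨⟩-θ (λ g → φ (f ∙ g)) a)) (Φ d) ⟨
    F.⟨ (λ f → F.⟨ (λ g → φ (f ∙ g)) , θ a ⟩) , Φ d ⟩  ≈⟨ F.⟨⟩-* φ (Φ d) (θ a) ⟨
    F.⟨ φ , Φ d KF.* θ a ⟩  ∎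

  private module A = Ring F.ring

  Φ-c₀≋ : ∀ d → Φ d KF.* KF.single c₀ F.≋ θ (ι d)
  Φ-c₀≋ d = F.≈⇒≋ (Φ-c₀ d)

  -- `ι d` can be read off `Φ d` as its product with `c₀`, because `θ` is injective.
  ι-cong : ∀ {d s} → Φ d F.≋ Φ s → ι d S.≋ ι s
  ι-cong {d} {s} p = θ-injective (A.trans (A.sym (Φ-c₀≋ d)) (A.trans (A.*-congʳ p) (Φ-c₀≋ s)))

  infixl 7 _⋆_
  -- The product of the descent algebra in coordinates, transported from the invariant elements; the
  -- factors trade places because `Φ` reverses products.
  _⋆_ : Σₙ → Σₙ → Σₙ
  d ⋆ s = Φ⁻¹ (Φ s KF.* Φ d)

  Φ-⋆ : ∀ d s → Φ (d ⋆ s) F.≋ Φ s KF.* Φ d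
  Φ-⋆ d s = Φ-Φ⁻¹ (*-invariant (Φ-invariant s) (Φ-invariant d))

  -- Closure of the descent algebra under multiplication, deduced from the closure of the invariant
  -- elements: both sides are compared as combinations of chambers.
  ι-⋆ : ∀ d s → ι d KS.* ι s S.≋ ι (d ⋆ s)
  ι-⋆ d s = θ-injective (A.trans (θ-*ι (ι d) s) (A.trans (A.*-congˡ {Φ s} (A.sym (Φ-c₀≋ d)))
    (A.trans (A.sym (A.*-assoc (Φ s) (Φ d) (KF.single c₀)))
        (A.trans (A.*-congʳ (A.sym (Φ-⋆ d s))) (Φ-c₀≋ (d ⋆ s))))))

-- The sign character on invariant elements

module SignCharacter {c ℓ₁ ℓ₂ : Level} (K : HeytingField c ℓ₁ ℓ₂) (char0 : CharacteristicZero K) (m : ℕ) where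

  open FaceAlgebra K m
  open Bidigare K m
  open RawMonoid (faceMonoid m) using (_∙_; ε)
  open ListSum R
  open SetoidReasoning R.setoid
  module RP = RingProperties R.ring
  open RawSemiringOps (RawRing.rawSemiring R.rawRing) using (_^_)

  sign : Bool → R.Carrier
  sign true  = R.- R.1#
  sign false = R.1#

  sign-not : ∀ b → sign (not b) R.≈ R.- sign b
  sign-not true  = R.sym (RP.-‿involutive _)
  sign-not false = R.refl

  sign-xor : ∀ a b → sign (a xor b) R.≈ sign a R.* sign b
  sign-xor true  b = R.trans (sign-not b) (R.sym (RP.-1*x≈-x _))
  sign-xor false b = R.sym (R.*-identityˡ _)

  sign² : ∀ b → sign b R.* sign b R.≈ R.1#
  sign² true  = R.trans (RP.-1*x≈-x _) (RP.-‿involutive _)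
  sign² false = R.*-identityˡ _

  sgn≈sign : ∀ π → sgn π R.≈ sign (odd π)
  sgn≈sign π = R.trans (power (λ (i , j) → (i <? j) ×-dec ((π ⟨$⟩ʳ j) <? (π ⟨$⟩ʳ i)))
      (cartesianProduct (allFin N) (allFin N)))
    (R.reflexive (cong sign (parity-allFin² (λ i j → (i <ᵇ j) ∧ ((π ⟨$⟩ʳ j) <ᵇ (π ⟨$⟩ʳ i))))))
    where
    power : ∀ {A : Set} {P : A → Set} (P? : Decidable₁ P) xs →
            (R.- R.1#) ^ length (filter P? xs) R.≈ sign (parity (map (λ x → does (P? x)) xs))
    power P? []       = R.refl
    power P? (x ∷ xs) with does (P? x)
    ... | true  = R.trans (R.*-congˡ (power P? xs))
        (R.sym (sign-xor true (parity (map (λ x → does (P? x)) xs))))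
    ... | false = power P? xs

  sgn-cong : ∀ {π ρ} → π Perm.≈ ρ → sgn π R.≈ sgn ρ
  sgn-cong {π} {ρ} p = R.trans (sgn≈sign π) (R.trans (R.reflexive (cong sign (odd-cong {π = π} {ρ} p)))
      (R.sym (sgn≈sign ρ)))

  sgn-∘ : ∀ π ρ → sgn (ρ ∘ₚ π) R.≈ sgn π R.* sgn ρ
  sgn-∘ π ρ = begin
    sgn (ρ ∘ₚ π)  ≈⟨ sgn≈sign (ρ ∘ₚ π) ⟩
    sign (odd (ρ ∘ₚ π))  ≡⟨ cong sign (odd-∘ π ρ) ⟩
    sign (odd π xor odd ρ)  ≈⟨ sign-xor (odd π) (odd ρ) ⟩
    sign (odd π) R.* sign (odd ρ)  ≈⟨ R.*-cong (sgn≈sign π) (sgn≈sign ρ) ⟨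
    sgn π R.* sgn ρ  ∎

  sgn² : ∀ π → sgn π R.* sgn π R.≈ R.1#
  sgn² π = R.trans (R.*-cong (sgn≈sign π) (sgn≈sign π)) (sign² (odd π))

  sgn-flip : ∀ π → sgn (flip π) R.≈ sgn π
  sgn-flip π = R.trans (sgn≈sign (flip π)) (R.trans (R.reflexive (cong sign (odd-flip π)))
      (R.sym (sgn≈sign π)))

  sgn-transpose : ∀ {i j} → ¬ i ≡ j → sgn (transpose i j) R.≈ R.- R.1#
  sgn-transpose {i} {j} i≢j = R.trans (sgn≈sign (transpose i j))
      (R.reflexive (cong sign (odd-transpose i j i≢j)))

  ψ : KS.Algebra → R.Carrier
  ψ a = S.⟨ sgn , a ⟩

  ψ-cong : ∀ {a b} → a S.≋ b → ψ a R.≈ ψ b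
  ψ-cong = S.⟨⟩-cong≋ (λ {π} {ρ} → sgn-cong {π} {ρ})

  ψ-* : ∀ a b → ψ (a KS.* b) R.≈ ψ a R.* ψ b
  ψ-* = S.⟨⟩-mult sgn-∘

  -- A tie of `f` is broken by `z` itself, which creates no inversion against `z`.
  inv-∙ : ∀ (z f : Face N) → inv (lt z) (lt (f ∙ z)) ≡ inv (lt z) (lt f)
  inv-∙ z f = ⨁-cong λ i j → go i j _ refl
    where
    go : ∀ i j b → lef z j i ≡ b → lt z i j ∧ lt (f ∙ z) j i ≡ lt z i j ∧ lt f j i
    go i j true  p rewrite p = refl
    go i j false p = cong (λ b → lt z i j ∧ not b)
        (≡.trans (lef-∙ f z i j) (helper (lef f i j) (lef f j i) (lef-total z p)))
      where
      helper : ∀ a b {d} → d ≡ true → a ∧ (not b ∨ d) ≡ a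
      helper a true  refl = ∧-identityʳ a
      helper a false refl = ∧-identityʳ a

  inv-◃c₀ : ∀ (w : Permutation′ N) (f : Face N) → inv (lt (w ◃ c₀)) (lt f) ≡ inv (lt c₀) (lt (flip w ◃ f))
  inv-◃c₀ w f = ≡.trans (⨁-permute _ w) (⨁-cong λ i j → cong₂ _∧_
    (cong not (≡.trans (lef-◃ w c₀ _ _) (cong₂ (lef c₀) (inverseˡ w) (inverseˡ w))))
    (cong not (≡.sym (lef-◃ (flip w) f i j))))

  inv-c₀-◃c₀ : ∀ (w : Permutation′ N) → inv (lt c₀) (lt (w ◃ c₀)) ≡ odd (flip w)
  inv-c₀-◃c₀ w = inv-cong lt-c₀ (λ i j → ≡.trans (cong not (lef-◃ w c₀ j i)) (lt-c₀ (w ⟨$⟩ˡ i) (w ⟨$⟩ˡ j)))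

  -- The sign of the chamber `f ∙ c₀` relative to `c₀`, extended linearly; by `inv-∙` it can be
  -- written in terms of `f` alone.
  ψᶠ : KF.Algebra → R.Carrier
  ψᶠ v = F.⟨ (λ f → sign (inv (lt c₀) (lt f))) , v ⟩

  ψᶠ-cong : ∀ {u v} → u F.≋ v → ψᶠ u R.≈ ψᶠ v
  ψᶠ-cong = F.⟨⟩-cong≋ (functional (λ f → sign (inv (lt c₀) (lt f))))

  ψᶠ-Φ : ∀ d → ψᶠ (Φ d) R.≈ ψ (ι d)
  ψᶠ-Φ d = begin
    ψᶠ (Φ d)
      ≈⟨ F.⟨⟩-congˡ (λ f → R.reflexive (cong sign (inv-∙ c₀ f))) (Φ d) ⟨
    F.⟨ (λ f → sign (inv (lt c₀) (lt (f ∙ c₀)))) , Φ d ⟩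
      ≈⟨ ⟨⟩-Φ-c₀ (λ z → sign (inv (lt c₀) (lt z))) d ⟩
    S.⟨ (λ w → sign (inv (lt c₀) (lt (w ◃ c₀)))) , ι d ⟩
      ≈⟨ S.⟨⟩-congˡ (λ w → R.trans (R.reflexive (cong sign (inv-c₀-◃c₀ w)))
                                                                           (R.trans (R.sym (sgn≈sign
                                                                               (flip w))) (sgn-flip w)))
                                                                               (ι d) ⟩
    ψ (ι d)  ∎

  private module A = Ring F.ring

  -- In the group algebra `sgn` is a homomorphism. The reversal of factors by Bidigare's map
  -- disappears because the values commute.
  ψᶠ-* : ∀ {u v} → Inv u → Inv v → ψᶠ (u KF.* v) R.≈ ψᶠ u R.* ψᶠ v
  ψᶠ-* {u} {v} iu iv = begin
    ψᶠ (u KF.* v)  ≈⟨ ψᶠ-cong (A.*-cong (A.sym Φs≋u) (A.sym Φd≋v)) ⟩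
    ψᶠ (Φ s KF.* Φ d)  ≈⟨ ψᶠ-cong (Φ-⋆ d s) ⟨
    ψᶠ (Φ (d ⋆ s))  ≈⟨ ψᶠ-Φ (d ⋆ s) ⟩
    ψ (ι (d ⋆ s))  ≈⟨ ψ-cong (ι-⋆ d s) ⟨
    ψ (ι d KS.* ι s)  ≈⟨ ψ-* (ι d) (ι s) ⟩
    ψ (ι d) R.* ψ (ι s)  ≈⟨ R.*-comm _ _ ⟩
    ψ (ι s) R.* ψ (ι d)  ≈⟨ R.*-cong (ψᶠ-Φ s) (ψᶠ-Φ d) ⟨
    ψᶠ (Φ s) R.* ψᶠ (Φ d)  ≈⟨ R.*-cong (ψᶠ-cong Φs≋u) (ψᶠ-cong Φd≋v) ⟩
    ψᶠ u R.* ψᶠ v  ∎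
    where
    s = Φ⁻¹ u
    d = Φ⁻¹ v
    Φs≋u = Φ-Φ⁻¹ iu
    Φd≋v = Φ-Φ⁻¹ iv

  ψᶠ-1 : ψᶠ KF.1# R.≈ R.1#
  ψᶠ-1 = R.trans (F.⟨⟩-single (λ f → sign (inv (lt c₀) (lt f))) ε) (R.reflexive (cong sign
    (≡.trans (⨁-cong λ i j → ≡.trans (cong (λ b → lt c₀ i j ∧ not b) (ε-lef i j)) (∧-zeroʳ _))
        (⨁-symmetric (λ _ _ → false) (λ _ → refl) (λ _ _ → refl)))))

  double-injective : ∀ {x y} → x R.+ x R.≈ y R.+ y → x R.≈ y
  double-injective {x} {y} p = begin
    x  ≈⟨ halve x ⟨
    h R.* (x R.+ x)  ≈⟨ R.*-congˡ p ⟩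
    h R.* (y R.+ y)  ≈⟨ halve y ⟩
    y  ∎
    where
    -- `char0 k` concerns the multiple `suc k` of 1, so `k = 1` makes 2 invertible.
    2⁻¹ = HeytingField.#⇒invertible K (char0 1)
    h = proj₁ 2⁻¹
    halve : ∀ x → h R.* (x R.+ x) R.≈ x
    halve x = begin
      h R.* (x R.+ x)
        ≈⟨ R.*-congˡ (R.+-cong (R.*-identityˡ x) (R.*-identityˡ x)) ⟨
      h R.* (R.1# R.* x R.+ R.1# R.* x)  ≈⟨ R.*-congˡ (R.distribʳ x R.1# R.1#) ⟨
      h R.* ((R.1# R.+ R.1#) R.* x)  ≈⟨ R.*-assoc h _ x ⟨
      (h R.* (R.1# R.+ R.1#)) R.* x
        ≈⟨ R.*-congʳ (R.*-congˡ (R.+-congˡ (R.+-identityʳ R.1#))) ⟨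
      (h R.* (R.1# R.+ (R.1# R.+ R.0#))) R.* x
        ≈⟨ R.*-congʳ (R.*-congˡ (R.trans (R.+-congˡ RP.-0#≈0#) (R.+-identityʳ _))) ⟨
      (h R.* ((R.1# R.+ (R.1# R.+ R.0#)) R.+ R.- R.0#)) R.* x  ≈⟨ R.*-congʳ (proj₁ (proj₂ 2⁻¹)) ⟩
      R.1# R.* x  ≈⟨ R.*-identityˡ x ⟩
      x  ∎

  module _ (Y : Face N) (p : Pairing Y) where
    open Pairing p

    private
      z : Face N
      z = adapted Y p

      G : Face N → R.Carrier
      G f = sign (inv (lt z) (lt f))

    -- Recursive in a list of points, so that the condition `Y ⊑ f` can be imposed one pair at a
    -- time; for `allFin N` it is the whole condition.
    unseparated : List (Fin N) → Face N → Bool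
    unseparated []       f = true
    unseparated (i ∷ is) f = samef f i (t i) ∧ unseparated is f

    -- v being invariant, any chamber may take the place of c₀ in ψᶠ v.
    ψᶠ-adapted : ∀ {v} → Inv v → ψᶠ v R.≈ F.⟨ G , v ⟩
    ψᶠ-adapted {v} iv = begin
      ψᶠ v
        ≈⟨ invariant-⟨⟩ iv (λ f → sign (inv (lt c₀) (lt f))) (flip w) ⟨
      F.⟨ (λ f → sign (inv (lt c₀) (lt (flip w ◃ f)))) , v ⟩
        ≈⟨ F.⟨⟩-congˡ (λ f → R.reflexive (cong sign (≡.trans (≡.sym (inv-◃c₀ w f))
                                                                        (cong (λ z → inv (lt z) (lt f))
                                                                            (≡.sym (proj₂ w,z≡)))))) v ⟩
      F.⟨ G , v ⟩  ∎
      where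
      w,z≡ = chamber⇒perm z (adapted-chamber Y p)
      w = proj₁ w,z≡

    -- The transposition of `i` and `t i` maps each pair of partners to itself, and being tied is
    -- symmetric.
    unseparated-◃ : ∀ is f i → unseparated is (transpose i (t i) ◃ f) ≡ unseparated is f
    unseparated-◃ []       f i = refl
    unseparated-◃ (k ∷ is) f i = cong₂ _∧_ (≡.trans (same-◃ (transpose i (t i)) f k (t k))
      (≡.trans (cong₂ (samef f) (transpose-ˡ i (t i) k) (transpose-ˡ i (t i) (t k)))
          (go (k ≟ᶠ i) (k ≟ᶠ t i)))) (unseparated-◃ is f i)
      where
      τ = transpose i (t i) ⟨$⟩ʳ_
      go : Dec (k ≡ i) → Dec (k ≡ t i) → samef f (τ k) (τ (t k)) ≡ samef f k (t k)
      go (yes refl) _ = ≡.trans (cong₂ (samef f) (transpose-≡ˡ k (t k)) (transpose-≡ʳ k (t k)))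
                          (≡-from-⇔ (same-sym f) (same-sym f))
      go (no _) (yes refl) = ≡.trans (cong₂ (samef f) (transpose-≡ʳ i (t i))
          (≡.trans (cong τ (t-involutive i)) (transpose-≡ˡ i (t i))))
                          (≡.trans (≡-from-⇔ (same-sym f) (same-sym f))
                              (cong (samef f (t i)) (≡.sym (t-involutive i))))
      go (no q) (no r) = cong₂ (samef f) (transpose-≢ i (t i) q r) (transpose-≢ i (t i)
        (λ tk≡i → r (≡.trans (≡.sym (t-involutive k)) (cong t tk≡i)))
        (λ tk≡ti → q (≡.trans (≡.sym (t-involutive k)) (≡.trans (cong t tk≡ti) (t-involutive i)))))

    -- Averaging over the transposition (i , t i) kills the faces that separate i from t i.
    average : ∀ {v} → Inv v → ∀ is i → F.⟨ (λ f → [ unseparated (i ∷ is) f ]ᵇ R.* G f) , v ⟩ R.≈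
                                        F.⟨ (λ f → [ unseparated is f ]ᵇ R.* G f) , v ⟩
    average {v} iv is i = double-injective (begin
      F.⟨ g′ , v ⟩ R.+ F.⟨ g′ , v ⟩  ≈⟨ F.⟨⟩-+ˡ g′ g′ v ⟨
      F.⟨ (λ f → g′ f R.+ g′ f) , v ⟩  ≈⟨ F.⟨⟩-congˡ (λ f → pointwise f _ refl) v ⟩
      F.⟨ (λ f → g f R.+ g (transpose i (t i) ◃ f)) , v ⟩  ≈⟨ F.⟨⟩-+ˡ g _ v ⟩
      F.⟨ g , v ⟩ R.+ F.⟨ (λ f → g (transpose i (t i) ◃ f)) , v ⟩
        ≈⟨ R.+-congˡ (invariant-⟨⟩ iv g (transpose i (t i))) ⟩
      F.⟨ g , v ⟩ R.+ F.⟨ g , v ⟩  ∎)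
      where
      g g′ : Face N → R.Carrier
      g f = [ unseparated is f ]ᵇ R.* G f
      g′ f = [ unseparated (i ∷ is) f ]ᵇ R.* G f

      pointwise : ∀ f b → samef f i (t i) ≡ b → g′ f R.+ g′ f R.≈ g f R.+ g (transpose i (t i) ◃ f)
      pointwise f true  s = R.+-cong (R.reflexive g′≡g)
          (R.reflexive (≡.trans g′≡g (cong g (≡.sym (transpose-same {f = f} s)))))
        where
        g′≡g : g′ f ≡ g f
        g′≡g = cong (λ b → [ b ∧ unseparated is f ]ᵇ R.* G f) s
      pointwise f false s = begin
        g′ f R.+ g′ f  ≈⟨ R.+-cong g′≈0 g′≈0 ⟩
        R.0# R.+ R.0#  ≈⟨ R.+-identityʳ _ ⟩
        R.0#  ≈⟨ R.-‿inverseʳ (g f) ⟨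
        g f R.+ R.- g f  ≈⟨ R.+-congˡ (RP.-‿distribʳ-* _ _) ⟩
        g f R.+ [ unseparated is f ]ᵇ R.* (R.- G f)
          ≈⟨ R.+-congˡ (R.*-cong (R.reflexive (cong [_]ᵇ (≡.sym (unseparated-◃ is f i))))
               (R.trans (R.sym (sign-not (inv (lt z) (lt f))))
                   (R.reflexive (cong sign (≡.sym (inv-adapted-swap Y p f s)))))) ⟩
        g f R.+ g (transpose i (t i) ◃ f)  ∎
        where
        g′≈0 : g′ f R.≈ R.0#
        g′≈0 = R.trans (R.reflexive (cong (λ b → [ b ∧ unseparated is f ]ᵇ R.* G f) s)) (R.zeroˡ _)

    unseparated⇒⊑ : ∀ {f} → unseparated (allFin N) f ≡ true → Y ⊑ f
    unseparated⇒⊑ {f} u {i} {j} s with t-unique s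
    ... | inj₁ refl = same-refl f i
    ... | inj₂ refl = each u (∈-allFin i)
      where
      each : ∀ {is} → unseparated is f ≡ true → ∀ {i} → i ∈ˡ is → samef f i (t i) ≡ true
      each {k ∷ is} u (here refl) = proj₁ (∧-true u)
      each {k ∷ is} u (there i∈)  = each {is} (proj₂ (∧-true {samef f k (t k)} u)) i∈

    ⊑⇒unseparated : ∀ {f} → Y ⊑ f → ∀ is → unseparated is f ≡ true
    ⊑⇒unseparated Y⊑f []       = refl
    ⊑⇒unseparated {f} Y⊑f (i ∷ is) = cong₂ _∧_ (Y⊑f (t-same i)) (⊑⇒unseparated {f} Y⊑f is)

    χ : Face N → R.Carrier
    χ f = [ unseparated (allFin N) f ]ᵇ

    -- Read from right to left, `average` strips the points from the indicator until no condition is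
    -- left. On the faces that the full indicator keeps, `inv-adapted-⊑` removes the sign.
    ψᶠ-χ : ∀ {v} → Inv v → ψᶠ v R.≈ F.⟨ χ , v ⟩
    ψᶠ-χ {v} iv = begin
      ψᶠ v  ≈⟨ ψᶠ-adapted iv ⟩
      F.⟨ G , v ⟩
        ≈⟨ F.⟨⟩-congˡ (λ f → R.*-identityˡ (G f)) v ⟨
      F.⟨ (λ f → [ unseparated [] f ]ᵇ R.* G f) , v ⟩  ≈⟨ all (allFin N) ⟨
      F.⟨ (λ f → χ f R.* G f) , v ⟩  ≈⟨ F.⟨⟩-congˡ (λ f → G≈1 f _ refl) v ⟩
      F.⟨ χ , v ⟩  ∎
      where
      all : ∀ is → F.⟨ (λ f → [ unseparated is f ]ᵇ R.* G f) , v ⟩ R.≈ F.⟨ (λ f →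
          [ unseparated [] f ]ᵇ R.* G f) , v ⟩
      all []       = R.refl
      all (i ∷ is) = R.trans (average iv is i) (all is)

      G≈1 : ∀ f b → unseparated (allFin N) f ≡ b →
          [ unseparated (allFin N) f ]ᵇ R.* G f R.≈ [ unseparated (allFin N) f ]ᵇ
      G≈1 f true  u = R.trans (R.*-congˡ (R.reflexive
          (cong sign (inv-adapted-⊑ Y p f (unseparated⇒⊑ {f} u))))) (R.*-identityʳ _)
      G≈1 f false u = R.trans (R.*-congʳ (R.reflexive (cong [_]ᵇ u)))
          (R.trans (R.zeroˡ _) (R.reflexive (cong [_]ᵇ (≡.sym u))))

-- Sandwiches between idempotents

module _ {a ℓ} (A : Ring a ℓ) where
  open Ring A
  open SetoidReasoning setoid
  open MonoidSolver *-monoid using (solve; _⊕_; _⊜_)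

  sandwich-+ : ∀ e r v → e * (v * r) ≈ 0# → r * (v * e) ≈ 0# →
               (e + r) * (v * (e + r)) ≈ e * (v * e) + r * (v * r)
  sandwich-+ e r v p q = begin
    (e + r) * (v * (e + r))  ≈⟨ *-congˡ (distribˡ v e r) ⟩
    (e + r) * (v * e + v * r)  ≈⟨ distribʳ _ e r ⟩
    e * (v * e + v * r) + r * (v * e + v * r)
      ≈⟨ +-cong (distribˡ e _ _) (distribˡ r _ _) ⟩
    (e * (v * e) + e * (v * r)) + (r * (v * e) + r * (v * r))  ≈⟨ +-cong (+-congˡ p) (+-congʳ q) ⟩
    (e * (v * e) + 0#) + (0# + r * (v * r))
      ≈⟨ +-cong (+-identityʳ _) (+-identityˡ _) ⟩
    e * (v * e) + r * (v * r)  ∎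

  -- Regrouped so that `u⁻¹ v u`, which is invariant if `u`, `u⁻¹` and `v` are, stands between the
  -- unconjugated factors.
  sandwich-conj : ∀ {e} u e′ u⁻¹ v → e ≈ (u * e′) * u⁻¹ →
                  e * (v * e) ≈ (u * (e′ * ((u⁻¹ * (v * u)) * e′))) * u⁻¹
  sandwich-conj {e} u e′ u⁻¹ v p = begin
    e * (v * e)  ≈⟨ *-cong p (*-congˡ p) ⟩
    ((u * e′) * u⁻¹) * (v * ((u * e′) * u⁻¹))  ≈⟨ solve 4 (λ u e′ u⁻¹ v →
      ((u ⊕ e′) ⊕ u⁻¹) ⊕ (v ⊕ ((u ⊕ e′) ⊕ u⁻¹)) ⊜ (u ⊕ (e′ ⊕ ((u⁻¹ ⊕ (v ⊕ u)) ⊕ e′))) ⊕ u⁻¹)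
          (Ring.refl A) u e′ u⁻¹ v ⟩
    (u * (e′ * ((u⁻¹ * (v * u)) * e′))) * u⁻¹  ∎

≈Π-decSetoid : ∀ n → DecSetoid _ _
≈Π-decSetoid n = record
  { Carrier = Π n ; _≈_ = _≈Π_
  ; isDecEquivalence = record
    { isEquivalence = record
      { refl  = (λ p → p) , (λ p → p)
      ; sym   = λ (p , q) → q , p
      ; trans = λ (p , q) (p′ , q′) → (λ r → p′ (p r)) , (λ r → q (q′ r))
      }
    ; _≟_ = _≈Π?_
    }
  }

module Sandwich {c ℓ₁ ℓ₂ : Level} (K : HeytingField c ℓ₁ ℓ₂) (char0 : CharacteristicZero K) (m : ℕ) where

  open FaceAlgebra K m
  open Bidigare K m
  open SignCharacter K char0 m
  open RawMonoid (faceMonoid m) using (_∙_)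
  open ListSum R

  module A = Ring F.ring

  -- If inserting any face `f` between `g` and `w` only rescales `g w` by `κ f`, with `κ` the same
  -- for all `g` occurring in `s`, then inserting `v` rescales by the linear extension of `κ`. It is
  -- applied with `κ` an indicator and with `κ` zero.
  absorb-* : ∀ {s w} {κ : Face N → R.Carrier} →
    All (λ (_ , g) → ∀ f φ → F.⟨ φ , KF.single (g ∙ f) KF.* w ⟩ R.≈ κ f R.* F.⟨ φ , KF.single g KF.* w ⟩) s →
    ∀ v → s KF.* (v KF.* w) F.≋ F.⟨ κ , v ⟩ KF.· (s KF.* w)
  absorb-* {s} {w} {κ} absorb v = F.≋-ext λ φ _ → begin
    F.⟨ φ , s KF.* (v KF.* w) ⟩
      ≈⟨ R.trans (F.⟨⟩-* φ s (v KF.* w)) (F.⟨⟩-congˡ (λ g → F.⟨⟩-* _ v w) s) ⟩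
    F.⟨ (λ g → F.⟨ (λ f → F.⟨ (λ h → φ (g ∙ (f ∙ h))) , w ⟩) , v ⟩) , s ⟩
      ≈⟨ ∑-congᴬ (All.map (λ {(r , g)} H → R.*-congˡ (term φ g (λ f → H f φ))) absorb) ⟩
    F.⟨ (λ g → F.⟨ κ , v ⟩ R.* F.⟨ (λ h → φ (g ∙ h)) , w ⟩) , s ⟩  ≈⟨ F.⟨⟩-*ˡ _ _ s ⟩
    F.⟨ κ , v ⟩ R.* F.⟨ (λ g → F.⟨ (λ h → φ (g ∙ h)) , w ⟩) , s ⟩  ≈⟨ R.*-congˡ (F.⟨⟩-* φ s w) ⟨
    F.⟨ κ , v ⟩ R.* F.⟨ φ , s KF.* w ⟩  ≈⟨ F.⟨⟩-· φ _ (s KF.* w) ⟨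
    F.⟨ φ , F.⟨ κ , v ⟩ KF.· (s KF.* w) ⟩  ∎
    where
    open SetoidReasoning R.setoid
    single-* : ∀ φ g → F.⟨ φ , KF.single g KF.* w ⟩ R.≈ F.⟨ (λ h → φ (g ∙ h)) , w ⟩
    single-* φ g = R.trans (F.⟨⟩-* φ (KF.single g) w) (F.⟨⟩-single (λ g → F.⟨ (λ h → φ (g ∙ h)) , w ⟩) g)

    term : ∀ φ g → (∀ f → F.⟨ φ , KF.single (g ∙ f) KF.* w ⟩ R.≈ κ f R.* F.⟨ φ , KF.single g KF.* w ⟩) →
           F.⟨ (λ f → F.⟨ (λ h → φ (g ∙ (f ∙ h))) , w ⟩) , v ⟩ R.≈ F.⟨ κ , v ⟩ R.* F.⟨ (λ h → φ (g ∙ h)) , w ⟩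
    term φ g H = begin
      F.⟨ (λ f → F.⟨ (λ h → φ (g ∙ (f ∙ h))) , w ⟩) , v ⟩  ≈⟨ F.⟨⟩-congˡ (λ f → begin
        F.⟨ (λ h → φ (g ∙ (f ∙ h))) , w ⟩
          ≈⟨ F.⟨⟩-congˡ (λ h → R.reflexive (cong φ (face-assoc g f h))) w ⟨
        F.⟨ (λ h → φ ((g ∙ f) ∙ h)) , w ⟩  ≈⟨ single-* φ (g ∙ f) ⟨
        F.⟨ φ , KF.single (g ∙ f) KF.* w ⟩  ≈⟨ H f ⟩
        κ f R.* F.⟨ φ , KF.single g KF.* w ⟩  ≈⟨ R.*-congˡ (single-* φ g) ⟩
        κ f R.* F.⟨ (λ h → φ (g ∙ h)) , w ⟩  ∎) v ⟩
      F.⟨ (λ f → κ f R.* F.⟨ (λ h → φ (g ∙ h)) , w ⟩) , v ⟩  ≈⟨ F.⟨⟩-*ʳ _ κ v ⟩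
      F.⟨ κ , v ⟩ R.* F.⟨ (λ h → φ (g ∙ h)) , w ⟩  ∎

  module _ (Ê : Π N → KF.Algebra) (saliola : IsSaliolaFamily Ê) where
    open IsSaliolaFamily saliola
    open WholeAlgebra.IsCFPOI isCFPOI using (primitive′)
    open SetoidReasoning A.setoid

    private
      Ê-support : ∀ Y → ∃ λ s → All (λ (_ , g) → g ⊑ Y) s × Ê Y F.≋ s
      Ê-support Y =
        let s , s≤ , Ê≈ = supported Y
        in s , All.map (λ {(_ , g)} → ≤Π⇒⊑ {X = g} {Y}) s≤ , F.≈⇒≋ Ê≈

      annihilated-⟨⟩ : ∀ f Y → ¬ Y ⊑ f → ∀ φ → F.⟨ φ , KF.single f KF.* Ê Y ⟩ R.≈ R.0#
      annihilated-⟨⟩ f Y Y⋢f φ = F.⟨⟩-cong (functional φ) {KF.single f KF.* Ê Y} {KF.0#}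
          (annihilated f Y (λ Y≤f → Y⋢f (≤Π⇒⊑ {X = Y} {f} Y≤f)))

    Ê-idem : ∀ Y → Ê Y KF.* Ê Y F.≋ Ê Y
    Ê-idem Y = F.≈⇒≋ (WholeAlgebra.IsPrimitive.idempotent (primitive′ Y))

    -- Ê Y is supported on faces g ≤ Y; then g f Ê Y is g Ê Y for f ≥ Y, since g f = g, and 0
    -- otherwise.
    Ê-sandwich : ∀ {Y} → Pairing Y → ∀ {v} → Inv v → Ê Y KF.* (v KF.* Ê Y) F.≋ ψᶠ v KF.· Ê Y
    Ê-sandwich {Y} p {v} iv = begin
      Ê Y KF.* (v KF.* Ê Y)  ≈⟨ A.*-congʳ {v KF.* Ê Y} Ê≋s ⟩
      s KF.* (v KF.* Ê Y)
        ≈⟨ absorb-* (All.map (λ {(_ , g)} g⊑Y f φ → absorb g g⊑Y f φ _ refl) s⊑) v ⟩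
      F.⟨ χ Y p , v ⟩ KF.· (s KF.* Ê Y)
        ≈⟨ F.·-cong (R.sym (ψᶠ-χ Y p iv)) (A.trans (A.*-congʳ {Ê Y} (A.sym Ê≋s)) (Ê-idem Y)) ⟩
      ψᶠ v KF.· Ê Y  ∎
      where
      s,p = Ê-support Y
      s = proj₁ s,p
      s⊑ = proj₁ (proj₂ s,p)
      Ê≋s = proj₂ (proj₂ s,p)

      absorb : ∀ g → g ⊑ Y → ∀ f φ b → unseparated Y p (allFin N) f ≡ b →
               F.⟨ φ , KF.single (g ∙ f) KF.* Ê Y ⟩ R.≈ χ Y p f R.* F.⟨ φ , KF.single g KF.* Ê Y ⟩
      absorb g g⊑Y f φ true  u = R.trans
        (R.reflexive (cong (λ h → F.⟨ φ , KF.single h KF.* Ê Y ⟩) (∙-absorb {f = g} {f} λ s →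
            unseparated⇒⊑ Y p {f} u (g⊑Y s))))
        (R.sym (R.trans (R.*-congʳ (R.reflexive (cong [_]ᵇ u))) (R.*-identityˡ _)))
      absorb g g⊑Y f φ false u = R.trans
        (annihilated-⟨⟩ (g ∙ f) Y (λ Y⊑gf → false≢true u
            (⊑⇒unseparated Y p {f} (λ s → proj₂ (∙-same⁻ g f (Y⊑gf s))) (allFin N))) φ)
        (R.sym (R.trans (R.*-congʳ (R.reflexive (cong [_]ᵇ u))) (R.zeroˡ _)))

    -- Faces `g` in the support of `Ê X` refine `X`. If `g f` did not annihilate `Ê Y`, then `Y`
    -- would refine `g f`, hence `g`, hence `X`, and two such set partitions of this type would
    -- coincide.
    Ê-cross : ∀ {X Y} → Pairing X → Pairing Y → ¬ X ≈Π Y → ∀ v → Ê X KF.* (v KF.* Ê Y) F.≋ KF.0#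
    Ê-cross {X} {Y} pX pY X≉Y v = begin
      Ê X KF.* (v KF.* Ê Y)  ≈⟨ A.*-congʳ {v KF.* Ê Y} Ê≋s ⟩
      s KF.* (v KF.* Ê Y)
        ≈⟨ absorb-* {κ = λ _ → R.0#} (All.map (λ {(_ , g)} g⊑X f φ → R.trans
             (annihilated-⟨⟩ (g ∙ f) Y (λ Y⊑gf → X≉Y (antisym λ q → g⊑X (proj₁ (∙-same⁻ g f (Y⊑gf q))))) φ)
             (R.sym (R.zeroˡ _))) s⊑) v ⟩
      F.⟨ (λ _ → R.0#) , v ⟩ KF.· (s KF.* Ê Y)  ≈⟨ F.·-cong (F.⟨⟩-zeroˡ v) A.refl ⟩
      R.0# KF.· (s KF.* Ê Y)  ≈⟨ F.·-0 (s KF.* Ê Y) ⟩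
      KF.0#  ∎
      where
      s,p = Ê-support X
      s = proj₁ s,p
      s⊑ = proj₁ (proj₂ s,p)
      Ê≋s = proj₂ (proj₂ s,p)

      antisym : Y ⊑ X → X ≈Π Y
      antisym Y⊑X = ⊑-antisym {X = X} {Y} (pairing-⊑ {X = Y} {X} pY pX Y⊑X) Y⊑X

    private
      ∑Ê = λ L → WholeAlgebra.∑ L Ê

    ∑Ê-sandwich : ∀ {L} → AllPairs (λ X Y → ¬ X ≈Π Y) L → All Pairing L → ∀ {v} → Inv v →
                  ∑Ê L KF.* (v KF.* ∑Ê L) F.≋ ψᶠ v KF.· ∑Ê L
    ∑Ê-sandwich []        []       {v} iv = A.refl
    ∑Ê-sandwich {Y ∷ L} (Y≉ ∷ L!) (p ∷ ps) {v} iv = begin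
      (Ê Y KF.+ ∑Ê L) KF.* (v KF.* (Ê Y KF.+ ∑Ê L))
        ≈⟨ sandwich-+ F.ring (Ê Y) (∑Ê L) v (crossʳ Y≉ ps) (crossˡ Y≉ ps) ⟩
      Ê Y KF.* (v KF.* Ê Y) KF.+ ∑Ê L KF.* (v KF.* ∑Ê L)
        ≈⟨ A.+-cong (Ê-sandwich p iv) (∑Ê-sandwich L! ps iv) ⟩
      (ψᶠ v KF.· Ê Y) KF.+ (ψᶠ v KF.· ∑Ê L)  ≈⟨ F.·-+ʳ (ψᶠ v) (Ê Y) (∑Ê L) ⟨
      ψᶠ v KF.· (Ê Y KF.+ ∑Ê L)  ∎
      where
      crossʳ : ∀ {L} → All (λ X → ¬ Y ≈Π X) L → All Pairing L → Ê Y KF.* (v KF.* ∑Ê L) F.≋ KF.0#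
      crossʳ []       []       = A.trans (A.*-congˡ {Ê Y} (A.zeroʳ v)) (A.zeroʳ (Ê Y))
      crossʳ {X ∷ L} (Y≉X ∷ Y≉) (q ∷ qs) = begin
        Ê Y KF.* (v KF.* (Ê X KF.+ ∑Ê L))
          ≈⟨ A.*-congˡ {Ê Y} (A.distribˡ v (Ê X) (∑Ê L)) ⟩
        Ê Y KF.* (v KF.* Ê X KF.+ v KF.* ∑Ê L)
          ≈⟨ A.distribˡ (Ê Y) (v KF.* Ê X) (v KF.* ∑Ê L) ⟩
        Ê Y KF.* (v KF.* Ê X) KF.+ Ê Y KF.* (v KF.* ∑Ê L)
          ≈⟨ A.+-cong (Ê-cross p q Y≉X v) (crossʳ Y≉ qs) ⟩
        KF.0# KF.+ KF.0#  ≈⟨ A.refl ⟩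
        KF.0#  ∎

      crossˡ : ∀ {L} → All (λ X → ¬ Y ≈Π X) L → All Pairing L → ∑Ê L KF.* (v KF.* Ê Y) F.≋ KF.0#
      crossˡ []       []       = A.refl
      crossˡ {X ∷ L} (Y≉X ∷ Y≉) (q ∷ qs) = begin
        (Ê X KF.+ ∑Ê L) KF.* (v KF.* Ê Y)  ≈⟨ A.distribʳ (v KF.* Ê Y) (Ê X) (∑Ê L) ⟩
        Ê X KF.* (v KF.* Ê Y) KF.+ ∑Ê L KF.* (v KF.* Ê Y)
          ≈⟨ A.+-cong (Ê-cross q p (λ (a , b) → Y≉X (b , a)) v) (crossˡ Y≉ qs) ⟩
        KF.0# KF.+ KF.0#  ≈⟨ A.refl ⟩
        KF.0#  ∎

    module _ (E : Partition N → KF.Algebra) (family : IsInvariantFamily Ê E) where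
      open IsInvariantFamily family

      E-sandwich : ∀ {v} → Inv v →
        E (twosPartition N) KF.* (v KF.* E (twosPartition N)) F.≋ ψᶠ v KF.· E (twosPartition N)
      E-sandwich {v} iv = begin
        Eλ KF.* (v KF.* Eλ)  ≈⟨ sandwich-conj F.ring u (∑Ê L) u⁻¹ v Eλ≋ ⟩
        u KF.* (∑Ê L KF.* ((u⁻¹ KF.* (v KF.* u)) KF.* ∑Ê L)) KF.* u⁻¹
          ≈⟨ A.*-congʳ {u⁻¹} (A.*-congˡ {u} (∑Ê-sandwich L! pairings
              (*-invariant iu⁻¹ (*-invariant iv iu)))) ⟩
        u KF.* (ψᶠ (u⁻¹ KF.* (v KF.* u)) KF.· ∑Ê L) KF.* u⁻¹  ≈⟨ A.*-congʳ {u⁻¹} (F.·-*ʳ _ u (∑Ê L)) ⟩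
        (ψᶠ (u⁻¹ KF.* (v KF.* u)) KF.· (u KF.* ∑Ê L)) KF.* u⁻¹  ≈⟨ F.·-*ˡ _ (u KF.* ∑Ê L) u⁻¹ ⟩
        ψᶠ (u⁻¹ KF.* (v KF.* u)) KF.· (u KF.* ∑Ê L KF.* u⁻¹)  ≈⟨ F.·-cong ψᶠ-conj (A.sym Eλ≋) ⟩
        ψᶠ v KF.· Eλ  ∎
        where
        Eλ = E (twosPartition N)
        L = filter (_∈Λ? twosPartition N) (allSetPartitions N)
        Eλ≋ : Eλ F.≋ u KF.* ∑Ê L KF.* u⁻¹
        Eλ≋ = F.≈⇒≋ (conjugate (twosPartition N))
        iu : Inv u
        iu = mkInv u-inv
        iu⁻¹ : Inv u⁻¹
        iu⁻¹ = mkInv u⁻¹-inv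

        L! : AllPairs (λ X Y → ¬ X ≈Π Y) L
        L! = AllPairs.filter⁺ (_∈Λ? twosPartition N) (deduplicate-! (≈Π-decSetoid N) (allFaces N))

        pairings : All Pairing L
        pairings = All.map (λ {Y} → pairing N Y) (All.all-filter (_∈Λ? twosPartition N) (allSetPartitions N))

        -- The values of `ψᶠ` commute, so those of `u⁻¹` and `u` meet and multiply to 1.
        ψᶠ-conj : ψᶠ (u⁻¹ KF.* (v KF.* u)) R.≈ ψᶠ v
        ψᶠ-conj = let open CommutativeSemigroupProperties R.*-commutativeSemigroup using (x∙yz≈y∙xz) in
          R.trans (ψᶠ-* iu⁻¹ (*-invariant iv iu)) (R.trans (R.*-congˡ (ψᶠ-* iv iu)) (R.trans (x∙yz≈y∙xz _ _ _)
            (R.trans (R.*-congˡ (R.trans (R.sym (ψᶠ-* iu⁻¹ iu))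
                (R.trans (ψᶠ-cong (F.≈⇒≋ {u⁻¹ KF.* u} {KF.1#} u⁻¹u)) ψᶠ-1))) (R.*-identityʳ _))))

-- The sign isotypic subspace

chamber-or-pair : ∀ {n} (f : Face n) → IsChamber f ⊎ ∃₂ λ i j → samef f i j ≡ true × ¬ i ≡ j
chamber-or-pair f with any? (λ i → any? (λ j → (samef f i j ≟ᵇ true) ×-dec ¬? (i ≟ᶠ j)))
... | yes p = inj₂ p
... | no ¬p = inj₁ λ {i} {j} s → decidable-stable (i ≟ᶠ j) (λ i≢j → ¬p (i , j , s , i≢j))

module SignIsotypicSubspace {c ℓ₁ ℓ₂ : Level} (K : HeytingField c ℓ₁ ℓ₂) (char0 : CharacteristicZero K)
    (m : ℕ) where

  open FaceAlgebra K m
  open Bidigare K m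
  open SignCharacter K char0 m
  open ListSum R
  open SetoidReasoning R.setoid
  private module A = Ring F.ring

  chamber-elim : ∀ {p} (P : Face N → Set p) → (∀ w → P (w ◃ c₀)) →
                 (∀ f i j → samef f i j ≡ true → ¬ i ≡ j → P f) → ∀ f → P f
  chamber-elim P ch pair f = by-cases (chamber-or-pair f)
    where
    by-cases : IsChamber f ⊎ (∃₂ λ i j → samef f i j ≡ true × ¬ i ≡ j) → P f
    by-cases (inj₁ c) = let w , f≡ = chamber⇒perm f c in subst P (≡.sym f≡) (ch w)
    by-cases (inj₂ (i , j , s , i≢j)) = pair f i j s i≢j

  coeff-· : ∀ k u f → KF.coeff (k KF.· u) f R.≈ k R.* KF.coeff u f
  coeff-· k u f = R.trans (F.coeff-δ (k KF.· u) f)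
      (R.trans (F.⟨⟩-· (F.δ f) k u) (R.*-congˡ (R.sym (F.coeff-δ u f))))

  -- The antisymmetriser of the group algebra.
  alt : KS.Algebra
  alt = map (λ w → sgn w , w) (allPermutations N)

  ⟨⟩-alt : ∀ φ → S.⟨ φ , alt ⟩ R.≈ ∑ (allPermutations N) (λ w → sgn w R.* φ w)
  ⟨⟩-alt φ = R.reflexive (∑-map (λ w → sgn w , w) (allPermutations N) _)

  ∑-δ-perm : ∀ w (φ g : Permutation′ N → R.Carrier) →
             (∀ x → w Perm.≈ x → φ x R.≈ g w) → (∀ x → ¬ w Perm.≈ x → φ x R.≈ R.0#) →
                 ∑ (allPermutations N) φ R.≈ g w
  ∑-δ-perm w φ g = ∑-δ {_∼_ = Perm._≈_} φ g {w} (allPermutations-unique N) (∈-allPermutations w)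
    (λ p q i → ≡.trans (≡.sym (p i)) (q i)) (λ p q i → ≡.trans (≡.sym (q i)) (p i))

  coeff-alt : ∀ w → KS.coeff alt w R.≈ sgn w
  coeff-alt w = R.trans (S.coeff-δ alt w) (R.trans (⟨⟩-alt (S.δ w)) (∑-δ-perm w (λ x → sgn x R.* S.δ w x) sgn
    (λ x w≈x → R.trans (R.*-cong (R.sym (sgn-cong {w} {x} w≈x)) (S.δ-≈ {w} {x} w≈x)) (R.*-identityʳ _))
    (λ x w≉x → R.trans (R.*-congˡ (S.δ-≉ {w} {x} w≉x)) (R.zeroʳ _))))

  s₀ : KF.Algebra
  s₀ = θ alt

  coeff-s₀ : ∀ w → KF.coeff s₀ (w ◃ c₀) R.≈ sgn w
  coeff-s₀ w = R.trans (coeff-θ alt w) (coeff-alt w)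

  coeff-s₀-pair : ∀ f i j → samef f i j ≡ true → ¬ i ≡ j → KF.coeff s₀ f R.≈ R.0#
  coeff-s₀-pair f i j s i≢j = begin
    KF.coeff s₀ f  ≈⟨ F.coeff-δ s₀ f ⟩
    F.⟨ F.δ f , s₀ ⟩  ≡⟨ ⟨⟩-θ (F.δ f) alt ⟩
    S.⟨ (λ w → F.δ f (w ◃ c₀)) , alt ⟩
      ≈⟨ S.⟨⟩-congˡ (λ w → F.δ-≉ λ f≡ → i≢j (subst IsChamber (≡.sym f≡) (◃-chamber w c₀ c₀-chamber) s)) alt ⟩
    S.⟨ (λ _ → R.0#) , alt ⟩  ≈⟨ S.⟨⟩-zeroˡ alt ⟩
    R.0#  ∎

  s₀-sign : ∀ k → SignIsotypic (k KF.· s₀)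
  s₀-sign k π = chamber-elim (λ f → KF.coeff (π • (k KF.· s₀)) f R.≈ KF.coeff (sgn π KF.· (k KF.· s₀)) f)
    (λ w → begin
      KF.coeff (π • (k KF.· s₀)) (w ◃ c₀)  ≈⟨ coeff-• π (k KF.· s₀) (w ◃ c₀) ⟩
      KF.coeff (k KF.· s₀) (flip π ◃ (w ◃ c₀))  ≡⟨ cong (KF.coeff (k KF.· s₀)) (◃-comp (flip π) w c₀) ⟩
      KF.coeff (k KF.· s₀) ((w ∘ₚ flip π) ◃ c₀)  ≈⟨ coeff-· k s₀ ((w ∘ₚ flip π) ◃ c₀) ⟩
      k R.* KF.coeff s₀ ((w ∘ₚ flip π) ◃ c₀)
        ≈⟨ R.*-congˡ (R.trans (coeff-s₀ (w ∘ₚ flip π))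
            (R.trans (sgn-∘ (flip π) w) (R.*-congʳ (sgn-flip π)))) ⟩
      k R.* (sgn π R.* sgn w)  ≈⟨ x∙yz≈y∙xz _ _ _ ⟩
      sgn π R.* (k R.* sgn w)
        ≈⟨ R.*-congˡ (R.trans (coeff-· k s₀ (w ◃ c₀)) (R.*-congˡ (coeff-s₀ w))) ⟨
      sgn π R.* KF.coeff (k KF.· s₀) (w ◃ c₀)  ≈⟨ coeff-· (sgn π) (k KF.· s₀) (w ◃ c₀) ⟨
      KF.coeff (sgn π KF.· (k KF.· s₀)) (w ◃ c₀)  ∎)
    (λ f i j s i≢j → R.trans (coeff-• π (k KF.· s₀) f)
      (R.trans (vanish (flip π ◃ f) (π ⟨$⟩ˡ i) (π ⟨$⟩ˡ j)
        (≡.trans (same-◃ (flip π) f (π ⟨$⟩ˡ i) (π ⟨$⟩ˡ j))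
            (≡.trans (cong₂ (samef f) (inverseʳ π) (inverseʳ π)) s))
        (i≢j ∘ ⟨$⟩ˡ-injective π))
      (R.sym (R.trans (coeff-· (sgn π) (k KF.· s₀) f)
          (R.trans (R.*-congˡ (vanish f i j s i≢j)) (R.zeroʳ _))))))
    where
    open CommutativeSemigroupProperties R.*-commutativeSemigroup using (x∙yz≈y∙xz)
    vanish : ∀ f i j → samef f i j ≡ true → ¬ i ≡ j → KF.coeff (k KF.· s₀) f R.≈ R.0#
    vanish f i j s i≢j = R.trans (coeff-· k s₀ f)
        (R.trans (R.*-congˡ (coeff-s₀-pair f i j s i≢j)) (R.zeroʳ _))

  -- The coordinate on the line spanned by `s₀`, in which `c₀` has coefficient 1.
  κ : KF.Algebra → R.Carrier
  κ u = KF.coeff u c₀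

  -- A transposition inside a block of f fixes f, so the coefficient of f is its own negative.
  sign-determined : ∀ {u} → SignIsotypic u → u F.≋ κ u KF.· s₀
  sign-determined {u} sg = F.≈⇒≋ (chamber-elim (λ f → KF.coeff u f R.≈ KF.coeff (κ u KF.· s₀) f)
    (λ w → begin
      KF.coeff u (w ◃ c₀)  ≈⟨ R.*-identityˡ _ ⟨
      R.1# R.* KF.coeff u (w ◃ c₀)  ≈⟨ R.*-congʳ (sgn² w) ⟨
      (sgn w R.* sgn w) R.* KF.coeff u (w ◃ c₀)  ≈⟨ R.*-assoc _ _ _ ⟩
      sgn w R.* (sgn w R.* KF.coeff u (w ◃ c₀))  ≈⟨ R.*-congˡ (coeff-· (sgn w) u (w ◃ c₀)) ⟨
      sgn w R.* KF.coeff (sgn w KF.· u) (w ◃ c₀)  ≈⟨ R.*-congˡ (sg w (w ◃ c₀)) ⟨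
      sgn w R.* KF.coeff (w • u) (w ◃ c₀)  ≈⟨ R.*-congˡ (coeff-• w u (w ◃ c₀)) ⟩
      sgn w R.* KF.coeff u (flip w ◃ (w ◃ c₀))
        ≡⟨ cong (λ f → sgn w R.* KF.coeff u f) (◃-inverseˡ w c₀) ⟩
      sgn w R.* κ u  ≈⟨ R.*-comm _ _ ⟩
      κ u R.* sgn w
        ≈⟨ R.trans (coeff-· (κ u) s₀ (w ◃ c₀)) (R.*-congˡ (coeff-s₀ w)) ⟨
      KF.coeff (κ u KF.· s₀) (w ◃ c₀)  ∎)
    (λ f i j s i≢j → R.trans (u-vanish f i j s i≢j)
      (R.sym (R.trans (coeff-· (κ u) s₀ f) (R.trans (R.*-congˡ (coeff-s₀-pair f i j s i≢j)) (R.zeroʳ _))))))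
    where
    u-vanish : ∀ f i j → samef f i j ≡ true → ¬ i ≡ j → KF.coeff u f R.≈ R.0#
    u-vanish f i j s i≢j = double-injective (begin
      y R.+ y  ≈⟨ R.+-congˡ y≈-y ⟩
      y R.+ R.- y  ≈⟨ R.-‿inverseʳ y ⟩
      R.0#  ≈⟨ R.+-identityʳ _ ⟨
      R.0# R.+ R.0#  ∎)
      where
      y = KF.coeff u f
      τ = transpose i j
      τf : flip τ ◃ f ≡ f
      τf = ≡.trans (cong (flip τ ◃_) (≡.sym (transpose-same {f = f} s))) (◃-inverseˡ τ f)
      y≈-y : y R.≈ R.- y
      y≈-y = begin
        y  ≡⟨ cong (KF.coeff u) τf ⟨
        KF.coeff u (flip τ ◃ f)  ≈⟨ coeff-• τ u f ⟨
        KF.coeff (τ • u) f  ≈⟨ sg τ f ⟩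
        KF.coeff (sgn τ KF.· u) f  ≈⟨ coeff-· (sgn τ) u f ⟩
        sgn τ R.* y  ≈⟨ R.*-congʳ (sgn-transpose i≢j) ⟩
        (R.- R.1#) R.* y  ≈⟨ RP.-1*x≈-x y ⟩
        R.- y  ∎

  κ-cong : ∀ {u v} → u F.≋ v → κ u R.≈ κ v
  κ-cong p = F.≋⇒≈ p c₀

  κ-θ : ∀ a → κ (θ a) R.≈ KS.coeff a Perm.id
  κ-θ a = R.trans (R.reflexive (cong (KF.coeff (θ a)) (≡.sym (◃-id c₀)))) (coeff-θ a Perm.id)

  κ-s₀ : κ s₀ R.≈ R.1#
  κ-s₀ = R.trans (κ-θ alt) (R.trans (coeff-alt Perm.id)
      (R.trans (sgn≈sign Perm.id) (R.reflexive (cong sign odd-id))))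
    where
    odd-id : odd (Perm.id {N}) ≡ false
    odd-id = ≡.trans (odd-∘ Perm.id Perm.id) (xor-same (odd (Perm.id {N})))

  -- A term `x` of `a` reaches the identity only from the term `x⁻¹` of `alt`, and this has the
  -- coefficient `sgn x`.
  coeff-alt-* : ∀ a → KS.coeff (alt KS.* a) Perm.id R.≈ ψ a
  coeff-alt-* a = begin
    KS.coeff (alt KS.* a) Perm.id  ≈⟨ S.coeff-δ (alt KS.* a) Perm.id ⟩
    S.⟨ S.δ Perm.id , alt KS.* a ⟩  ≈⟨ S.⟨⟩-* (S.δ Perm.id) alt a ⟩
    S.⟨ (λ w → S.⟨ (λ x → S.δ Perm.id (x ∘ₚ w)) , a ⟩) , alt ⟩
      ≈⟨ ∑-fubini alt a (λ w x → S.δ Perm.id (x ∘ₚ w)) ⟩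
    S.⟨ (λ x → S.⟨ (λ w → S.δ Perm.id (x ∘ₚ w)) , alt ⟩) , a ⟩  ≈⟨ S.⟨⟩-congˡ inner a ⟩
    ψ a  ∎
    where
    inner : ∀ x → S.⟨ (λ w → S.δ Perm.id (x ∘ₚ w)) , alt ⟩ R.≈ sgn x
    inner x = R.trans (⟨⟩-alt (λ w → S.δ Perm.id (x ∘ₚ w)))
        (∑-δ-perm (flip x) (λ w → sgn w R.* S.δ Perm.id (x ∘ₚ w)) (λ _ → sgn x)
      (λ w p → R.trans (R.*-cong (R.trans (R.sym (sgn-cong {flip x} {w} p)) (sgn-flip x))
                         (S.δ-≈ {Perm.id} {x ∘ₚ w} (λ i → ≡.trans (≡.sym (inverseˡ x)) (p (x ⟨$⟩ʳ i)))))
                             (R.*-identityʳ _))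
      (λ w ¬p → R.trans (R.*-congˡ (S.δ-≉ {Perm.id} {x ∘ₚ w} (λ p →
          ¬p (λ i → ≡.trans (p (x ⟨$⟩ˡ i)) (cong (w ⟨$⟩ʳ_) (inverseʳ x)))))) (R.zeroʳ _)))

  κ-Φ* : ∀ r {u} → SignIsotypic u → κ (Φ r KF.* u) R.≈ κ u R.* ψ (ι r)
  κ-Φ* r {u} sg = begin
    κ (Φ r KF.* u)  ≈⟨ κ-cong (A.*-congˡ {Φ r} (sign-determined sg)) ⟩
    κ (Φ r KF.* (κ u KF.· s₀))  ≈⟨ κ-cong (F.·-*ʳ (κ u) (Φ r) s₀) ⟩
    κ (κ u KF.· (Φ r KF.* s₀))  ≈⟨ coeff-· (κ u) (Φ r KF.* s₀) c₀ ⟩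
    κ u R.* κ (Φ r KF.* s₀)  ≈⟨ R.*-congˡ (κ-cong (θ-*ι alt r)) ⟨
    κ u R.* κ (θ (alt KS.* ι r))  ≈⟨ R.*-congˡ (R.trans (κ-θ (alt KS.* ι r)) (coeff-alt-* (ι r))) ⟩
    κ u R.* ψ (ι r)  ∎

-- The module generated by the idempotent, and its radical

module _ {c ℓ₁ ℓ₂ : Level} (K : HeytingField c ℓ₁ ℓ₂) (char0 : CharacteristicZero K) (m : ℕ)
         (Ê : Π (suc m) → FaceAlgebra.KF.Algebra K m) (saliola : FaceAlgebra.IsSaliolaFamily K m Ê)
         (E : Partition (suc m) → FaceAlgebra.KF.Algebra K m)
         (family : FaceAlgebra.IsInvariantFamily K m Ê E) where

  open FaceAlgebra K m
  open Bidigare K m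
  open SignCharacter K char0 m
  open SignIsotypicSubspace K char0 m
  open ListSum R
  open HeytingField K using (_#_; #⇒invertible; tight; #-cotrans)
  private
    module A = Ring F.ring
    module B = Ring S.ring
    module BP = RingProperties S.ring

  infixr 7 _·Σ_
  _·Σ_ : R.Carrier → Σₙ → Σₙ
  (k ·Σ d) J = k R.* d J

  Φ-· : ∀ k d → Φ (k ·Σ d) F.≋ k KF.· Φ d
  Φ-· k d = F.≋-ext λ φ _ → R.trans (⟨⟩-Φ φ (k ·Σ d))
      (R.trans (∑-cong (allSubsets m) (λ J → R.*-assoc k (d J) _))
    (R.trans (∑-*ˡ (allSubsets m) k _) (R.sym (R.trans (F.⟨⟩-· φ k (Φ d)) (R.*-congˡ (⟨⟩-Φ φ d))))))

  ι-· : ∀ k d → ι (k ·Σ d) S.≋ k KS.· ι d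
  ι-· k d = S.≋-ext λ φ _ → R.trans (⟨⟩-ι φ (k ·Σ d))
      (R.trans (∑-cong (allSubsets m) (λ J → R.*-assoc k (d J) _))
    (R.trans (∑-*ˡ (allSubsets m) k _) (R.sym (R.trans (S.⟨⟩-· φ k (ι d)) (R.*-congˡ (⟨⟩-ι φ d))))))

  ι-+ : ∀ d s → ι (λ J → d J R.+ s J) S.≋ ι d KS.+ ι s
  ι-+ d s = S.≋-ext λ φ _ → R.trans (⟨⟩-ι φ (λ J → d J R.+ s J))
      (R.trans (∑-cong (allSubsets m) (λ J → R.distribʳ _ (d J) (s J)))
    (R.trans (∑-+ (allSubsets m) _ _) (R.sym (R.trans (S.⟨⟩-+ φ (ι d) (ι s))
        (R.+-cong (⟨⟩-ι φ d) (⟨⟩-ι φ s))))))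

  ψ-+ : ∀ a b → ψ (a KS.+ b) R.≈ ψ a R.+ ψ b
  ψ-+ = S.⟨⟩-+ sgn

  ψ-· : ∀ k a → ψ (k KS.· a) R.≈ k R.* ψ a
  ψ-· = S.⟨⟩-· sgn

  ψ-neg : ∀ a → ψ (KS.- a) R.≈ R.- ψ a
  ψ-neg = S.⟨⟩-neg sgn

  private
    λ₂ = twosPartition N
    Eλ = E λ₂

    module CFPOI = InvariantAlgebra.IsCFPOI (IsInvariantFamily.isCFPOI family)
    module Primitive = InvariantAlgebra.IsPrimitive (CFPOI.primitive′ λ₂)

    iE : Inv Eλ
    iE = mkInv (CFPOI.member λ₂)

    EE : Eλ KF.* Eλ F.≋ Eλ
    EE = F.≈⇒≋ Primitive.idempotent

    sandwich : ∀ {v} → Inv v → Eλ KF.* (v KF.* Eλ) F.≋ ψᶠ v KF.· Eλ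
    sandwich = Sandwich.E-sandwich K char0 m Ê saliola E family

    d₀ : Σₙ
    d₀ = Φ⁻¹ Eλ

    e : KS.Algebra
    e = ι d₀

    Φd₀ : Φ d₀ F.≋ Eλ
    Φd₀ = Φ-Φ⁻¹ iE

    e-idem : e KS.* e S.≋ e
    e-idem = B.trans (ι-⋆ d₀ d₀) (ι-cong (A.trans (Φ-⋆ d₀ d₀)
        (A.trans (A.*-cong Φd₀ Φd₀) (A.trans EE (A.sym Φd₀)))))

    -- The antiisomorphism reverses products, but a sandwich with equal outer factors reads the same
    -- in both directions.
    e-sandwich : ∀ s → (e KS.* ι s) KS.* e S.≋ ψ (ι s) KS.· e
    e-sandwich s = B.trans (B.*-congʳ {e} (ι-⋆ d₀ s)) (B.trans (ι-⋆ (d₀ ⋆ s) d₀) (B.trans (ι-cong (begin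
      Φ ((d₀ ⋆ s) ⋆ d₀)  ≈⟨ Φ-⋆ (d₀ ⋆ s) d₀ ⟩
      Φ d₀ KF.* Φ (d₀ ⋆ s)  ≈⟨ A.*-congˡ {Φ d₀} (Φ-⋆ d₀ s) ⟩
      Φ d₀ KF.* (Φ s KF.* Φ d₀)  ≈⟨ A.*-cong Φd₀ (A.*-congˡ {Φ s} Φd₀) ⟩
      Eλ KF.* (Φ s KF.* Eλ)  ≈⟨ sandwich (Φ-invariant s) ⟩
      ψᶠ (Φ s) KF.· Eλ  ≈⟨ F.·-cong (ψᶠ-Φ s) (A.sym Φd₀) ⟩
      ψ (ι s) KF.· Φ d₀  ≈⟨ Φ-· (ψ (ι s)) d₀ ⟨
      Φ (ψ (ι s) ·Σ d₀)  ∎)) (ι-· (ψ (ι s)) d₀)))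
      where open SetoidReasoning A.setoid

    1≉0 : ¬ R.1# R.≈ R.0#
    1≉0 1≈0 = proj₂ (tight _ _) (R.trans (R.+-identityʳ R.1#) 1≈0) (char0 0)

    -- The field axioms invert the difference of two apart elements, here `a - 0`; what is left is
    -- to drop the zero.
    inverse : ∀ {a} → a # R.0# → ∃ λ a⁻¹ → a⁻¹ R.* a R.≈ R.1#
    inverse a#0 = let a⁻¹ , p , _ = #⇒invertible a#0 in
      a⁻¹ , R.trans (R.*-congˡ (R.sym (R.trans (R.+-congˡ RP.-0#≈0#) (R.+-identityʳ _)))) p

    -- `ψ e` is idempotent, and it is not 0, as otherwise `Eλ = Eλ Eλ Eλ` would vanish by the
    -- sandwich identity. Cotransitivity makes it apart from 0, where it cancels, or from 1, where
    -- inverting `1 - ψ e` would force it to be 0.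
    ψe : ψ e R.≈ R.1#
    ψe = by-cases (#-cotrans 1#0 (ψ e))
      where
      open SetoidReasoning R.setoid
      1#0 : R.1# # R.0#
      1#0 = HeytingField.invertible⇒# K (R.1# , R.trans (R.*-identityˡ _) 1-0≈1 , R.trans
          (R.*-identityʳ _) 1-0≈1)
        where
        1-0≈1 : R.1# R.- R.0# R.≈ R.1#
        1-0≈1 = R.trans (R.+-congˡ RP.-0#≈0#) (R.+-identityʳ _)

      ψe² : ψ e R.* ψ e R.≈ ψ e
      ψe² = R.trans (R.sym (ψ-* e e)) (ψ-cong e-idem)

      ψe≉0 : ¬ ψ e R.≈ R.0#
      ψe≉0 p = Primitive.nonzero (F.≋⇒≈ (A.trans (A.sym EE) (A.trans (A.*-congˡ {Eλ} (A.sym EE))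
        (A.trans (sandwich iE) (A.trans (F.·-cong
            (R.trans (ψᶠ-cong (A.sym Φd₀)) (R.trans (ψᶠ-Φ d₀) p)) A.refl) (F.·-0 Eλ))))))

      by-cases : R.1# # ψ e ⊎ ψ e # R.0# → ψ e R.≈ R.1#
      by-cases (inj₂ ψe#0) = let h , hψ = inverse ψe#0 in begin
        ψ e  ≈⟨ R.*-identityˡ _ ⟨
        R.1# R.* ψ e  ≈⟨ R.*-congʳ hψ ⟨
        (h R.* ψ e) R.* ψ e  ≈⟨ R.*-assoc h _ _ ⟩
        h R.* (ψ e R.* ψ e)  ≈⟨ R.*-congˡ ψe² ⟩
        h R.* ψ e  ≈⟨ hψ ⟩
        R.1#  ∎
      by-cases (inj₁ 1#ψe) = contradiction (begin
        ψ e  ≈⟨ R.*-identityˡ _ ⟨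
        R.1# R.* ψ e  ≈⟨ R.*-congʳ (proj₁ (proj₂ 1-ψe⁻¹)) ⟨
        (h R.* (R.1# R.- ψ e)) R.* ψ e  ≈⟨ R.*-assoc h _ _ ⟩
        h R.* ((R.1# R.- ψ e) R.* ψ e)  ≈⟨ R.*-congˡ (R.distribʳ (ψ e) R.1# (R.- ψ e)) ⟩
        h R.* (R.1# R.* ψ e R.+ (R.- ψ e) R.* ψ e)
          ≈⟨ R.*-congˡ (R.+-cong (R.*-identityˡ _) (R.trans (R.sym (RP.-‿distribˡ-* _ _)) (R.-‿cong ψe²))) ⟩
        h R.* (ψ e R.- ψ e)  ≈⟨ R.*-congˡ (R.-‿inverseʳ (ψ e)) ⟩
        h R.* R.0#  ≈⟨ R.zeroʳ h ⟩
        R.0#  ∎) ψe≉0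
        where
        1-ψe⁻¹ = #⇒invertible 1#ψe
        h = proj₁ 1-ψe⁻¹

    Pλ : Pred KS.Algebra (c ⊔ ℓ₁)
    Pλ = P Eλ

    P-intro : ∀ s {a} → a S.≋ e KS.* ι s → Pλ a
    P-intro s p = d₀ , s , F.≋⇒≈ Φd₀ , S.≋⇒≈ p

    -- The definition of `P` allows any preimage of `Eλ` under `Φ`; all of them have the same image
    -- under `ι`, so `d₀` can replace it.
    P-elim : ∀ a → Pλ a → ∃ λ s → a S.≋ e KS.* ι s
    P-elim a (d , s , Φd , p) = s , B.trans (S.≈⇒≋ {a} {ι d KS.* ι s} p)
      (B.*-congʳ {ι s} (ι-cong (A.trans (F.≈⇒≋ {Φ d} {Eλ} Φd) (A.sym Φd₀))))

    open Submodules groupModule using (IsSubmodule; IsMaximalSubmodule; rad)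

    P-resp : ∀ {a b} → a S.≋ b → Pλ a → Pλ b
    P-resp {a} p pa = let s , q = P-elim a pa in P-intro s (B.trans (B.sym p) q)

    P-+ : ∀ a b → Pλ a → Pλ b → Pλ (a KS.+ b)
    P-+ a b pa pb =
      let s , p = P-elim a pa
          t , q = P-elim b pb
      in P-intro (λ J → s J R.+ t J) (B.trans (B.+-cong p q)
           (B.trans (B.sym (B.distribˡ e (ι s) (ι t))) (B.*-congˡ {e} (B.sym (ι-+ s t)))))

    P-· : ∀ k a → Pλ a → Pλ (k KS.· a)
    P-· k a pa =
      let s , p = P-elim a pa
      in P-intro (k ·Σ s) (B.trans (S.·-cong R.refl p)
          (B.trans (B.sym (S.·-*ʳ k e (ι s))) (B.*-congˡ {e} (B.sym (ι-· k s)))))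

    P-e : Pλ e
    P-e = P-intro d₀ (B.sym e-idem)

    P-0 : Pλ KS.0#
    P-0 = P-resp (S.·-0 e) (P-· R.0# e P-e)

    P-neg : ∀ a → Pλ a → Pλ (KS.- a)
    P-neg a pa = P-resp (B.trans (S.·-neg R.1# a) (B.-‿cong (S.·-1 a))) (P-· (R.- R.1#) a pa)

    P-* : ∀ a → Pλ a → ∀ r → Pλ (a KS.* ι r)
    P-* a pa r =
      let s , p = P-elim a pa
      in P-intro (s ⋆ r) (B.trans (B.*-congʳ {ι r} p)
          (B.trans (B.*-assoc e (ι s) (ι r)) (B.*-congˡ {e} (ι-⋆ s r))))

    -- For `a = e x` the scalar in the sandwich identity is `ψ x`, and this is `ψ a` because `ψ e`
    -- is 1.
    P-sandwich : ∀ a → Pλ a → a KS.* e S.≋ ψ a KS.· e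
    P-sandwich a pa =
      let s , p = P-elim a pa
          ψa = R.trans (ψ-cong p) (R.trans (ψ-* e (ι s)) (R.trans (R.*-congʳ ψe) (R.*-identityˡ _)))
      in B.trans (B.*-congʳ {e} p) (B.trans (e-sandwich s) (S.·-cong (R.sym ψa) B.refl))

    P⊆ : ∀ {N′ : Pred KS.Algebra (c ⊔ ℓ₁)} → IsSubmodule N′ → N′ e → ∀ {a} → Pλ a → N′ a
    P⊆ sub e∈ {a} pa = let s , p = P-elim a pa in
      IsSubmodule.resp sub (S.≋⇒≈ (B.sym p)) (IsSubmodule.*-closed sub e∈ s)

    J : Pred KS.Algebra (c ⊔ ℓ₁)
    J a = Pλ a × ψ a R.≈ R.0#

    J-isSubmodule : IsSubmodule J
    J-isSubmodule = record
      { resp     = λ {u} {v} p (pu , ψu) → P-resp (S.≈⇒≋ {u} {v} p) pu , R.trans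
            (ψ-cong (S.≈⇒≋ {v} {u} (λ w → R.sym (p w)))) ψu
      ; 0-closed = P-0 , R.refl
      ; +-closed = λ {u} {v} (pu , ψu) (pv , ψv) →
            P-+ u v pu pv , R.trans (ψ-+ u v) (R.trans (R.+-cong ψu ψv) (R.+-identityʳ _))
      ; -‿closed = λ {u} (pu , ψu) → P-neg u pu , R.trans (ψ-neg u) (R.trans (R.-‿cong ψu) RP.-0#≈0#)
      ; *-closed = λ {u} (pu , ψu) r → P-* u pu r , R.trans (ψ-* u (ι r)) (R.trans (R.*-congʳ ψu) (R.zeroˡ _))
      }

    J-isMaximal : IsMaximalSubmodule Pλ J
    J-isMaximal = record
      { isSubmodule = J-isSubmodule
      ; contained   = proj₁
      ; proper      = λ P⊆J → 1≉0 (R.trans (R.sym ψe) (proj₂ (P⊆J {e} P-e)))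
      -- By tightness it is enough to refute that `ψ a` is apart from 0. With an inverse `h` of
      -- `ψ a`, multiplying `a` by `h e` gives `e`, so `N′` would be everything.
      ; maximal     = λ N′ sub J⊆N′ N′⊆P N′≠P {a} a∈ → N′⊆P a∈ , proj₁ (tight (ψ a) R.0#) λ ψa#0 →
          let h , hψ = inverse ψa#0
          in N′≠P (P⊆ sub (IsSubmodule.resp sub (S.≋⇒≈ (begin
               a KS.* ι (h ·Σ d₀)  ≈⟨ B.*-congˡ {a} (ι-· h d₀) ⟩
               a KS.* (h KS.· e)  ≈⟨ S.·-*ʳ h a e ⟩
               h KS.· (a KS.* e)  ≈⟨ S.·-cong R.refl (P-sandwich a (N′⊆P a∈)) ⟩
               h KS.· (ψ a KS.· e)  ≈⟨ S.·-assoc h (ψ a) e ⟩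
               (h R.* ψ a) KS.· e  ≈⟨ S.·-cong hψ B.refl ⟩
               R.1# KS.· e  ≈⟨ S.·-1 e ⟩
               e  ∎)) (IsSubmodule.*-closed sub a∈ (h ·Σ d₀))))
      }
      where open SetoidReasoning B.setoid

    -- If e = u + j with u ∈ N′ and j ∈ J, then u e = e - j e = e, so N′ + J is proper when N′ is.
    J⊆maximal : ∀ {a} → J a → ∀ N′ → IsMaximalSubmodule Pλ N′ → N′ a
    J⊆maximal {a} a∈J N′ max = Max.maximal N+J N+J-isSubmodule
      (λ {u} u∈ → u , KS.0# , u∈ , IsSubmodule.0-closed J-isSubmodule , B.sym (B.+-identityʳ u))
      (λ (u , j , u∈ , (pj , _) , eq) → P-resp (B.sym eq) (P-+ u j (Max.contained u∈) pj))
      (λ P⊆ → Max.proper (e∈N⇒ (P⊆ P-e)))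
      (KS.0# , a , Sub.0-closed , a∈J , B.sym (B.+-identityˡ a))
      where
      module Max = IsMaximalSubmodule max
      module Sub = IsSubmodule Max.isSubmodule
      module J = IsSubmodule J-isSubmodule

      N+J : Pred KS.Algebra (c ⊔ ℓ₁)
      N+J a = ∃₂ λ u j → N′ u × J j × a S.≋ u KS.+ j

      open CommutativeSemigroupProperties B.+-commutativeSemigroup using (interchange)

      N+J-isSubmodule : IsSubmodule N+J
      N+J-isSubmodule = record
        { resp     = λ {a} {b} p (u , j , u∈ , j∈ , eq) →
              u , j , u∈ , j∈ , B.trans (S.≈⇒≋ {b} {a} (λ w → R.sym (p w))) eq
        ; 0-closed = KS.0# , KS.0# , Sub.0-closed , J.0-closed , B.refl
        ; +-closed = λ (u , j , u∈ , j∈ , eq) (u′ , j′ , u′∈ , j′∈ , eq′) →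
            u KS.+ u′ , j KS.+ j′ , Sub.+-closed u∈ u′∈ , J.+-closed {j} {j′} j∈ j′∈ , B.trans
                (B.+-cong eq eq′) (interchange u j u′ j′)
        ; -‿closed = λ (u , j , u∈ , j∈ , eq) →
            KS.- u , KS.- j , Sub.-‿closed u∈ , J.-‿closed {j} j∈ , B.trans (B.-‿cong eq)
                (B.sym (BP.-‿+-comm u j))
        ; *-closed = λ (u , j , u∈ , j∈ , eq) r →
            u KS.* ι r , j KS.* ι r , Sub.*-closed u∈ r , J.*-closed {j} j∈ r , B.trans (B.*-congʳ {ι r} eq)
                (B.distribʳ (ι r) u j)
        }

      e∈N⇒ : N+J e → ∀ {a} → Pλ a → N′ a
      e∈N⇒ (u , j , u∈ , (pj , ψj) , eq) = P⊆ Max.isSubmodule (Sub.resp (S.≋⇒≈ (begin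
        u KS.* e  ≈⟨ B.+-identityʳ (u KS.* e) ⟨
        u KS.* e KS.+ KS.0#
          ≈⟨ B.+-congˡ (B.trans (P-sandwich j pj) (B.trans (S.·-cong ψj B.refl) (S.·-0 e))) ⟨
        u KS.* e KS.+ j KS.* e  ≈⟨ B.distribʳ e u j ⟨
        (u KS.+ j) KS.* e  ≈⟨ B.*-congʳ {e} eq ⟨
        e KS.* e  ≈⟨ e-idem ⟩
        e  ∎)) (Sub.*-closed u∈ d₀))
        where open SetoidReasoning B.setoid

    -- `J` lies in every maximal submodule and is itself maximal, so congruence modulo the radical
    -- is equality under `ψ`; `rad-elim` is the converse direction.
    rad-intro : ∀ a b → Pλ a → Pλ b → ψ a R.≈ ψ b → rad Pλ (a KS.+ (KS.- b))
    rad-intro a b pa pb eq = proj₁ a-b∈J , J⊆maximal a-b∈J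
      where
      a-b∈J : J (a KS.+ (KS.- b))
      a-b∈J = P-+ a (KS.- b) pa (P-neg b pb)
        , R.trans (ψ-+ a (KS.- b)) (R.trans (R.+-cong eq (ψ-neg b)) (R.-‿inverseʳ (ψ b)))

    rad-elim : ∀ a b → rad Pλ (a KS.+ (KS.- b)) → ψ a R.≈ ψ b
    rad-elim a b (_ , all) = RP.x∙y⁻¹≈ε⇒x≈y (ψ a) (ψ b)
      (R.trans (R.sym (R.trans (ψ-+ a (KS.- b)) (R.+-congˡ (ψ-neg b)))) (proj₂ (all J J-isMaximal)))

    ψ-·e : ∀ k → ψ (k KS.· e) R.≈ k
    ψ-·e k = R.trans (ψ-· k e) (R.trans (R.*-congˡ ψe) (R.*-identityʳ k))

    P-·e : ∀ k → Pλ (k KS.· e)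
    P-·e k = P-· k e P-e

    κ-injective : ∀ {u v} → SignIsotypic u → SignIsotypic v → κ u R.≈ κ v → u F.≋ v
    κ-injective {u} {v} su sv eq = A.trans (sign-determined {u} su)
        (A.trans (F.·-cong eq A.refl) (A.sym (sign-determined {v} sv)))

    difference⇒ : ∀ {u v} → u KF.+ (KF.- v) KF.≈ KF.0# → u F.≋ v
    difference⇒ {u} {v} p = RingProperties.x∙y⁻¹≈ε⇒x≈y F.ring u v (F.≈⇒≋ p)

    ⇒difference : ∀ {u v} → u F.≋ v → u KF.+ (KF.- v) KF.≈ KF.0#
    ⇒difference {u} {v} p = F.≋⇒≈ (RingProperties.x≈y⇒x∙y⁻¹≈ε F.ring p)

  -- `κ` is a coordinate on the source and `ψ` one on the quotient; since `ψ e` is 1, the map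
  -- preserves coordinates. On both sides the action of `r` multiplies the coordinate by `ψ (ι r)`.
  signIsotypic≅M : signIsotypic ≅ M Eλ
  signIsotypic≅M = record
    { ⟦_⟧        = λ u → κ u KS.· e
    ; maps-into  = λ {u} _ → P-·e (κ u)
    ; ⟦⟧-cong    = λ {u} {v} _ _ p → rad-intro (κ u KS.· e) (κ v KS.· e) (P-·e (κ u)) (P-·e (κ v))
        (R.trans (ψ-·e (κ u)) (R.trans (κ-cong (difference⇒ {u} {v} p)) (R.sym (ψ-·e (κ v)))))
    ; +-homo     = λ {u} {v} _ _ → rad-intro (κ (u KF.+ v) KS.· e) (κ u KS.· e KS.+ κ v KS.· e)
        (P-·e (κ (u KF.+ v))) (P-+ (κ u KS.· e) (κ v KS.· e) (P-·e (κ u)) (P-·e (κ v)))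
        (R.trans (ψ-·e (κ (u KF.+ v))) (R.trans (∑-++ u v _)
          (R.sym (R.trans (ψ-+ (κ u KS.· e) (κ v KS.· e)) (R.+-cong (ψ-·e (κ u)) (ψ-·e (κ v)))))))
    ; *-homo     = λ {u} su r → rad-intro (κ (Φ r KF.* u) KS.· e) ((κ u KS.· e) KS.* ι r)
        (P-·e (κ (Φ r KF.* u))) (P-* (κ u KS.· e) (P-·e (κ u)) r)
        (R.trans (ψ-·e (κ (Φ r KF.* u))) (R.trans (κ-Φ* r {u} su)
          (R.sym (R.trans (ψ-* (κ u KS.· e) (ι r)) (R.*-congʳ (ψ-·e (κ u)))))))
    ; injective  = λ {u} {v} su sv r → ⇒difference {u} {v} (κ-injective {u} {v} su sv
        (R.trans (R.sym (ψ-·e (κ u))) (R.trans (rad-elim (κ u KS.· e) (κ v KS.· e) r) (ψ-·e (κ v)))))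
    -- The preimage with coordinate `ψ a`; its value need only agree with `a` under `ψ`.
    ; surjective = λ {a} pa → ψ a KF.· s₀ , s₀-sign (ψ a) , rad-intro (κ (ψ a KF.· s₀) KS.· e) a
          (P-·e (κ (ψ a KF.· s₀))) pa
        (R.trans (ψ-·e (κ (ψ a KF.· s₀))) (R.trans (coeff-· (ψ a) s₀ c₀)
            (R.trans (R.*-congˡ κ-s₀) (R.*-identityʳ _))))
    }

proposition4p6 : ∀ {c ℓ₁ ℓ₂} (K : HeytingField c ℓ₁ ℓ₂) →
    CharacteristicZero K → AlgebraicallyClosed K →
    ∀ (m : ℕ) → let open FaceAlgebra K m in
    (Ê : Π (suc m) → KF.Algebra) → IsSaliolaFamily Ê →
    (E : Partition (suc m) → KF.Algebra) → IsInvariantFamily Ê E →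
    signIsotypic ≅ M (E (twosPartition (suc m)))
proposition4p6 K char0 _ m Ê saliola E family = signIsotypic≅M K char0 m Ê saliola E family
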